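{- Let $t$ be a positive integer and let $\mathcal{F}_{sim}(t)$ be the $3$-graph defined below. For sufficiently large $n$, $$\mathrm{ex}_3(n,\mathcal{F}_{sim}(t))=\max_{a+b+c=n-t}\left\{abc+t\left(\binom{a}{2}+\binom{b}{2}+\binom{c}{2}\right)\right\}+\binom{t}{3},$$ where the maximum is over positive integers $a,b,c$. The maximum is achieved when $a,b,c$ differ pairwise by at most $1$. Moreover, an $n$-vertex $\mathcal{F}_{sim}(t)$-free $3$-graph has exactly this many hyperedges if and only if it is the following $3$-graph: take the complete $3$-partite $3$-graph $T_3(n-t,3)$ and a disjoint set $Q$ of $t$ further vertices; the hyperedges are those of $T_3(n-t,3)$, all triples inside $Q$, and all triples $\{q,x,y\}$ with $q\in Q$ and $x,y$ two vertices lying in the same part of $T_3(n-t,3)$.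
   Context: All hypergraphs are $3$-uniform. $\mathrm{ex}_3(n,\mathcal{F})$ is the maximum number of hyperedges in an $n$-vertex $3$-graph with no copy of $\mathcal{F}$ as a subhypergraph. $T_3(N,3)$ is the complete $3$-partite $3$-graph on $N$ vertices (hyperedges are triples with one vertex in each part) with part sizes $\lfloor N/3\rfloor$ or $\lceil N/3\rceil$. $\mathcal{F}_{sim}(t)$ is the $3$-graph with vertices $f_1,\dots,f_7,g_1,\dots,g_t$ and hyperedges $f_1f_2f_3$, $f_1f_2f_4$, $f_3f_4f_5$, $f_5f_6f_7$, and $f_6f_7g_i$ for $i=1,\dots,t$ (i.e. the $3$-graph $\{f_1f_2f_3,f_1f_2f_4,f_3f_4f_5,f_5f_6f_7,f_6f_7f_8\}$ with the vertex $f_8$ blown up into $t$ copies). -}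

module Defs where

open import Data.Nat using (ℕ; zero; suc; _+_; _*_; _∸_; _≤_; _<_; _⊔_; _<ᵇ_; _≡ᵇ_; _%_)
open import Data.Nat.Combinatorics using (_C_)
open import Data.Bool using (Bool; true; false; _∧_; _∨_; if_then_else_; not)
open import Data.Fin using (Fin; toℕ; _↑ˡ_; _↑ʳ_; zero; suc)
open import Data.List using (List; []; _∷_; concatMap; map; foldr; allFin; upTo)
open import Data.Nat.ListAction using (sum)
open import Data.Product using (Σ; _×_; _,_)
open import Data.Sum using (_⊎_)
open import Relation.Binary.PropositionalEquality using (_≡_)
open import Relation.Nullary using (¬_)
open import Function.Definitions using (Injective)
open import Function.Bundles using (_↔_; Inverse)

-- 3-graphs on the vertex set Fin n.
-- A 3-graph is given by a Boolean function E; only its values on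
-- strictly increasing triples x < y < z matter: the hyperedge {x,y,z}
-- (x<y<z) is present iff E x y z ≡ true.

Graph3 : ℕ → Set
Graph3 n = Fin n → Fin n → Fin n → Bool

data IncEdge {n : ℕ} (E : Graph3 n) : Fin n → Fin n → Fin n → Set where
  mk : ∀ {x y z} → toℕ x < toℕ y → toℕ y < toℕ z → E x y z ≡ true →
       IncEdge E x y z

Edge : {n : ℕ} → Graph3 n → Fin n → Fin n → Fin n → Set
Edge E a b c =
  IncEdge E a b c ⊎ IncEdge E a c b ⊎ IncEdge E b a c ⊎
  IncEdge E b c a ⊎ IncEdge E c a b ⊎ IncEdge E c b a

numEdges : {n : ℕ} → Graph3 n → ℕ
numEdges {n} E =
  sum (concatMap (λ x → concatMap (λ y → map (λ z →
         if (toℕ x <ᵇ toℕ y) ∧ (toℕ y <ᵇ toℕ z) ∧ E x y z then 1 else 0)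
       (allFin n)) (allFin n)) (allFin n))

fv : (t : ℕ) → Fin 7 → Fin (7 + t)
fv t k = k ↑ˡ t

f1 f2 f3 f4 f5 f6 f7 : (t : ℕ) → Fin (7 + t)
f1 t = fv t zero
f2 t = fv t (suc zero)
f3 t = fv t (suc (suc zero))
f4 t = fv t (suc (suc (suc zero)))
f5 t = fv t (suc (suc (suc (suc zero))))
f6 t = fv t (suc (suc (suc (suc (suc zero)))))
f7 t = fv t (suc (suc (suc (suc (suc (suc zero))))))

gv : (t : ℕ) → Fin t → Fin (7 + t)
gv t i = 7 ↑ʳ i

data FsimEdge (t : ℕ) : Fin (7 + t) → Fin (7 + t) → Fin (7 + t) → Set where
  e123 : FsimEdge t (f1 t) (f2 t) (f3 t)
  e124 : FsimEdge t (f1 t) (f2 t) (f4 t)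
  e345 : FsimEdge t (f3 t) (f4 t) (f5 t)
  e567 : FsimEdge t (f5 t) (f6 t) (f7 t)
  e67g : (i : Fin t) → FsimEdge t (f6 t) (f7 t) (gv t i)

ContainsFsim : (t : ℕ) {n : ℕ} → Graph3 n → Set
ContainsFsim t {n} E =
  Σ (Fin (7 + t) → Fin n) λ φ →
    Injective _≡_ _≡_ φ ×
    (∀ a b c → FsimEdge t a b c → Edge E (φ a) (φ b) (φ c))

FsimFree : (t : ℕ) {n : ℕ} → Graph3 n → Set
FsimFree t E = ¬ ContainsFsim t E

objective : ℕ → ℕ → ℕ → ℕ → ℕ
objective t a b c = a * b * c + t * (a C 2 + b C 2 + c C 2)

-- max over positive a, b, c with a + b + c = m of objective t a b c
-- (0 if there are no such triples, i.e. m < 3)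
maxObjective : ℕ → ℕ → ℕ
maxObjective m t =
  foldr _⊔_ 0
    (concatMap (λ a → map (λ b →
        if (0 <ᵇ a) ∧ (0 <ᵇ b) ∧ (a + b <ᵇ m)
        then objective t a b (m ∸ (a + b)) else 0)
      (upTo (suc m))) (upTo (suc m)))

exValue : ℕ → ℕ → ℕ
exValue n t = maxObjective (n ∸ t) t + t C 3

ExEquals : ℕ → ℕ → ℕ → Set
ExEquals n t v =
  (Σ (Graph3 n) λ E → FsimFree t E × numEdges E ≡ v) ×
  (∀ (E : Graph3 n) → FsimFree t E → numEdges E ≤ v)

-- The extremal construction on Fin n: vertices with index < t form Q;
-- a vertex v with index ≥ t lies in part (index v ∸ t) mod 3 of
-- T_3(n - t, 3) (part sizes are floor/ceil of (n-t)/3).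

inQ : {n : ℕ} → ℕ → Fin n → Bool
inQ t v = toℕ v <ᵇ t

part : {n : ℕ} → ℕ → Fin n → ℕ
part t v = (toℕ v ∸ t) % 3

distinct3 : {n : ℕ} → Fin n → Fin n → Fin n → Bool
distinct3 x y z =
  not (toℕ x ≡ᵇ toℕ y) ∧ not (toℕ y ≡ᵇ toℕ z) ∧ not (toℕ x ≡ᵇ toℕ z)

pairSame : {n : ℕ} → ℕ → Fin n → Fin n → Bool
pairSame t x y = not (inQ t x) ∧ not (inQ t y) ∧ (part t x ≡ᵇ part t y)

allDiffParts : {n : ℕ} → ℕ → Fin n → Fin n → Fin n → Bool
allDiffParts t x y z =
  not (part t x ≡ᵇ part t y) ∧ not (part t y ≡ᵇ part t z) ∧
  not (part t x ≡ᵇ part t z)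

consEdge : (n t : ℕ) → Fin n → Fin n → Fin n → Bool
consEdge n t x y z =
  distinct3 x y z ∧
  ( (inQ t x ∧ inQ t y ∧ inQ t z)
  ∨ (inQ t x ∧ pairSame t y z)
  ∨ (inQ t y ∧ pairSame t x z)
  ∨ (inQ t z ∧ pairSame t x y)
  ∨ (not (inQ t x) ∧ not (inQ t y) ∧ not (inQ t z) ∧ allDiffParts t x y z))

IsoToConstruction : (n t : ℕ) → Graph3 n → Set
IsoToConstruction n t E =
  Σ (Fin n ↔ Fin n) λ σ →
    ∀ x y z → toℕ x < toℕ y → toℕ y < toℕ z →
      E x y z ≡ consEdge n t (Inverse.to σ x) (Inverse.to σ y) (Inverse.to σ z)

-- Deleting the edges through pairs of codegree below t + 6 costs O(n²) edges and leaves a graph in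
-- which no common neighbourhood N(uv) contains two vertices of a common edge: otherwise F_sim(t)
-- could be completed greedily. So for an edge xyz the sets N(xy), N(yz), N(xz) are disjoint and
-- independent in the shadow. Let T and S be the numbers of ordered edges and of ordered shadow pairs.
-- Cauchy–Schwarz gives an edge with 3T ≤ Sσ, where σ = |N(xy)| + |N(yz)| + |N(xz)|, and independence
-- gives 3S ≤ 3n² - σ². Thus 9T ≤ σ(3n² - σ²), and since T is about 2n³/9 this forces σ ≥ n - O(√n):
-- the three sets nearly partition the vertices and nearly all crossing triples are edges.
--
-- Relative to this partition a vertex is of one of three kinds. If it lies in many edges with two
-- vertices of one part, it is the vertex f₅ of many copies of {f₁f₂f₃, f₁f₂f₄, f₃f₄f₅}, so every pair
-- in its link has codegree at most t. Otherwise its link consists of almost all pairs across two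
-- parts, or its degree is too small by a quadratic amount. Having a vertex of the last kind, or a
-- number of vertices of the first kind other than t, loses quadratically many edges; in the remaining
-- case every deviation from the construction loses some edge.
--
-- Colour Q by 0 and the three parts by the nonzero elements of the Klein four-group. The edges of the
-- construction are then the triples of colour sum 0, which makes it plain that it is F_sim(t)-free.
{-# OPTIONS --safe #-}
module Submission where

open import Defs
open import Data.Nat
open import Data.Nat.Properties
open import Data.Nat.DivMod using (m%n<n; m≡m%n+[m/n]*n; m/n*n≤m; m*n/n≡m; /-monoˡ-≤)
open import Data.Nat.Tactic.RingSolver using (solve-∀)
open import Algebra.Properties.Semiring.Sum +-*-semiring
  using (sum; sum-remove; ∑-distrib-+; ∑-comm; ∑-permute; sum-cong-≗; *-distribˡ-sum; *-distribʳ-sum)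
open import Data.Bool using (Bool; true; false; _∧_; _∨_; not; if_then_else_)
open import Data.Bool.Properties using (∧-conicalˡ; ∧-conicalʳ; T-≡; ¬-not; ∨-identityʳ; ∧-identityʳ; ∧-zeroʳ; ∧-comm; ∧-assoc)
open import Data.Fin using (Fin; zero; suc; toℕ; punchIn)
import Data.Fin.Properties as Fin
open import Data.Fin.Permutation using (Permutation; _⟨$⟩ʳ_)
import Data.Fin.Permutation as Perm
open import Data.List using (List; []; _∷_; length; map; concatMap; allFin; tabulate; upTo; foldr)
open import Data.Nat.ListAction using () renaming (sum to sumᴸ)
open import Data.Nat.ListAction.Properties using (sum-++)
open import Data.Bool.Solver using (module ∨-∧-Solver)
open import Data.List.Relation.Unary.All using (All; []; _∷_)
import Data.List.Relation.Unary.All as All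
import Data.List.Relation.Unary.All.Properties as All
open import Data.List.Properties using (length-tabulate)
open import Data.List.Relation.Unary.Any using (here; there)
import Data.List.Relation.Unary.Any as Any
open import Data.List.Membership.Propositional using (_∈_; find)
open import Data.List.Membership.Propositional.Properties
  using (∈-concatMap⁺; ∈-concatMap⁻; ∈-map⁺; ∈-map⁻; ∈-upTo⁺; foldr-selective)
open import Data.Nat.Combinatorics using (_C_; nCk+nC[k+1]≡[n+1]C[k+1]; nC1≡n)
open import Data.Product using (Σ; ∃; ∃₂; _×_; _,_; proj₁; proj₂)
open import Data.Sum using (_⊎_; inj₁; inj₂)
open import Data.Empty using (⊥; ⊥-elim)
open import Data.Vec.Functional using () renaming (_∷_ to _◃_)
open import Function using (_∘_; Injective; id; case_of_)
open import Function.Bundles using (_⇔_; mk⇔; Equivalence)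
open import Relation.Binary.Definitions using (tri<; tri≈; tri>)
open import Relation.Nullary.Decidable using (_×-dec_)
open import Relation.Nullary using (¬_; Dec; yes; no; does; contradiction)
open import Relation.Binary.PropositionalEquality

-- The partition settles all but `u` vertices, where `u` is a small fixed fraction of n. This
-- separates the scales: the leftover δ is only O(√n), so for large n an error of order δ n² is
-- below u² n, while the deficit of a single vertex is measured in units of u n, and n² exceeds
-- every multiple of u n that is needed. The vertices of Q are among the unsettled ones, and their
-- number w is not known beforehand. The construction with w vertices in Q dominates the graph pair
-- by pair, which settles w ≤ t. For w > t this comparison is too weak, since that construction
-- exceeds the claimed bound; there a coarser count is used in which a pair inside a part has at
-- most t neighbours in Q. Only graphs with at least the claimed number of edges are analysed. For
-- them the structure and hence equality follow, so the upper bound and the uniqueness come from one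
-- argument. Since subtraction on ℕ truncates, polynomial inequalities are stated with sums on both
-- sides and proved by ring identities with an explicit nonnegative slack.

private variable
  n : ℕ

-- Finite sums and counting

-- A certificate: the identity says that r - l is R - L plus the slack `s`. A polynomial inequality
-- thus becomes a weighted sum `L ≤ R` of known ones and a ring identity free of subtraction.
lin : ∀ {l r L R} s → L ≤ R → l + R + s ≡ r + L → l ≤ r
lin {l} {r} {L} {R} s L≤R e = +-cancelʳ-≤ R l r
  (≤-trans (m≤m+n (l + R) s) (≤-trans (≤-reflexive e) (+-monoʳ-≤ r L≤R)))

⟦_⟧ : Bool → ℕ
⟦ true ⟧ = 1
⟦ false ⟧ = 0

⟦⟧-mono : ∀ {a b} → (a ≡ true → b ≡ true) → ⟦ a ⟧ ≤ ⟦ b ⟧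
⟦⟧-mono {false} f = z≤n
⟦⟧-mono {true}  f rewrite f refl = ≤-refl

⟦⟧-≤1 : ∀ b → ⟦ b ⟧ ≤ 1
⟦⟧-≤1 true  = ≤-refl
⟦⟧-≤1 false = z≤n

⟦⟧-pos : ∀ {b} → 0 < ⟦ b ⟧ → b ≡ true
⟦⟧-pos {true} _ = refl

⟦⟧-∧ : ∀ a b → ⟦ a ∧ b ⟧ ≡ ⟦ a ⟧ * ⟦ b ⟧
⟦⟧-∧ true  b = sym (+-identityʳ ⟦ b ⟧)
⟦⟧-∧ false b = refl

⟦⟧-split : ∀ a b → ⟦ a ⟧ ≡ ⟦ a ∧ b ⟧ + ⟦ a ∧ not b ⟧
⟦⟧-split true  true  = refl
⟦⟧-split true  false = refl
⟦⟧-split false b     = refl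

∧-true : ∀ {a b} → a ≡ true → b ≡ true → a ∧ b ≡ true
∧-true refl refl = refl

∧-trueˡ : ∀ {a b} → a ∧ b ≡ true → a ≡ true
∧-trueˡ = ∧-conicalˡ _ _

∧-trueʳ : ∀ {a b} → a ∧ b ≡ true → b ≡ true
∧-trueʳ {a} {b} = ∧-conicalʳ a b

not-true : ∀ {a} → not a ≡ true → a ≡ false
not-true {false} _ = refl

true≢false : {A : Set} {a : Bool} → a ≡ true → a ≡ false → A
true≢false refl ()

opaque
  ∑ : (Fin n → ℕ) → ℕ
  ∑ = sum

  ∑-empty : (f : Fin 0 → ℕ) → ∑ f ≡ 0
  ∑-empty f = refl

  ∑-suc : (f : Fin (suc n) → ℕ) → ∑ f ≡ f zero + ∑ (f ∘ suc)
  ∑-suc f = refl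

  ∑-+ : (f g : Fin n → ℕ) → ∑ (λ i → f i + g i) ≡ ∑ f + ∑ g
  ∑-+ = ∑-distrib-+

  ∑-swap : (f : Fin n → Fin n → ℕ) → ∑ (λ x → ∑ (λ y → f y x)) ≡ ∑ (λ x → ∑ (f x))
  ∑-swap f = ∑-comm (λ x y → f y x)

  ∑-perm : (f : Fin n → ℕ) (π : Permutation n n) → ∑ (λ i → f (π ⟨$⟩ʳ i)) ≡ ∑ f
  ∑-perm f π = sym (∑-permute f π)

  ∑-remove : (f : Fin (suc n) → ℕ) (i : Fin (suc n)) → ∑ f ≡ f i + ∑ (λ j → f (punchIn i j))
  ∑-remove f i = sum-remove {i = i} f

  ∑-cong : {f g : Fin n → ℕ} → (∀ i → f i ≡ g i) → ∑ f ≡ ∑ g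
  ∑-cong = sum-cong-≗

  ∑-*ˡ : ∀ k (f : Fin n → ℕ) → ∑ (λ i → k * f i) ≡ k * ∑ f
  ∑-*ˡ k f = sym (*-distribˡ-sum k f)

  ∑-*ʳ : ∀ k (f : Fin n → ℕ) → ∑ (λ i → f i * k) ≡ ∑ f * k
  ∑-*ʳ k f = sym (*-distribʳ-sum k f)

  ∑-mono : {f g : Fin n → ℕ} → (∀ i → f i ≤ g i) → ∑ f ≤ ∑ g
  ∑-mono {zero}  f≤g = z≤n
  ∑-mono {suc n} f≤g = +-mono-≤ (f≤g zero) (∑-mono (λ i → f≤g (suc i)))

  -- The device that turns extremality into structure: if the sums leave no room, no single term
  -- does.
  ∑-tight : {f g : Fin n → ℕ} → (∀ i → f i ≤ g i) → ∑ g ≤ ∑ f → ∀ i → f i ≡ g i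
  ∑-tight {suc n} {f} {g} f≤g ge zero = ≤-antisym (f≤g zero)
    (+-cancelʳ-≤ (∑ (f ∘ suc)) _ _
      (≤-trans (+-monoʳ-≤ (g zero) (∑-mono (λ i → f≤g (suc i)))) ge))
  ∑-tight {suc n} {f} {g} f≤g ge (suc i) = ∑-tight {f = f ∘ suc} {g ∘ suc} (λ j → f≤g (suc j))
    (+-cancelˡ-≤ (f zero) _ _ (≤-trans (+-monoˡ-≤ _ (f≤g zero)) ge)) i

  ∑-const : ∀ n k → ∑ {n} (λ _ → k) ≡ n * k
  ∑-const zero    k = refl
  ∑-const (suc n) k = cong (k +_) (∑-const n k)

  ∑-witness : (f g : Fin n → ℕ) → ∑ f < ∑ g → ∃ λ i → f i < g i
  ∑-witness {suc n} f g lt with f zero <? g zero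
  ... | yes p = zero , p
  ... | no ¬p with ∑-witness (f ∘ suc) (g ∘ suc)
                     (+-cancelˡ-< (f zero) _ _ (<-≤-trans lt (+-monoˡ-≤ _ (≮⇒≥ ¬p))))
  ...   | i , q = suc i , q

  ≤∑ : (f : Fin n → ℕ) (i : Fin n) → f i ≤ ∑ f
  ≤∑ f zero    = m≤m+n _ _
  ≤∑ f (suc i) = ≤-trans (≤∑ (f ∘ suc) i) (m≤n+m _ _)

∑-zero : (f : Fin n → ℕ) → (∀ i → f i ≡ 0) → ∑ f ≡ 0
∑-zero {n} f e = trans (∑-cong e) (trans (∑-const n 0) (*-zeroʳ n))

∑-bound : {f : Fin n → ℕ} (k : ℕ) → (∀ i → f i ≤ k) → ∑ f ≤ n * k
∑-bound {n} k f≤k = ≤-trans (∑-mono f≤k) (≤-reflexive (∑-const n k))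

∑₂ : (Fin n → Fin n → ℕ) → ℕ
∑₂ f = ∑ λ x → ∑ (f x)

∑₃ : (Fin n → Fin n → Fin n → ℕ) → ℕ
∑₃ f = ∑ λ x → ∑₂ (f x)

∑₂-cong : {f g : Fin n → Fin n → ℕ} → (∀ x y → f x y ≡ g x y) → ∑₂ f ≡ ∑₂ g
∑₂-cong e = ∑-cong λ x → ∑-cong (e x)

∑₃-cong : {f g : Fin n → Fin n → Fin n → ℕ} → (∀ x y z → f x y z ≡ g x y z) → ∑₃ f ≡ ∑₃ g
∑₃-cong e = ∑-cong λ x → ∑₂-cong (e x)

∑₂-mono : {f g : Fin n → Fin n → ℕ} → (∀ x y → f x y ≤ g x y) → ∑₂ f ≤ ∑₂ g
∑₂-mono e = ∑-mono λ x → ∑-mono (e x)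

∑₃-mono : {f g : Fin n → Fin n → Fin n → ℕ} → (∀ x y z → f x y z ≤ g x y z) → ∑₃ f ≤ ∑₃ g
∑₃-mono e = ∑-mono λ x → ∑₂-mono (e x)

∑₂-+ : (f g : Fin n → Fin n → ℕ) → ∑₂ (λ x y → f x y + g x y) ≡ ∑₂ f + ∑₂ g
∑₂-+ f g = trans (∑-cong λ x → ∑-+ (f x) (g x)) (∑-+ _ _)

∑₃-+ : (f g : Fin n → Fin n → Fin n → ℕ) → ∑₃ (λ x y z → f x y z + g x y z) ≡ ∑₃ f + ∑₃ g
∑₃-+ f g = trans (∑-cong λ x → ∑₂-+ (f x) (g x)) (∑-+ _ _)

∑₂-*ˡ : ∀ k (f : Fin n → Fin n → ℕ) → ∑₂ (λ x y → k * f x y) ≡ k * ∑₂ f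
∑₂-*ˡ k f = trans (∑-cong λ x → ∑-*ˡ k (f x)) (∑-*ˡ k _)

∑₃-*ˡ : ∀ k (f : Fin n → Fin n → Fin n → ℕ) → ∑₃ (λ x y z → k * f x y z) ≡ k * ∑₃ f
∑₃-*ˡ k f = trans (∑-cong λ x → ∑₂-*ˡ k (f x)) (∑-*ˡ k _)

∑₂-swap : (f : Fin n → Fin n → ℕ) → ∑₂ (λ x y → f y x) ≡ ∑₂ f
∑₂-swap f = ∑-swap f

∑₃-swap₁₂ : (f : Fin n → Fin n → Fin n → ℕ) → ∑₃ (λ x y z → f y x z) ≡ ∑₃ f
∑₃-swap₁₂ f = ∑-swap λ x y → ∑ (f x y)

∑₃-swap₂₃ : (f : Fin n → Fin n → Fin n → ℕ) → ∑₃ (λ x y z → f x z y) ≡ ∑₃ f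
∑₃-swap₂₃ f = ∑-cong λ x → ∑₂-swap (f x)

# : (Fin n → Bool) → ℕ
# p = ∑ (⟦_⟧ ∘ p)

#₂ : (Fin n → Fin n → Bool) → ℕ
#₂ p = ∑₂ λ x y → ⟦ p x y ⟧

#-mono : {p q : Fin n → Bool} → (∀ i → p i ≡ true → q i ≡ true) → # p ≤ # q
#-mono f = ∑-mono λ i → ⟦⟧-mono (f i)

∑∑-product : (f g : Fin n → ℕ) → ∑₂ (λ x y → f x * g y) ≡ ∑ f * ∑ g
∑∑-product f g = trans (∑-cong λ x → ∑-*ˡ (f x) g) (∑-*ʳ (∑ g) f)

#-witness : (p : Fin n → Bool) → 0 < # p → ∃ λ x → p x ≡ true
#-witness {n} p lt with ∑-witness (λ _ → 0) (⟦_⟧ ∘ p) (≤-trans (s≤s (≤-reflexive (trans (∑-const n 0) (*-zeroʳ n)))) lt)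
... | i , q = i , ⟦⟧-pos q

infix 4 _==_ _≠_

_==_ : Fin n → Fin n → Bool
x == y = does (x Fin.≟ y)

_≠_ : Fin n → Fin n → Bool
x ≠ y = not (x == y)

==⇒≡ : {x y : Fin n} → (x == y) ≡ true → x ≡ y
==⇒≡ {x = x} {y} e with x Fin.≟ y
... | yes p = p

==-refl : (x : Fin n) → (x == x) ≡ true
==-refl x with x Fin.≟ x
... | yes _ = refl
... | no ¬p = contradiction refl ¬p

≠⇒≢ : {x y : Fin n} → (x ≠ y) ≡ true → x ≢ y
≠⇒≢ {x = x} e refl rewrite ==-refl x = case e of λ ()

≢⇒≠ : {x y : Fin n} → x ≢ y → (x ≠ y) ≡ true
≢⇒≠ {x = x} {y} ne with x Fin.≟ y
... | yes p = contradiction p ne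
... | no _  = refl

#-== : (x : Fin n) → # (_== x) ≡ 1
#-== {suc n} zero = trans (∑-suc _) (cong suc (∑-zero (λ (i : Fin n) → ⟦ suc i == zero ⟧) (λ _ → refl)))
#-== (suc x)      = trans (∑-suc _) (#-== x)

#-remove : (p : Fin n → Bool) (x : Fin n) → # p ≤ suc (# λ y → p y ∧ (y ≠ x))
#-remove p x = begin
  # p                                                      ≤⟨ ∑-mono (λ y → split (p y) (y == x)) ⟩
  ∑ (λ y → ⟦ y == x ⟧ + ⟦ p y ∧ (y ≠ x) ⟧)                  ≡⟨ ∑-+ _ _ ⟩
  # (_== x) + # (λ y → p y ∧ (y ≠ x))                       ≡⟨ cong₂ _+_ (#-== x) refl ⟩
  suc (# λ y → p y ∧ (y ≠ x))                               ∎
  where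
  open ≤-Reasoning
  split : ∀ a b → ⟦ a ⟧ ≤ ⟦ b ⟧ + ⟦ a ∧ not b ⟧
  split true  true  = ≤-refl
  split true  false = ≤-refl
  split false b     = z≤n

Avoids : List (Fin n) → Fin n → Set
Avoids L x = All (x ≢_) L

pick : (p : Fin n → Bool) (L : List (Fin n)) → length L < # p →
       ∃ λ x → p x ≡ true × Avoids L x
pick p []      lt with #-witness p lt
... | x , e = x , e , []
pick p (a ∷ L) lt with pick (λ y → p y ∧ (y ≠ a)) L (≤-pred (≤-trans lt (#-remove p a)))
... | x , e , avoid = x , ∧-trueˡ e , ≠⇒≢ (∧-trueʳ e) ∷ avoid

◃-injective : ∀ {k} {x : Fin n} {g : Fin k → Fin n} →
              (∀ i → x ≢ g i) → Injective _≡_ _≡_ g → Injective _≡_ _≡_ (x ◃ g)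
◃-injective x∉g inj {zero}  {zero}  e = refl
◃-injective x∉g inj {zero}  {suc j} e = contradiction e (x∉g j)
◃-injective x∉g inj {suc i} {zero}  e = contradiction (sym e) (x∉g i)
◃-injective x∉g inj {suc i} {suc j} e = cong suc (inj e)

◃-avoids : ∀ {k} {x y : Fin n} {g : Fin k → Fin n} →
           x ≢ y → (∀ i → x ≢ g i) → ∀ i → x ≢ (y ◃ g) i
◃-avoids x≢y x∉g zero    = x≢y
◃-avoids x≢y x∉g (suc i) = x∉g i

pickMany : ∀ k (p : Fin n → Bool) (L : List (Fin n)) → k + length L ≤ # p →
           ∃ λ (g : Fin k → Fin n) → Injective _≡_ _≡_ g ×
             (∀ i → p (g i) ≡ true) × (∀ i → Avoids L (g i))
pickMany zero    p L le = (λ ()) , (λ { {()} }) , (λ ()) , λ ()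
pickMany (suc k) p L le with pick p L (≤-trans (s≤s (m≤n+m (length L) k)) le)
... | x , px , x∉L with pickMany k p (x ∷ L) (≤-trans (≤-reflexive (+-suc k _)) le)
...   | g , inj , pg , g∉ = x ◃ g
        , ◃-injective (λ i e → case g∉ i of λ { (g≢x ∷ _) → g≢x (sym e) }) inj
        , (λ { zero → px ; (suc i) → pg i })
        , (λ { zero → x∉L ; (suc i) → case g∉ i of λ { (_ ∷ r) → r } })

#₂-remove : (p : Fin n → Fin n → Bool) (a : Fin n) →
            #₂ p ≤ 2 * n + #₂ (λ x y → p x y ∧ ((x ≠ a) ∧ (y ≠ a)))
#₂-remove {n} p a = begin
  #₂ p
    ≤⟨ ∑₂-mono (λ x y → split (p x y) (x == a) (y == a)) ⟩
  ∑₂ (λ x y → (⟦ x == a ⟧ + ⟦ y == a ⟧) + ⟦ p x y ∧ ((x ≠ a) ∧ (y ≠ a)) ⟧)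
    ≡⟨ trans (∑₂-+ _ _) (cong₂ _+_ (trans (∑₂-+ _ _) (cong₂ _+_ left right)) refl) ⟩
  (n + n) + #₂ (λ x y → p x y ∧ ((x ≠ a) ∧ (y ≠ a)))
    ≡⟨ cong₂ _+_ (cong (n +_) (sym (+-identityʳ n))) refl ⟩
  2 * n + #₂ (λ x y → p x y ∧ ((x ≠ a) ∧ (y ≠ a)))
    ∎
  where
  open ≤-Reasoning
  split : ∀ u v w → ⟦ u ⟧ ≤ (⟦ v ⟧ + ⟦ w ⟧) + ⟦ u ∧ (not v ∧ not w) ⟧
  split false v     w     = z≤n
  split true  true  w     = s≤s z≤n
  split true  false true  = s≤s z≤n
  split true  false false = ≤-refl
  right : ∑₂ (λ (x y : Fin n) → ⟦ y == a ⟧) ≡ n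
  right = trans (∑-cong λ _ → #-== a) (trans (∑-const n 1) (*-identityʳ n))
  left : ∑₂ (λ (x y : Fin n) → ⟦ x == a ⟧) ≡ n
  left = trans (∑₂-swap (λ x y → ⟦ y == a ⟧)) right

-- An avoided vertex meets at most `2 * n` ordered pairs, so the list rules out at most its length
-- times `2 * n` of them.
pickPair : (p : Fin n → Fin n → Bool) (L : List (Fin n)) → length L * (2 * n) < #₂ p →
           ∃₂ λ x y → p x y ≡ true × Avoids L x × Avoids L y
pickPair {n} p [] lt with ∑-witness (λ _ → 0) (λ x → # (p x))
  (≤-trans (s≤s (≤-reflexive (trans (∑-const n 0) (*-zeroʳ n)))) lt)
... | x , lt′ with #-witness (p x) lt′
...   | y , e = x , y , e , [] , []
pickPair {n} p (a ∷ L) lt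
  with pickPair (λ x y → p x y ∧ ((x ≠ a) ∧ (y ≠ a))) L
         (+-cancelˡ-< (2 * n) _ _ (<-≤-trans lt (#₂-remove p a)))
... | x , y , e , x∉ , y∉ = x , y , ∧-trueˡ e
  , ≠⇒≢ (∧-trueˡ (∧-trueʳ {p x y} e)) ∷ x∉ , ≠⇒≢ (∧-trueʳ {x ≠ a} (∧-trueʳ {p x y} e)) ∷ y∉

#-remove-≥ : (p : Fin n → Bool) (x : Fin n) → p x ≡ true → suc (# λ y → p y ∧ (y ≠ x)) ≤ # p
#-remove-≥ p x px = begin
  suc (# λ y → p y ∧ (y ≠ x))                   ≡⟨ cong (_+ # (λ y → p y ∧ (y ≠ x))) (sym (#-== x)) ⟩
  # (_== x) + # (λ y → p y ∧ (y ≠ x))           ≡⟨ ∑-+ _ _ ⟨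
  ∑ (λ y → ⟦ y == x ⟧ + ⟦ p y ∧ (y ≠ x) ⟧)      ≤⟨ ∑-mono (λ y → join y (y == x) refl) ⟩
  # p                                           ∎
  where
  open ≤-Reasoning
  join : ∀ y b → (y == x) ≡ b → ⟦ b ⟧ + ⟦ p y ∧ not b ⟧ ≤ ⟦ p y ⟧
  join y true  e rewrite ==⇒≡ {x = y} e | px = ≤-refl
  join y false e with p y
  ... | true  = ≤-refl
  ... | false = z≤n

injection-≤# : ∀ {k} (g : Fin k → Fin n) → Injective _≡_ _≡_ g →
               (p : Fin n → Bool) → (∀ i → p (g i) ≡ true) → k ≤ # p
injection-≤# {k = zero}  g inj p pg = z≤n
injection-≤# {k = suc k} g inj p pg = ≤-trans
  (s≤s (injection-≤# (λ i → g (suc i)) (λ e → Fin.suc-injective (inj e)) (λ y → p y ∧ (y ≠ g zero))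
         (λ i → ∧-true (pg (suc i)) (≢⇒≠ λ e → case inj e of λ ()))))
  (#-remove-≥ p (g zero) (pg zero))

-- 3-graphs as symmetric Boolean functions, counted by ordered triples

toℕ-<ᵇ : {x y : Fin n} → toℕ x < toℕ y → (toℕ x <ᵇ toℕ y) ≡ true
toℕ-<ᵇ lt = Equivalence.to T-≡ (<⇒<ᵇ lt)

record Is3Graph (h : Graph3 n) : Set where
  field
    swap₁₂   : ∀ x y z → h x y z ≡ h y x z
    swap₂₃   : ∀ x y z → h x y z ≡ h x z y
    loopless : ∀ x z → h x x z ≡ false

  rotate : ∀ x y z → h x y z ≡ h y z x
  rotate x y z = trans (swap₁₂ x y z) (swap₂₃ y x z)

  swap₁₃ : ∀ x y z → h x y z ≡ h z y x
  swap₁₃ x y z = trans (rotate x y z) (swap₁₂ y z x)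

  edge⇒≢₁₂ : ∀ {x y z} → h x y z ≡ true → x ≢ y
  edge⇒≢₁₂ e refl = true≢false e (loopless _ _)

  edge⇒≢₂₃ : ∀ {x y z} → h x y z ≡ true → y ≢ z
  edge⇒≢₂₃ {x} {y} {z} e = edge⇒≢₁₂ (trans (sym (rotate x y z)) e)

  edge⇒≢₁₃ : ∀ {x y z} → h x y z ≡ true → x ≢ z
  edge⇒≢₁₃ {x} {y} {z} e = edge⇒≢₁₂ (trans (sym (swap₂₃ x y z)) e)

open Is3Graph public

record Symmetric₃ {A : Set} (f : Fin n → Fin n → Fin n → A) : Set where
  constructor symmetric₃
  field
    sym₁₂ : ∀ x y z → f x y z ≡ f y x z
    sym₂₃ : ∀ x y z → f x y z ≡ f x z y

  symᵣ : ∀ x y z → f x y z ≡ f y z x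
  symᵣ x y z = trans (sym₁₂ x y z) (sym₂₃ y x z)

-- A triple is either a rearrangement of an increasing one, or symmetry moves a repeated entry to
-- the first two places. Facts known only on increasing triples, where `Graph3` is meaningful,
-- extend in this way to all triples.
determined : {A : Set} {f g : Fin n → Fin n → Fin n → A} → Symmetric₃ f → Symmetric₃ g →
  (∀ x z → f x x z ≡ g x x z) →
  (∀ x y z → toℕ x < toℕ y → toℕ y < toℕ z → f x y z ≡ g x y z) →
  ∀ x y z → f x y z ≡ g x y z
determined {f = f} {g} F G diag inc x y z
  with <-cmp (toℕ x) (toℕ y) | <-cmp (toℕ y) (toℕ z) | <-cmp (toℕ x) (toℕ z)
... | tri≈ _ e _ | _ | _ with refl ← Fin.toℕ-injective e = diag x z
... | tri< _ _ _ | tri≈ _ e _ | _ with refl ← Fin.toℕ-injective e =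
  trans (F.symᵣ x y y) (trans (diag y x) (sym (G.symᵣ x y y)))
  where module F = Symmetric₃ F ; module G = Symmetric₃ G
... | tri> _ _ _ | tri≈ _ e _ | _ with refl ← Fin.toℕ-injective e =
  trans (F.symᵣ x y y) (trans (diag y x) (sym (G.symᵣ x y y)))
  where module F = Symmetric₃ F ; module G = Symmetric₃ G
... | tri< p _ _ | tri< q _ _ | _ = inc x y z p q
... | tri> _ _ p | tri> _ _ q | _ =
  trans (F.symᵣ x y z) (trans (F.sym₁₂ y z x) (trans (inc z y x q p)
    (sym (trans (G.symᵣ x y z) (G.sym₁₂ y z x)))))
  where module F = Symmetric₃ F ; module G = Symmetric₃ G
... | tri< _ _ _ | tri> _ _ q | tri< r _ _ =
  trans (F.sym₂₃ x y z) (trans (inc x z y r q) (sym (G.sym₂₃ x y z)))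
  where module F = Symmetric₃ F ; module G = Symmetric₃ G
... | tri< _ _ _ | tri> _ _ q | tri≈ _ e _ with refl ← Fin.toℕ-injective e =
  trans (F.sym₂₃ x y z) (trans (diag x y) (sym (G.sym₂₃ x y z)))
  where module F = Symmetric₃ F ; module G = Symmetric₃ G
... | tri< p _ _ | tri> _ _ _ | tri> _ _ r =
  trans (sym (F.symᵣ z x y)) (trans (inc z x y r p) (G.symᵣ z x y))
  where module F = Symmetric₃ F ; module G = Symmetric₃ G
... | tri> _ _ p | tri< _ _ _ | tri< r _ _ =
  trans (F.sym₁₂ x y z) (trans (inc y x z p r) (sym (G.sym₁₂ x y z)))
  where module F = Symmetric₃ F ; module G = Symmetric₃ G
... | tri> _ _ _ | tri< _ _ _ | tri≈ _ e _ with refl ← Fin.toℕ-injective e =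
  trans (F.sym₂₃ x y z) (trans (diag x y) (sym (G.sym₂₃ x y z)))
  where module F = Symmetric₃ F ; module G = Symmetric₃ G
... | tri> _ _ _ | tri< q _ _ | tri> _ _ r =
  trans (F.symᵣ x y z) (trans (inc y z x q r) (sym (G.symᵣ x y z)))
  where module F = Symmetric₃ F ; module G = Symmetric₃ G

size : Graph3 n → ℕ
size h = ∑₃ λ x y z → ⟦ h x y z ⟧

inc : Graph3 n → Graph3 n
inc E x y z = (toℕ x <ᵇ toℕ y) ∧ (toℕ y <ᵇ toℕ z) ∧ E x y z

orbitOr : Graph3 n → Graph3 n
orbitOr f x y z = f x y z ∨ f x z y ∨ f y x z ∨ f y z x ∨ f z x y ∨ f z y x

-- The values of `E` on triples that are not increasing are arbitrary. They are erased by `inc`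
-- before symmetrising, so that every hyperedge appears in exactly its six orders and nothing else
-- does.
hyper : Graph3 n → Graph3 n
hyper E = orbitOr (inc E)

inc⇒< : (E : Graph3 n) {x y z : Fin n} → inc E x y z ≡ true →
        toℕ x < toℕ y × toℕ y < toℕ z × E x y z ≡ true
inc⇒< E {x} {y} {z} e =
    <ᵇ⇒< _ _ (Equivalence.from T-≡ (∧-trueˡ e))
  , <ᵇ⇒< _ _ (Equivalence.from T-≡ (∧-trueˡ (∧-trueʳ {toℕ x <ᵇ toℕ y} e)))
  , ∧-trueʳ {toℕ y <ᵇ toℕ z} (∧-trueʳ {toℕ x <ᵇ toℕ y} e)

inc-true : (E : Graph3 n) {x y z : Fin n} → toℕ x < toℕ y → toℕ y < toℕ z →
           inc E x y z ≡ E x y z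
inc-true E p q rewrite toℕ-<ᵇ p | toℕ-<ᵇ q = refl

inc-false : (E : Graph3 n) {x y z : Fin n} →
            (toℕ x < toℕ y → toℕ y < toℕ z → ⊥) → inc E x y z ≡ false
inc-false E f = ¬-not λ e → case inc⇒< E e of λ { (p , q , _) → f p q }

hyper-inc : (E : Graph3 n) {x y z : Fin n} → toℕ x < toℕ y → toℕ y < toℕ z →
            hyper E x y z ≡ E x y z
hyper-inc E {x} {y} {z} p q
  rewrite inc-true E p q
        | inc-false E {x} {z} {y} (λ _ r → <-asym q r)
        | inc-false E {y} {x} {z} (λ r _ → <-asym p r)
        | inc-false E {y} {z} {x} (λ _ r → <-asym (<-trans p q) r)
        | inc-false E {z} {x} {y} (λ r _ → <-asym (<-trans p q) r)
        | inc-false E {z} {y} {x} (λ r _ → <-asym q r)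
        = ∨-identityʳ _

hyper-loopless : (E : Graph3 n) (x z : Fin n) → hyper E x x z ≡ false
hyper-loopless E x z
  rewrite inc-false E {x} {x} {z} (λ r _ → <-irrefl refl r)
        | inc-false E {x} {z} {x} <-asym
        | inc-false E {z} {x} {x} (λ _ r → <-irrefl refl r)
        = refl

module _ where
  open ∨-∧-Solver using (_:+_; _:=_) renaming (solve to solve-∨)

  orbitOr-swap₁₂ : (f : Graph3 n) → ∀ x y z → orbitOr f x y z ≡ orbitOr f y x z
  orbitOr-swap₁₂ f x y z =
    solve-∨ 6 (λ a b c d e f → a :+ (b :+ (c :+ (d :+ (e :+ f)))) := c :+ (d :+ (a :+ (b :+ (f :+ e)))))
      refl (f x y z) (f x z y) (f y x z) (f y z x) (f z x y) (f z y x)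

  orbitOr-swap₂₃ : (f : Graph3 n) → ∀ x y z → orbitOr f x y z ≡ orbitOr f x z y
  orbitOr-swap₂₃ f x y z =
    solve-∨ 6 (λ a b c d e f → a :+ (b :+ (c :+ (d :+ (e :+ f)))) := b :+ (a :+ (e :+ (f :+ (c :+ d)))))
      refl (f x y z) (f x z y) (f y x z) (f y z x) (f z x y) (f z y x)

hyper-3graph : (E : Graph3 n) → Is3Graph (hyper E)
hyper-3graph E .swap₁₂   = orbitOr-swap₁₂ (inc E)
hyper-3graph E .swap₂₃   = orbitOr-swap₂₃ (inc E)
hyper-3graph E .loopless = hyper-loopless E

Is3Graph⇒Symmetric₃ : {A : Set} {h : Graph3 n} (f : Bool → A) → Is3Graph h → Symmetric₃ (λ x y z → f (h x y z))
Is3Graph⇒Symmetric₃ f H = symmetric₃ (λ x y z → cong f (swap₁₂ H x y z)) (λ x y z → cong f (swap₂₃ H x y z))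

3graph-ext : {h k : Graph3 n} → Is3Graph h → Is3Graph k →
  (∀ x y z → toℕ x < toℕ y → toℕ y < toℕ z → h x y z ≡ k x y z) →
  ∀ x y z → h x y z ≡ k x y z
3graph-ext H K = determined (Is3Graph⇒Symmetric₃ id H) (Is3Graph⇒Symmetric₃ id K)
  (λ x z → trans (loopless H x z) (sym (loopless K x z)))

orbitSum : (Fin n → Fin n → Fin n → ℕ) → Fin n → Fin n → Fin n → ℕ
orbitSum f x y z = f x y z + f x z y + f y x z + f y z x + f z x y + f z y x

-- At most one order of a triple is increasing, so the disjunction has at most one true term and its
-- indicator is the sum of the six indicators. Hence the factor 6 between `size` and `numEdges`.
hyper-orbit : (E : Graph3 n) → ∀ x y z →
  ⟦ hyper E x y z ⟧ ≡ orbitSum (λ x y z → ⟦ inc E x y z ⟧) x y z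
hyper-orbit {n} E = determined (Is3Graph⇒Symmetric₃ ⟦_⟧ (hyper-3graph E))
  (symmetric₃ (λ x y z → s₁ (e x y z) (e x z y) (e y x z) (e y z x) (e z x y) (e z y x))
              (λ x y z → s₂ (e x y z) (e x z y) (e y x z) (e y z x) (e z x y) (e z y x)))
  (λ x z → trans (cong ⟦_⟧ (hyper-loopless E x z)) (sym (diag x z)))
  (λ x y z p q → trans (cong ⟦_⟧ (hyper-inc E p q)) (sym (incr p q)))
  where
  e : Fin n → Fin n → Fin n → ℕ
  e x y z = ⟦ inc E x y z ⟧
  s₁ : ∀ a b c d e f → a + b + c + d + e + f ≡ c + d + a + b + f + e
  s₁ = solve-∀
  s₂ : ∀ a b c d e f → a + b + c + d + e + f ≡ b + a + e + f + c + d
  s₂ = solve-∀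
  zeros : ∀ a → a + 0 + 0 + 0 + 0 + 0 ≡ a
  zeros = solve-∀
  diag : ∀ x z → orbitSum e x x z ≡ 0
  diag x z
    rewrite inc-false E {x} {x} {z} (λ r _ → <-irrefl refl r)
          | inc-false E {x} {z} {x} <-asym
          | inc-false E {z} {x} {x} (λ _ r → <-irrefl refl r)
          = refl
  incr : ∀ {x y z} → toℕ x < toℕ y → toℕ y < toℕ z → orbitSum e x y z ≡ ⟦ E x y z ⟧
  incr {x} {y} {z} p q
    rewrite inc-true E p q
          | inc-false E {x} {z} {y} (λ _ r → <-asym q r)
          | inc-false E {y} {x} {z} (λ r _ → <-asym p r)
          | inc-false E {y} {z} {x} (λ _ r → <-asym (<-trans p q) r)
          | inc-false E {z} {x} {y} (λ r _ → <-asym (<-trans p q) r)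
          | inc-false E {z} {y} {x} (λ r _ → <-asym q r)
          = zeros ⟦ E x y z ⟧

∑₃-orbitSum : (f : Fin n → Fin n → Fin n → ℕ) → ∑₃ (orbitSum f) ≡ 6 * ∑₃ f
∑₃-orbitSum f =
  trans (∑₃-+ _ _) (trans (cong₂ _+_ (trans (∑₃-+ _ _) (cong₂ _+_ (trans (∑₃-+ _ _) (cong₂ _+_
    (trans (∑₃-+ _ _) (cong₂ _+_ (trans (∑₃-+ _ _) (cong₂ _+_ refl p₂)) p₃)) p₄)) p₅)) p₆)
    (six (∑₃ f)))
  where
  p₂ : ∑₃ (λ x y z → f x z y) ≡ ∑₃ f
  p₂ = ∑₃-swap₂₃ f
  p₃ : ∑₃ (λ x y z → f y x z) ≡ ∑₃ f
  p₃ = ∑₃-swap₁₂ f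
  p₄ : ∑₃ (λ x y z → f y z x) ≡ ∑₃ f
  p₄ = trans (∑₃-swap₁₂ (λ x y z → f x z y)) p₂
  p₅ : ∑₃ (λ x y z → f z x y) ≡ ∑₃ f
  p₅ = trans (∑₃-swap₂₃ (λ x y z → f y x z)) p₃
  p₆ : ∑₃ (λ x y z → f z y x) ≡ ∑₃ f
  p₆ = trans (∑₃-swap₂₃ (λ x y z → f y z x)) p₄
  six : ∀ a → a + a + a + a + a + a ≡ 6 * a
  six = solve-∀

sum-concatMap : {A : Set} (f : A → List ℕ) (xs : List A) →
                sumᴸ (concatMap f xs) ≡ sumᴸ (map (λ x → sumᴸ (f x)) xs)
sum-concatMap f []       = refl
sum-concatMap f (x ∷ xs) =
  trans (sum-++ (f x) (concatMap f xs)) (cong (sumᴸ (f x) +_) (sum-concatMap f xs))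

sum-tabulate : {A : Set} (g : Fin n → A) (f : A → ℕ) → sumᴸ (map f (tabulate g)) ≡ ∑ (λ i → f (g i))
sum-tabulate {zero}  g f = sym (∑-empty _)
sum-tabulate {suc n} g f = trans (cong (f (g zero) +_) (sum-tabulate (λ i → g (suc i)) f)) (sym (∑-suc _))

sum-allFin : (f : Fin n → ℕ) → sumᴸ (map f (allFin n)) ≡ ∑ f
sum-allFin f = sum-tabulate id f

numEdges≡∑₃ : (E : Graph3 n) → numEdges E ≡ ∑₃ λ x y z → ⟦ inc E x y z ⟧
numEdges≡∑₃ {n} E =
  trans (sum-concatMap _ (allFin n)) (trans (sum-allFin _) (∑-cong λ x →
  trans (sum-concatMap _ (allFin n)) (trans (sum-allFin _) (∑-cong λ y →
  trans (sum-allFin _) (∑-cong λ z → indicator (inc E x y z))))))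
  where
  indicator : ∀ b → (if b then 1 else 0) ≡ ⟦ b ⟧
  indicator true  = refl
  indicator false = refl

size-hyper : (E : Graph3 n) → size (hyper E) ≡ 6 * numEdges E
size-hyper E = trans (∑₃-cong (hyper-orbit E))
  (trans (∑₃-orbitSum _) (cong (6 *_) (sym (numEdges≡∑₃ E))))

incEdge : (E : Graph3 n) {x y z : Fin n} → inc E x y z ≡ true → IncEdge E x y z
incEdge E e = case inc⇒< E e of λ { (p , q , r) → mk p q r }

hyper⇒Edge : (E : Graph3 n) {x y z : Fin n} → hyper E x y z ≡ true → Edge E x y z
hyper⇒Edge E {x} {y} {z} e
  with inc E x y z in e₁ | inc E x z y in e₂ | inc E y x z in e₃ | inc E y z x in e₄ | inc E z x y in e₅ | inc E z y x in e₆
... | true  | _     | _     | _     | _     | _     = inj₁ (incEdge E e₁)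
... | false | true  | _     | _     | _     | _     = inj₂ (inj₁ (incEdge E e₂))
... | false | false | true  | _     | _     | _     = inj₂ (inj₂ (inj₁ (incEdge E e₃)))
... | false | false | false | true  | _     | _     = inj₂ (inj₂ (inj₂ (inj₁ (incEdge E e₄))))
... | false | false | false | false | true  | _     = inj₂ (inj₂ (inj₂ (inj₂ (inj₁ (incEdge E e₅)))))
... | false | false | false | false | false | true  = inj₂ (inj₂ (inj₂ (inj₂ (inj₂ (incEdge E e₆)))))

Edge⇒hyper : (E : Graph3 n) {x y z : Fin n} → Edge E x y z → hyper E x y z ≡ true
Edge⇒hyper {n} E = go
  where
  H = hyper-3graph E
  base : ∀ {x y z} → IncEdge E x y z → hyper E x y z ≡ true
  base (mk p q e) = trans (hyper-inc E p q) e
  go : ∀ {x y z} → Edge E x y z → hyper E x y z ≡ true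
  go {x} {y} {z} (inj₁ i)                             = base i
  go {x} {y} {z} (inj₂ (inj₁ i))                      = trans (swap₂₃ H x y z) (base i)
  go {x} {y} {z} (inj₂ (inj₂ (inj₁ i)))               = trans (swap₁₂ H x y z) (base i)
  go {x} {y} {z} (inj₂ (inj₂ (inj₂ (inj₁ i))))        = trans (rotate H x y z) (base i)
  go {x} {y} {z} (inj₂ (inj₂ (inj₂ (inj₂ (inj₁ i))))) = trans (sym (rotate H z x y)) (base i)
  go {x} {y} {z} (inj₂ (inj₂ (inj₂ (inj₂ (inj₂ i))))) = trans (swap₁₃ H x y z) (base i)

-- Maximising the objective

C2-square : ∀ a → 2 * (a C 2) + a ≡ a * a
C2-square zero    = refl
C2-square (suc a) = begin
  2 * (suc a C 2) + suc a          ≡⟨ cong (λ z → 2 * z + suc a) (sym (nCk+nC[k+1]≡[n+1]C[k+1] a 1)) ⟩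
  2 * (a C 1 + a C 2) + suc a      ≡⟨ cong (λ z → 2 * (z + a C 2) + suc a) (nC1≡n a) ⟩
  2 * (a + a C 2) + suc a          ≡⟨ ring₁ a (a C 2) ⟩
  2 * a + 1 + (2 * (a C 2) + a)    ≡⟨ cong (2 * a + 1 +_) (C2-square a) ⟩
  2 * a + 1 + a * a                ≡⟨ ring₂ a ⟩
  suc a * suc a                    ∎
  where
  open ≡-Reasoning
  ring₁ : ∀ a c → 2 * (a + c) + (1 + a) ≡ 2 * a + 1 + (2 * c + a)
  ring₁ = solve-∀
  ring₂ : ∀ a → 2 * a + 1 + a * a ≡ (1 + a) * (1 + a)
  ring₂ = solve-∀

C3-cube : ∀ a → 6 * (a C 3) + 3 * (a * a) ≡ a * a * a + 2 * a
C3-cube zero    = refl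
C3-cube (suc a) = begin
  6 * (suc a C 3) + 3 * (suc a * suc a)
    ≡⟨ cong (λ z → 6 * z + 3 * (suc a * suc a)) (sym (nCk+nC[k+1]≡[n+1]C[k+1] a 2)) ⟩
  6 * (a C 2 + a C 3) + 3 * (suc a * suc a)
    ≡⟨ ring₁ a (a C 2) (a C 3) ⟩
  3 * (2 * (a C 2) + a) + (6 * (a C 3) + 3 * (a * a)) + (3 * a + 3)
    ≡⟨ cong₂ (λ y z → 3 * y + z + (3 * a + 3)) (C2-square a) (C3-cube a) ⟩
  3 * (a * a) + (a * a * a + 2 * a) + (3 * a + 3)
    ≡⟨ ring₂ a ⟩
  suc a * suc a * suc a + 2 * suc a ∎
  where
  open ≡-Reasoning
  ring₁ : ∀ a c d → 6 * (c + d) + 3 * ((1 + a) * (1 + a)) ≡ 3 * (2 * c + a) + (6 * d + 3 * (a * a)) + (3 * a + 3)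
  ring₁ = solve-∀
  ring₂ : ∀ a → 3 * (a * a) + (a * a * a + 2 * a) + (3 * a + 3) ≡ (1 + a) * (1 + a) * (1 + a) + 2 * (1 + a)
  ring₂ = solve-∀

-- Twice the objective, up to the term t (a + b + c), which is constant under a + b + c = m.
Φ : ℕ → ℕ → ℕ → ℕ → ℕ
Φ t a b c = 2 * (a * b * c) + t * (a * a + b * b + c * c)

objective-Φ : ∀ t a b c → 2 * objective t a b c + t * (a + b + c) ≡ Φ t a b c
objective-Φ t a b c = begin
  2 * (a * b * c + t * (a C 2 + b C 2 + c C 2)) + t * (a + b + c)
    ≡⟨ ring t a b c (a C 2) (b C 2) (c C 2) ⟩
  2 * (a * b * c) + t * ((2 * (a C 2) + a) + (2 * (b C 2) + b) + (2 * (c C 2) + c))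
    ≡⟨ cong (λ z → 2 * (a * b * c) + t * z) (cong₂ _+_ (cong₂ _+_ (C2-square a) (C2-square b)) (C2-square c)) ⟩
  Φ t a b c ∎
  where
  open ≡-Reasoning
  ring : ∀ t a b c x y z → 2 * (a * b * c + t * (x + y + z)) + t * (a + b + c)
       ≡ 2 * (a * b * c) + t * ((2 * x + a) + (2 * y + b) + (2 * z + c))
  ring = solve-∀

Φ<⇒objective< : ∀ t a b c a′ b′ c′ → a + b + c ≡ a′ + b′ + c′ →
                Φ t a b c < Φ t a′ b′ c′ → objective t a b c < objective t a′ b′ c′
Φ<⇒objective< t a b c a′ b′ c′ e lt = *-cancelˡ-< 2 _ _ (+-cancelʳ-< (t * (a + b + c)) _ _ (begin-strict
  2 * objective t a b c + t * (a + b + c)              ≡⟨ objective-Φ t a b c ⟩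
  Φ t a b c                                            <⟨ lt ⟩
  Φ t a′ b′ c′                                         ≡⟨ objective-Φ t a′ b′ c′ ⟨
  2 * objective t a′ b′ c′ + t * (a′ + b′ + c′)        ≡⟨ cong (λ z → 2 * objective t a′ b′ c′ + t * z) e ⟨
  2 * objective t a′ b′ c′ + t * (a + b + c)           ∎))
  where open ≤-Reasoning

objective-swap₁₂ : ∀ t a b c → objective t a b c ≡ objective t b a c
objective-swap₁₂ t a b c = ring t a b c (a C 2) (b C 2) (c C 2)
  where
  ring : ∀ t a b c x y z → a * b * c + t * (x + y + z) ≡ b * a * c + t * (y + x + z)
  ring = solve-∀

objective-swap₂₃ : ∀ t a b c → objective t a b c ≡ objective t a c b
objective-swap₂₃ t a b c = ring t a b c (a C 2) (b C 2) (c C 2)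
  where
  ring : ∀ t a b c x y z → a * b * c + t * (x + y + z) ≡ a * c * b + t * (x + z + y)
  ring = solve-∀

foldr-⊔-upper : ∀ {v : ℕ} {xs} → v ∈ xs → v ≤ foldr _⊔_ 0 xs
foldr-⊔-upper {xs = x ∷ xs} (here refl) = m≤m⊔n x _
foldr-⊔-upper {xs = x ∷ xs} (there i)   = ≤-trans (foldr-⊔-upper i) (m≤n⊔m x _)

record Triple (m : ℕ) : Set where
  constructor triple
  field
    a b c : ℕ
    1≤a : 1 ≤ a
    1≤b : 1 ≤ b
    1≤c : 1 ≤ c
    total : a + b + c ≡ m

  value : ℕ → ℕ
  value t = objective t a b c

module _ (m t : ℕ) where
  private
    guard : ℕ → ℕ → Bool
    guard a b = (0 <ᵇ a) ∧ (0 <ᵇ b) ∧ (a + b <ᵇ m)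

    entry : ℕ → ℕ → ℕ
    entry a b = if guard a b then objective t a b (m ∸ (a + b)) else 0

    row : ℕ → List ℕ
    row a = map (entry a) (upTo (suc m))

  objective≤max : (τ : Triple m) → Triple.value τ t ≤ maxObjective m t
  objective≤max (triple a@(suc a′) b@(suc b′) c 1≤a 1≤b 1≤c refl) =
    subst (_≤ maxObjective m t) value (foldr-⊔-upper
      (∈-concatMap⁺ row (Any.map (λ { refl → ∈-map⁺ (entry a) (∈-upTo⁺ b<) }) (∈-upTo⁺ a<))))
    where
    a<m : a + b < m
    a<m = ≤-trans (≤-reflexive (+-comm 1 (a + b))) (+-monoʳ-≤ (a + b) 1≤c)
    a< : a < suc m
    a< = s≤s (≤-trans (m≤m+n a b) (<⇒≤ a<m))
    b< : b < suc m
    b< = s≤s (≤-trans (m≤n+m b a) (<⇒≤ a<m))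
    value : entry a b ≡ objective t a b c
    value rewrite Equivalence.to T-≡ (<⇒<ᵇ a<m) = cong (objective t a b) (m+n∸m≡n (a + b) c)

  -- The fold may return its initial 0, or a 0 that stands for a pair out of range. In both cases
  -- the maximum is 0, and `corner` attains it because no value exceeds the maximum.
  max-attained : 3 ≤ m → ∃ λ (τ : Triple m) → Triple.value τ t ≡ maxObjective m t
  max-attained 3≤m with foldr-selective ⊔-sel 0
      (concatMap row (upTo (suc m)))
  ... | inj₁ max≡0 = corner , ≤-antisym (objective≤max corner) (≤-trans (≤-reflexive max≡0) z≤n)
    where
    corner : Triple m
    corner = triple 1 1 (m ∸ 2) ≤-refl ≤-refl (∸-monoˡ-≤ 2 3≤m) (m+[n∸m]≡n (≤-trans (n≤1+n 2) 3≤m))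
  ... | inj₂ max∈ with find (∈-concatMap⁻ row {xs = upTo (suc m)} max∈)
  ...   | a , _ , v∈ with ∈-map⁻ (entry a) v∈
  ...     | b , _ , e with guard a b in g
  ...       | false = corner , ≤-antisym (objective≤max corner) (≤-trans (≤-reflexive e) z≤n)
    where
    corner : Triple m
    corner = triple 1 1 (m ∸ 2) ≤-refl ≤-refl (∸-monoˡ-≤ 2 3≤m) (m+[n∸m]≡n (≤-trans (n≤1+n 2) 3≤m))
  ...       | true  = triple a b (m ∸ (a + b))
      (<ᵇ⇒< 0 a (Equivalence.from T-≡ (∧-trueˡ g)))
      (<ᵇ⇒< 0 b (Equivalence.from T-≡ (∧-trueˡ (∧-trueʳ {0 <ᵇ a} g))))
      (m<n⇒0<n∸m a+b<m) (m+[n∸m]≡n (<⇒≤ a+b<m)) , sym e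
    where
    a+b<m : a + b < m
    a+b<m = <ᵇ⇒< (a + b) m (Equivalence.from T-≡ (∧-trueʳ {0 <ᵇ b} (∧-trueʳ {0 <ᵇ a} g)))

Balanced : ℕ → ℕ → ℕ → Set
Balanced a b c = (a ≤ suc b × b ≤ suc a) × (b ≤ suc c × c ≤ suc b) × (a ≤ suc c × c ≤ suc a)

-- The product gains (a - 1 - b) c and the pair term loses t (a - 1 - b), a net gain of (a - 1 -
-- b)(c - t). In the proof `d` and `e` are the excesses of a over b + 2 and of c over t + 1.
shift-better : ∀ t a b c → 2 + b ≤ a → t < c →
  objective t a b c < objective t (a ∸ 1) (1 + b) c
shift-better t a b c 2+b≤a t<c with m≤n⇒∃[o]m+o≡n 2+b≤a | m≤n⇒∃[o]m+o≡n t<c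
... | d , refl | e , refl = Φ<⇒objective< t (2 + b + d) b c (1 + b + d) (1 + b) c (sum-eq b d c)
  (≤-trans (m≤m+n _ (d + d + e + e + (d * e + d * e) + 1)) (≤-reflexive (gain t b d e)))
  where
  sum-eq : ∀ b d c → 2 + b + d + b + c ≡ 1 + b + d + (1 + b) + c
  sum-eq = solve-∀
  gain : ∀ t b d e →
    1 + (2 * ((2 + b + d) * b * (1 + t + e)) + t * ((2 + b + d) * (2 + b + d) + b * b + (1 + t + e) * (1 + t + e)))
      + (d + d + e + e + (d * e + d * e) + 1)
    ≡ 2 * ((1 + b + d) * (1 + b) * (1 + t + e)) + t * ((1 + b + d) * (1 + b + d) + (1 + b) * (1 + b) + (1 + t + e) * (1 + t + e))
  gain = solve-∀

lopsided-bound : ∀ t a b c → b ≤ t → c ≤ t →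
  Φ t a b c ≤ 2 * ((a + b + c) * t * t) + t * ((a + b + c) * (a + b + c))
lopsided-bound t a b c b≤t c≤t = +-mono-≤
  (*-monoʳ-≤ 2 (*-mono-≤ (*-mono-≤ (≤-trans (m≤m+n a b) (m≤m+n (a + b) c)) b≤t) c≤t))
  (*-monoʳ-≤ t (≤-trans (m≤m+n _ (2 * (a * b + b * c + a * c))) (≤-reflexive (square a b c))))
  where
  square : ∀ a b c → a * a + b * b + c * c + 2 * (a * b + b * c + a * c) ≡ (a + b + c) * (a + b + c)
  square = solve-∀

-- With m ≤ 4 k the left side is at most 8 k t² + 16 k² t, which is less than 24 k² t because t < k.
-- Since 24 is 2 · 12, this is where the condition 12 t ≤ k comes from.
lopsided-small : ∀ t k m → 1 ≤ t → 12 * t ≤ k → m ≤ 4 * k →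
  2 * (m * t * t) + t * (m * m) < 2 * (k * k * k)
lopsided-small t k m 1≤t 12t≤k m≤4k = begin-strict
  2 * (m * t * t) + t * (m * m)
    ≤⟨ +-mono-≤ (*-monoʳ-≤ 2 (*-monoˡ-≤ t (*-monoˡ-≤ t m≤4k))) (*-monoʳ-≤ t (*-mono-≤ m≤4k m≤4k)) ⟩
  2 * (4 * k * t * t) + t * (4 * k * (4 * k))
    ≡⟨ e₁ t k ⟩
  8 * k * t * t + 16 * k * k * t
    <⟨ +-monoˡ-< (16 * k * k * t) (*-monoʳ-< (8 * k * t) {{>-nonZero 0<8kt}} t<k) ⟩
  8 * k * t * k + 16 * k * k * t
    ≡⟨ e₂ t k ⟩
  2 * (k * k * (12 * t))
    ≤⟨ *-monoʳ-≤ 2 (*-monoʳ-≤ (k * k) 12t≤k) ⟩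
  2 * (k * k * k) ∎
  where
  open ≤-Reasoning
  t<k : t < k
  t<k = ≤-trans (≤-trans (+-monoˡ-≤ t 1≤t) (≤-trans (m≤m+n (t + t) (10 * t)) (≤-reflexive (e₃ t)))) 12t≤k
    where
    e₃ : ∀ t → t + t + 10 * t ≡ 12 * t
    e₃ = solve-∀
  0<8kt : 0 < 8 * k * t
  0<8kt = *-mono-≤ {1} {8 * k} (*-mono-≤ {1} {8} (s≤s z≤n) (≤-trans (s≤s z≤n) t<k)) 1≤t
  e₁ : ∀ t k → 2 * (4 * k * t * t) + t * (4 * k * (4 * k)) ≡ 8 * k * t * t + 16 * k * k * t
  e₁ = solve-∀
  e₂ : ∀ t k → 8 * k * t * k + 16 * k * k * t ≡ 2 * (k * k * (12 * t))
  e₂ = solve-∀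

-- k is a third of m, rounded down; the bound 12 t ≤ k is what makes three nearly equal parts
-- beat one huge part and two parts of size at most t.
record LargeThird (t m : ℕ) : Set where
  field
    k s : ℕ
    1≤t : 1 ≤ t
    large : 12 * t ≤ k
    s≤2 : s ≤ 2
    split : 3 * k + s ≡ m

  t<k : t < k
  t<k = ≤-trans (≤-trans (+-monoˡ-≤ t 1≤t) (≤-trans (m≤m+n (t + t) (10 * t)) (≤-reflexive (e t)))) large
    where
    e : ∀ t → t + t + 10 * t ≡ 12 * t
    e = solve-∀

  1≤k : 1 ≤ k
  1≤k = ≤-trans (s≤s z≤n) t<k

  2≤k : 2 ≤ k
  2≤k = ≤-trans (s≤s 1≤t) t<k

  -- For s = 2 this triple is not balanced. It serves as a benchmark whose product is at least k³.
  middle : Triple m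
  middle = triple k k (k + s) 1≤k 1≤k (≤-trans 1≤k (m≤m+n k s)) (trans (e k s) split)
    where
    e : ∀ k s → k + k + (k + s) ≡ 3 * k + s
    e = solve-∀

  m≤4k : m ≤ 4 * k
  m≤4k = ≤-trans (≤-reflexive (sym split)) (≤-trans (+-monoʳ-≤ (3 * k) (≤-trans s≤2 2≤k)) (≤-reflexive (e k)))
    where
    e : ∀ k → 3 * k + k ≡ 4 * k
    e = solve-∀

module _ {t m : ℕ} (L : LargeThird t m) where
  open LargeThird L

  Improvable : ℕ → ℕ → ℕ → Set
  Improvable a b c = ∃ λ (τ : Triple m) → objective t a b c < Triple.value τ t

  -- One unit leaves `a` so that the untouched part is one that exceeds t. If c ≤ t < b, then c + 2
  -- ≤ a holds too and the unit goes to `c`. If neither `b` nor `c` exceeds t, no such shift gains,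
  -- and the lopsided triple is compared with `middle`.
  improvable : ∀ a b c → 1 ≤ b → 1 ≤ c → a + b + c ≡ m → 2 + b ≤ a → Improvable a b c
  improvable a b c 1≤b 1≤c total 2+b≤a with t <? c | t <? b
  ... | yes t<c | _ = triple (a ∸ 1) (1 + b) c
        (∸-monoˡ-≤ 1 (≤-trans (s≤s (s≤s z≤n)) 2+b≤a)) (s≤s z≤n) 1≤c
        (trans (move (≤-trans (s≤s z≤n) 2+b≤a)) total)
      , shift-better t a b c 2+b≤a t<c
    where
    move : 1 ≤ a → a ∸ 1 + (1 + b) + c ≡ a + b + c
    move (s≤s {n = a′} _) = cong (_+ c) (+-suc a′ b)
  ... | no t≮c | yes t<b = triple (a ∸ 1) b (1 + c)
        (∸-monoˡ-≤ 1 (≤-trans (s≤s (s≤s z≤n)) 2+b≤a)) 1≤b (s≤s z≤n)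
        (trans (move (≤-trans (s≤s z≤n) 2+b≤a)) total)
      , subst₂ _<_ (objective-swap₂₃ t a c b) (objective-swap₂₃ t (a ∸ 1) (1 + c) b)
          (shift-better t a c b (≤-trans (+-monoʳ-≤ 2 (≤-trans (≮⇒≥ t≮c) (<⇒≤ t<b))) 2+b≤a) t<b)
    where
    move : 1 ≤ a → a ∸ 1 + b + (1 + c) ≡ a + b + c
    move (s≤s {n = a′} _) = +-suc (a′ + b) c
  ... | no t≮c | no t≮b = middle , Φ<⇒objective< t a b c k k (k + s) (trans total (sym (Triple.total middle)))
      (≤-<-trans (lopsided-bound t a b c (≮⇒≥ t≮b) (≮⇒≥ t≮c))
      (<-≤-trans (lopsided-small t k (a + b + c) 1≤t large (≤-trans (≤-reflexive total) m≤4k))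
      (≤-trans (*-monoʳ-≤ 2 (*-monoʳ-≤ (k * k) (m≤m+n k s))) (m≤m+n _ _))))

  max⇒balanced : ∀ a b c → 1 ≤ a → 1 ≤ b → 1 ≤ c → a + b + c ≡ m →
    maxObjective m t ≤ objective t a b c → Balanced a b c
  max⇒balanced a b c 1≤a 1≤b 1≤c total max≤ =
      ( close a b c refl 1≤b 1≤c total
      , close b a c (objective-swap₁₂ t a b c) 1≤a 1≤c (trans (cong (_+ c) (+-comm b a)) total))
    , ( close b c a (trans (objective-swap₁₂ t a b c) (objective-swap₂₃ t b a c)) 1≤c 1≤a (trans (p₁ b c a) total)
      , close c b a (trans (trans (objective-swap₂₃ t a b c) (objective-swap₁₂ t a c b)) (objective-swap₂₃ t c a b)) 1≤b 1≤a (trans (p₂ c b a) total))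
    , ( close a c b (objective-swap₂₃ t a b c) 1≤c 1≤b (trans (p₃ a c b) total)
      , close c a b (trans (objective-swap₂₃ t a b c) (objective-swap₁₂ t a c b)) 1≤a 1≤b (trans (p₄ c a b) total))
    where
    close : ∀ x y z → objective t a b c ≡ objective t x y z → 1 ≤ y → 1 ≤ z → x + y + z ≡ m → x ≤ suc y
    close x y z e 1≤y 1≤z total′ with x ≤? suc y
    ... | yes p = p
    ... | no ¬p with improvable x y z 1≤y 1≤z total′ (≰⇒> ¬p)
    ...   | τ , lt = contradiction (<-≤-trans lt (objective≤max m t τ)) (≤⇒≯ (≤-trans max≤ (≤-reflexive e)))
    p₁ : ∀ b c a → b + c + a ≡ a + b + c
    p₁ = solve-∀
    p₂ : ∀ c b a → c + b + a ≡ a + b + c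
    p₂ = solve-∀
    p₃ : ∀ a c b → a + c + b ≡ a + b + c
    p₃ = solve-∀
    p₄ : ∀ c a b → c + a + b ≡ a + b + c
    p₄ = solve-∀

-- The Klein four-group: 𝟘 is the colour of the set Q and 𝟙, 𝟚, 𝟛 are the colours of the three
-- parts. A triple is an edge of the extremal construction iff its colours sum to 𝟘.
data K : Set where
  𝟘 𝟙 𝟚 𝟛 : K

infixl 6 _⊕_
infix 4 _=ᴷ_

_⊕_ : K → K → K
𝟘 ⊕ y = y
𝟙 ⊕ 𝟘 = 𝟙
𝟙 ⊕ 𝟙 = 𝟘
𝟙 ⊕ 𝟚 = 𝟛
𝟙 ⊕ 𝟛 = 𝟚
𝟚 ⊕ 𝟘 = 𝟚
𝟚 ⊕ 𝟙 = 𝟛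
𝟚 ⊕ 𝟚 = 𝟘
𝟚 ⊕ 𝟛 = 𝟙
𝟛 ⊕ 𝟘 = 𝟛
𝟛 ⊕ 𝟙 = 𝟚
𝟛 ⊕ 𝟚 = 𝟙
𝟛 ⊕ 𝟛 = 𝟘

_=ᴷ_ : K → K → Bool
𝟘 =ᴷ 𝟘 = true
𝟙 =ᴷ 𝟙 = true
𝟚 =ᴷ 𝟚 = true
𝟛 =ᴷ 𝟛 = true
_ =ᴷ _ = false

=ᴷ-refl : ∀ x → (x =ᴷ x) ≡ true
=ᴷ-refl 𝟘 = refl
=ᴷ-refl 𝟙 = refl
=ᴷ-refl 𝟚 = refl
=ᴷ-refl 𝟛 = refl

=ᴷ⇒≡ : ∀ x y → (x =ᴷ y) ≡ true → x ≡ y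
=ᴷ⇒≡ 𝟘 𝟘 _ = refl
=ᴷ⇒≡ 𝟙 𝟙 _ = refl
=ᴷ⇒≡ 𝟚 𝟚 _ = refl
=ᴷ⇒≡ 𝟛 𝟛 _ = refl

_≟ᴷ_ : (x y : K) → Dec (x ≡ y)
x ≟ᴷ y with x =ᴷ y in e
... | true  = yes (=ᴷ⇒≡ x y e)
... | false = no λ { refl → true≢false (=ᴷ-refl x) e }

-- Identities between colours are decided by evaluating the whole table: it computes to `true`, so
-- `refl` proves it.
allᴷ : (K → Bool) → Bool
allᴷ p = p 𝟘 ∧ p 𝟙 ∧ p 𝟚 ∧ p 𝟛

allᴷ-sound : (p : K → Bool) → allᴷ p ≡ true → ∀ x → p x ≡ true
allᴷ-sound p e 𝟘 = ∧-trueˡ e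
allᴷ-sound p e 𝟙 = ∧-trueˡ (∧-trueʳ {p 𝟘} e)
allᴷ-sound p e 𝟚 = ∧-trueˡ (∧-trueʳ {p 𝟙} (∧-trueʳ {p 𝟘} e))
allᴷ-sound p e 𝟛 = ∧-trueʳ {p 𝟚} (∧-trueʳ {p 𝟙} (∧-trueʳ {p 𝟘} e))

byTable₁ : (f g : K → K) → allᴷ (λ x → f x =ᴷ g x) ≡ true → ∀ x → f x ≡ g x
byTable₁ f g e x = =ᴷ⇒≡ (f x) (g x) (allᴷ-sound (λ x → f x =ᴷ g x) e x)

byTable₂ : (f g : K → K → K) → allᴷ (λ x → allᴷ λ y → f x y =ᴷ g x y) ≡ true → ∀ x y → f x y ≡ g x y
byTable₂ f g e x = byTable₁ (f x) (g x) (allᴷ-sound (λ x → allᴷ λ y → f x y =ᴷ g x y) e x)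

infix 5 _iff_

_iff_ : Bool → Bool → Bool
true  iff b = b
false iff b = not b

iff⇒≡ : ∀ {a b} → a iff b ≡ true → a ≡ b
iff⇒≡ {true}  {true}  _ = refl
iff⇒≡ {false} {false} _ = refl

byTableᵇ₁ : (f g : K → Bool) → allᴷ (λ x → f x iff g x) ≡ true → ∀ x → f x ≡ g x
byTableᵇ₁ f g e x = iff⇒≡ (allᴷ-sound (λ x → f x iff g x) e x)

byTableᵇ₂ : (f g : K → K → Bool) → allᴷ (λ x → allᴷ λ y → f x y iff g x y) ≡ true →
            ∀ x y → f x y ≡ g x y
byTableᵇ₂ f g e x = byTableᵇ₁ (f x) (g x) (allᴷ-sound (λ x → allᴷ λ y → f x y iff g x y) e x)

byTableᵇ₃ : (f g : K → K → K → Bool) →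
            allᴷ (λ x → allᴷ λ y → allᴷ λ z → f x y z iff g x y z) ≡ true →
            ∀ x y z → f x y z ≡ g x y z
byTableᵇ₃ f g e x = byTableᵇ₂ (f x) (g x)
  (allᴷ-sound (λ x → allᴷ λ y → allᴷ λ z → f x y z iff g x y z) e x)

⊕-self : ∀ x → x ⊕ x ≡ 𝟘
⊕-self = byTable₁ (λ x → x ⊕ x) (λ _ → 𝟘) refl

⊕-identityʳ : ∀ x → x ⊕ 𝟘 ≡ x
⊕-identityʳ = byTable₁ (_⊕ 𝟘) id refl

⊕-comm : ∀ x y → x ⊕ y ≡ y ⊕ x
⊕-comm = byTable₂ _⊕_ (λ x y → y ⊕ x) refl

⊕-cancel : ∀ x y → x ⊕ (x ⊕ y) ≡ y
⊕-cancel = byTable₂ (λ x y → x ⊕ (x ⊕ y)) (λ _ y → y) refl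

nz : K → Bool
nz 𝟘 = false
nz _ = true

nz⇒≢𝟘 : ∀ {x} → nz x ≡ true → x ≢ 𝟘
nz⇒≢𝟘 () refl

⊕-≢ˡ : ∀ a b → b ≢ 𝟘 → a ⊕ b ≢ a
⊕-≢ˡ a b b≢𝟘 e = b≢𝟘 (trans (sym (⊕-cancel a b)) (trans (cong (a ⊕_) e) (⊕-self a)))

⊕-≢𝟘 : ∀ a b → a ≢ b → a ⊕ b ≢ 𝟘
⊕-≢𝟘 a b a≢b e = a≢b (trans (sym (⊕-identityʳ a)) (trans (cong (a ⊕_) (sym e)) (⊕-cancel a b)))

≢𝟘-cases : (P : K → Set) → P 𝟙 → P 𝟚 → P 𝟛 → ∀ {x} → x ≢ 𝟘 → P x
≢𝟘-cases P p₁ p₂ p₃ {𝟘} ne = contradiction refl ne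
≢𝟘-cases P p₁ p₂ p₃ {𝟙} ne = p₁
≢𝟘-cases P p₁ p₂ p₃ {𝟚} ne = p₂
≢𝟘-cases P p₁ p₂ p₃ {𝟛} ne = p₃

≢𝟘⇒nz : ∀ {x} → x ≢ 𝟘 → nz x ≡ true
≢𝟘⇒nz = ≢𝟘-cases (λ x → nz x ≡ true) refl refl refl

≢⇒not-=ᴷ : ∀ {a b} → a ≢ b → not (a =ᴷ b) ≡ true
≢⇒not-=ᴷ {a} {b} ne = cong not (¬-not λ e → ne (=ᴷ⇒≡ a b e))

-- The three nonzero elements of the Klein four-group sum to 𝟘. The implication from p to q is coded
-- as the absorption `p ∧ q ≡ p`, which a table can check.
third-colour : ∀ a b c → a ≢ 𝟘 → b ≢ 𝟘 → c ≢ 𝟘 → a ≢ b → b ≢ c → a ≢ c → c ≡ a ⊕ b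
third-colour a b c a≢𝟘 b≢𝟘 c≢𝟘 a≢b b≢c a≢c = =ᴷ⇒≡ c (a ⊕ b)
  (∧-trueʳ {distinct a b c} (trans (table a b c)
    (∧-true (≢𝟘⇒nz a≢𝟘) (∧-true (≢𝟘⇒nz b≢𝟘) (∧-true (≢𝟘⇒nz c≢𝟘)
      (∧-true (≢⇒not-=ᴷ a≢b) (∧-true (≢⇒not-=ᴷ b≢c) (≢⇒not-=ᴷ a≢c))))))))
  where
  distinct : K → K → K → Bool
  distinct a b c = nz a ∧ nz b ∧ nz c ∧ not (a =ᴷ b) ∧ not (b =ᴷ c) ∧ not (a =ᴷ c)
  table : ∀ a b c → (distinct a b c ∧ (c =ᴷ a ⊕ b)) ≡ distinct a b c
  table = byTableᵇ₃ (λ a b c → distinct a b c ∧ (c =ᴷ a ⊕ b)) distinct refl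

-- Renamings of the three parts. Every permutation of the nonzero colours is additive, so renaming
-- the parts preserves the triples of colour sum 𝟘.
record Aut : Set where
  field
    to from : K → K
    to-from : ∀ x → to (from x) ≡ x
    from-to : ∀ x → from (to x) ≡ x
    fixes   : to 𝟘 ≡ 𝟘
    hom     : ∀ x y → to (x ⊕ y) ≡ to x ⊕ to y

  from-fixes : from 𝟘 ≡ 𝟘
  from-fixes = trans (cong from (sym fixes)) (from-to 𝟘)

  to-≢ : ∀ {x} → x ≢ 𝟘 → to x ≢ 𝟘
  to-≢ {x} x≢0 e = x≢0 (trans (sym (from-to x)) (trans (cong from e) from-fixes))

idᴬ : Aut
idᴬ = record { to = id ; from = id ; to-from = λ _ → refl ; from-to = λ _ → refl ; fixes = refl ; hom = λ _ _ → refl }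

_⁻ᴬ : Aut → Aut
α ⁻ᴬ = record
  { to = from ; from = to ; to-from = from-to ; from-to = to-from ; fixes = from-fixes
  ; hom = λ x y → trans (cong from (cong₂ _⊕_ (sym (to-from x)) (sym (to-from y))))
                  (trans (cong from (sym (hom (from x) (from y)))) (from-to _)) }
  where open Aut α

_∘ᴬ_ : Aut → Aut → Aut
α ∘ᴬ β = record
  { to = λ x → α.to (β.to x) ; from = λ x → β.from (α.from x)
  ; to-from = λ x → trans (cong α.to (β.to-from _)) (α.to-from x)
  ; from-to = λ x → trans (cong β.from (α.from-to _)) (β.from-to x)
  ; fixes = trans (cong α.to β.fixes) α.fixes
  ; hom = λ x y → trans (cong α.to (β.hom x y)) (α.hom _ _) }
  where
  module α = Aut α
  module β = Aut β

swap𝟙𝟚 : Aut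
swap𝟙𝟚 = record { to = f ; from = f ; to-from = inv ; from-to = inv ; fixes = refl ; hom = h }
  where
  f : K → K
  f 𝟘 = 𝟘
  f 𝟙 = 𝟚
  f 𝟚 = 𝟙
  f 𝟛 = 𝟛
  inv : ∀ x → f (f x) ≡ x
  inv = byTable₁ (λ x → f (f x)) id refl
  h : ∀ x y → f (x ⊕ y) ≡ f x ⊕ f y
  h = byTable₂ (λ x y → f (x ⊕ y)) (λ x y → f x ⊕ f y) refl

swap𝟚𝟛 : Aut
swap𝟚𝟛 = record { to = f ; from = f ; to-from = inv ; from-to = inv ; fixes = refl ; hom = h }
  where
  f : K → K
  f 𝟘 = 𝟘
  f 𝟙 = 𝟙
  f 𝟚 = 𝟛
  f 𝟛 = 𝟚
  inv : ∀ x → f (f x) ≡ x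
  inv = byTable₁ (λ x → f (f x)) id refl
  h : ∀ x y → f (x ⊕ y) ≡ f x ⊕ f y
  h = byTable₂ (λ x y → f (x ⊕ y)) (λ x y → f x ⊕ f y) refl

-- Class sizes up to renaming the parts

BalancedK : (K → ℕ) → Set
BalancedK N = ∀ {x y} → x ≢ 𝟘 → y ≢ 𝟘 → N x ≤ suc (N y)

Balanced⇒K : (N : K → ℕ) → Balanced (N 𝟙) (N 𝟚) (N 𝟛) → BalancedK N
Balanced⇒K N ((ab , ba) , (bc , cb) , (ac , ca)) = go _ _
  where
  go : ∀ x y → x ≢ 𝟘 → y ≢ 𝟘 → N x ≤ suc (N y)
  go 𝟘 y p q = contradiction refl p
  go x 𝟘 p q = contradiction refl q
  go 𝟙 𝟙 p q = n≤1+n _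
  go 𝟙 𝟚 p q = ab
  go 𝟙 𝟛 p q = ac
  go 𝟚 𝟙 p q = ba
  go 𝟚 𝟚 p q = n≤1+n _
  go 𝟚 𝟛 p q = bc
  go 𝟛 𝟙 p q = ca
  go 𝟛 𝟚 p q = cb
  go 𝟛 𝟛 p q = n≤1+n _

Symmetricᴺ : (ℕ → ℕ → ℕ → ℕ) → Set
Symmetricᴺ F = (∀ a b c → F a b c ≡ F b a c) × (∀ a b c → F a b c ≡ F a c b)

record Sorted (N : K → ℕ) : Set where
  field
    α   : Aut
    ≥₁₂ : N (Aut.to α 𝟚) ≤ N (Aut.to α 𝟙)
    ≥₂₃ : N (Aut.to α 𝟛) ≤ N (Aut.to α 𝟚)
    invariant : ∀ {F} → Symmetricᴺ F →
      F (N (Aut.to α 𝟙)) (N (Aut.to α 𝟚)) (N (Aut.to α 𝟛)) ≡ F (N 𝟙) (N 𝟚) (N 𝟛)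

sort : (N : K → ℕ) → Sorted N
sort N with ≤-total (N 𝟙) (N 𝟚) | ≤-total (N 𝟚) (N 𝟛) | ≤-total (N 𝟙) (N 𝟛)
... | inj₂ p | inj₂ q | _      = record { α = idᴬ ; ≥₁₂ = p ; ≥₂₃ = q ; invariant = λ _ → refl }
... | inj₁ p | inj₁ q | _      = record
  { α = swap𝟙𝟚 ∘ᴬ (swap𝟚𝟛 ∘ᴬ swap𝟙𝟚) ; ≥₁₂ = q ; ≥₂₃ = p
  ; invariant = λ (s₁₂ , s₂₃) → trans (s₁₂ _ _ _) (trans (s₂₃ _ _ _) (s₁₂ _ _ _)) }
... | inj₁ p | inj₂ q | inj₁ r = record
  { α = swap𝟙𝟚 ∘ᴬ swap𝟚𝟛 ; ≥₁₂ = q ; ≥₂₃ = r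
  ; invariant = λ (s₁₂ , s₂₃) → trans (s₂₃ _ _ _) (s₁₂ _ _ _) }
... | inj₁ p | inj₂ q | inj₂ r = record
  { α = swap𝟙𝟚 ; ≥₁₂ = p ; ≥₂₃ = r ; invariant = λ (s₁₂ , s₂₃) → s₁₂ _ _ _ }
... | inj₂ p | inj₁ q | inj₁ r = record
  { α = swap𝟚𝟛 ∘ᴬ swap𝟙𝟚 ; ≥₁₂ = r ; ≥₂₃ = p
  ; invariant = λ (s₁₂ , s₂₃) → trans (s₁₂ _ _ _) (s₂₃ _ _ _) }
... | inj₂ p | inj₁ q | inj₂ r = record
  { α = swap𝟚𝟛 ; ≥₁₂ = r ; ≥₂₃ = q ; invariant = λ (s₁₂ , s₂₃) → s₂₃ _ _ _ }

-- If c < c′, then a ≤ c + 1 ≤ c′, so every entry of the first triple is at most every entry of the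
-- second and the sums differ. With c and c′ equal, the same argument compares b with b′.
sorted-unique : ∀ {a b c a′ b′ c′} → b ≤ a → c ≤ b → a ≤ suc c → b′ ≤ a′ → c′ ≤ b′ → a′ ≤ suc c′ →
  a + b + c ≡ a′ + b′ + c′ → a ≡ a′ × b ≡ b′ × c ≡ c′
sorted-unique {a} {b} {c} {a′} {b′} {c′} b≤a c≤b a≤c b≤a′ c≤b′ a≤c′ e = a≡ , b≡ , c≡
  where
  c≮ : ∀ {a b c a′ b′ c′} → b ≤ a → a ≤ suc c → b′ ≤ a′ → c′ ≤ b′ → a + b + c ≡ a′ + b′ + c′ → ¬ c < c′
  c≮ b≤a a≤c b≤a′ c≤b′ e c<c′ = <-irrefl e (+-mono-≤-< (+-mono-≤ a≤a′ (≤-trans b≤a (≤-trans a≤c (≤-trans c<c′ c≤b′)))) c<c′)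
    where a≤a′ = ≤-trans a≤c (≤-trans c<c′ (≤-trans c≤b′ b≤a′))
  c≡ : c ≡ c′
  c≡ = ≤-antisym (≮⇒≥ (c≮ b≤a′ a≤c′ b≤a c≤b (sym e))) (≮⇒≥ (c≮ b≤a a≤c b≤a′ c≤b′ e))
  e₂ : a + b ≡ a′ + b′
  e₂ = +-cancelʳ-≡ c _ _ (trans e (cong (a′ + b′ +_) (sym c≡)))
  b≮ : ∀ {a b c a′ b′} → c ≤ b → a ≤ suc c → b′ ≤ a′ → a + b ≡ a′ + b′ → ¬ b < b′
  b≮ c≤b a≤c b≤a′ e b<b′ = <-irrefl e (+-mono-≤-< (≤-trans a≤c (≤-trans (s≤s c≤b) (≤-trans b<b′ b≤a′))) b<b′)
  b≡ : b ≡ b′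
  b≡ = ≤-antisym (≮⇒≥ (b≮ c≤b′ a≤c′ b≤a (sym e₂))) (≮⇒≥ (b≮ c≤b a≤c b≤a′ e₂))
  a≡ : a ≡ a′
  a≡ = +-cancelʳ-≡ b _ _ (trans e₂ (cong (a′ +_) (sym b≡)))

total : (K → ℕ) → ℕ
total N = N 𝟙 + N 𝟚 + N 𝟛

+-symmetricᴺ : Symmetricᴺ (λ a b c → a + b + c)
+-symmetricᴺ = (λ a b c → cong (_+ c) (+-comm a b)) , s
  where
  s : ∀ a b c → a + b + c ≡ a + c + b
  s = solve-∀

module _ (N M : K → ℕ) (bN : BalancedK N) (bM : BalancedK M) (e : total N ≡ total M) where
  private
    module N = Sorted (sort N)
    module M = Sorted (sort M)

    𝟙≢𝟘 : 𝟙 ≢ 𝟘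
    𝟙≢𝟘 ()
    𝟛≢𝟘 : 𝟛 ≢ 𝟘
    𝟛≢𝟘 ()

    agree : N (Aut.to N.α 𝟙) ≡ M (Aut.to M.α 𝟙) × N (Aut.to N.α 𝟚) ≡ M (Aut.to M.α 𝟚) × N (Aut.to N.α 𝟛) ≡ M (Aut.to M.α 𝟛)
    agree = sorted-unique N.≥₁₂ N.≥₂₃ (bN (Aut.to-≢ N.α 𝟙≢𝟘) (Aut.to-≢ N.α 𝟛≢𝟘))
                          M.≥₁₂ M.≥₂₃ (bM (Aut.to-≢ M.α 𝟙≢𝟘) (Aut.to-≢ M.α 𝟛≢𝟘))
      (trans (N.invariant {λ a b c → a + b + c} +-symmetricᴺ) (trans e (sym (M.invariant {λ a b c → a + b + c} +-symmetricᴺ))))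

  -- Undo the sorting of `N`, then apply the sorting of `M`: the sorted sizes agree.
  balanced-match : ∃ λ (ρ : Aut) → ∀ x → x ≢ 𝟘 → N x ≡ M (Aut.to ρ x)
  balanced-match = M.α ∘ᴬ (N.α ⁻ᴬ) , λ x x≢𝟘 →
    trans (cong N (sym (Aut.to-from N.α x))) (pointwise (Aut.from N.α x) (Aut.to-≢ (N.α ⁻ᴬ) x≢𝟘))
    where
    pointwise : ∀ y → y ≢ 𝟘 → N (Aut.to N.α y) ≡ M (Aut.to M.α y)
    pointwise 𝟘 ne = contradiction refl ne
    pointwise 𝟙 ne = proj₁ agree
    pointwise 𝟚 ne = proj₁ (proj₂ agree)
    pointwise 𝟛 ne = proj₂ (proj₂ agree)

  balanced-invariant : ∀ {F} → Symmetricᴺ F → F (N 𝟙) (N 𝟚) (N 𝟛) ≡ F (M 𝟙) (M 𝟚) (M 𝟛)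
  balanced-invariant {F} s = trans (sym (N.invariant {F} s))
    (trans (congF (proj₁ agree) (proj₁ (proj₂ agree)) (proj₂ (proj₂ agree))) (M.invariant {F} s))
    where
    congF : ∀ {a a′ b b′ c c′} → a ≡ a′ → b ≡ b′ → c ≡ c′ → F a b c ≡ F a′ b′ c′
    congF refl refl refl = refl

sizes : ℕ → ℕ → ℕ → K → ℕ
sizes a b c 𝟘 = 0
sizes a b c 𝟙 = a
sizes a b c 𝟚 = b
sizes a b c 𝟛 = c

-- The maximum is never computed. Some triple attains it and is balanced by `max⇒balanced`; balanced
-- triples of equal sum are rearrangements of each other, and the objective is symmetric.
balanced⇒max : ∀ {t m} → LargeThird t m → ∀ a b c → a + b + c ≡ m → Balanced a b c →
               objective t a b c ≡ maxObjective m t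
balanced⇒max {t} {m} L a b c e bal = step (max-attained m t 3≤m)
  where
  3≤m : 3 ≤ m
  3≤m = ≤-trans (*-monoʳ-≤ 3 (LargeThird.1≤k L)) (≤-trans (m≤m+n _ _) (≤-reflexive (LargeThird.split L)))
  step : (∃ λ (τ : Triple m) → Triple.value τ t ≡ maxObjective m t) → objective t a b c ≡ maxObjective m t
  step (triple a′ b′ c′ 1≤a 1≤b 1≤c e′ , max) = trans
    (balanced-invariant (sizes a b c) (sizes a′ b′ c′) (Balanced⇒K (sizes a b c) bal)
      (Balanced⇒K (sizes a′ b′ c′) (max⇒balanced L a′ b′ c′ 1≤a 1≤b 1≤c e′ (≤-reflexive (sym max))))
      (trans e (sym e′)) {F = objective t} (objective-swap₁₂ t , objective-swap₂₃ t)) max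

-- The extremal construction

Free : ℕ → Graph3 n → Set
Free {n} t h = (φ : Fin (7 + t) → Fin n) → Injective _≡_ _≡_ φ →
  (∀ a b c → FsimEdge t a b c → h (φ a) (φ b) (φ c) ≡ true) → ⊥

FsimFree⇒Free : ∀ {t} (E : Graph3 n) → FsimFree t E → Free t (hyper E)
FsimFree⇒Free E free φ inj e = free (φ , inj , λ a b c f → hyper⇒Edge E (e a b c f))

Free⇒FsimFree : ∀ {t} (E : Graph3 n) → Free t (hyper E) → FsimFree t E
Free⇒FsimFree E free (φ , inj , e) = free φ inj λ a b c f → Edge⇒hyper E (e a b c f)

Free-cong : ∀ {t} {h k : Graph3 n} → (∀ x y z → h x y z ≡ k x y z) → Free t h → Free t k
Free-cong eq free φ inj e = free φ inj λ a b c f → trans (eq _ _ _) (e a b c f)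

klein : (Fin n → K) → Graph3 n
klein κ x y z = ((x ≠ y) ∧ (y ≠ z) ∧ (x ≠ z)) ∧ (κ z =ᴷ κ x ⊕ κ y)

==-comm : (x y : Fin n) → (x == y) ≡ (y == x)
==-comm x y with x Fin.≟ y | y Fin.≟ x
... | yes _ | yes _ = refl
... | yes p | no ¬q = contradiction (sym p) ¬q
... | no ¬p | yes q = contradiction (sym q) ¬p
... | no _  | no _  = refl

klein-3graph : (κ : Fin n → K) → Is3Graph (klein κ)
klein-3graph κ .swap₁₂ x y z = cong₂ _∧_
  (trans (cong (λ b → not b ∧ (y ≠ z) ∧ (x ≠ z)) (==-comm x y)) (∧-perm₁ (y ≠ x) (y ≠ z) (x ≠ z)))
  (cong (κ z =ᴷ_) (⊕-comm (κ x) (κ y)))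
  where
  ∧-perm₁ : ∀ a b c → a ∧ b ∧ c ≡ a ∧ c ∧ b
  ∧-perm₁ a b c = cong (a ∧_) (∧-comm b c)
klein-3graph κ .swap₂₃ x y z = cong₂ _∧_
  (trans (∧-perm₂ (x ≠ y) (y ≠ z) (x ≠ z)) (cong (λ b → (x ≠ z) ∧ not b ∧ (x ≠ y)) (==-comm y z)))
  (swap (κ x) (κ y) (κ z))
  where
  ∧-perm₂ : ∀ a b c → a ∧ b ∧ c ≡ c ∧ b ∧ a
  ∧-perm₂ a b c = trans (∧-comm a (b ∧ c)) (trans (cong (_∧ a) (∧-comm b c)) (∧-assoc c b a))
  swap : ∀ x y z → (z =ᴷ x ⊕ y) ≡ (y =ᴷ x ⊕ z)
  swap x y z with z =ᴷ x ⊕ y in e | y =ᴷ x ⊕ z in f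
  ... | true  | true  = refl
  ... | false | false = refl
  ... | true  | false with refl ← =ᴷ⇒≡ z (x ⊕ y) e =
    true≢false (trans (cong (y =ᴷ_) (⊕-cancel x y)) (=ᴷ-refl y)) f
  ... | false | true  with refl ← =ᴷ⇒≡ y (x ⊕ z) f =
    true≢false (trans (cong (z =ᴷ_) (⊕-cancel x z)) (=ᴷ-refl z)) e
klein-3graph κ .loopless x z rewrite ==-refl x = refl

klein-colour : (κ : Fin n → K) (x y z : Fin n) → klein κ x y z ≡ true → κ z ≡ κ x ⊕ κ y
klein-colour κ x y z e = =ᴷ⇒≡ _ _ (∧-trueʳ {(x ≠ y) ∧ (y ≠ z) ∧ (x ≠ z)} e)

class : (Fin n → K) → K → ℕ
class κ i = # λ v → κ v =ᴷ i

-- The common neighbours f₁f₂ force κ f₃ = κ f₄, hence κ f₅ = 𝟘; then f₆ and f₇ have equal colours,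
-- so f₅ and all gᵢ are t + 1 vertices of colour 𝟘.
klein-free : ∀ {t} (κ : Fin n → K) → class κ 𝟘 ≤ t → Free t (klein κ)
klein-free {n} {t} κ few φ inj e =
  <-irrefl refl (≤-trans (injection-≤# ψ ψ-inj (λ v → κ v =ᴷ 𝟘) ψ-𝟘) few)
  where
  κφ : Fin (7 + t) → K
  κφ v = κ (φ v)
  colour : ∀ {a b c} → FsimEdge t a b c → κφ c ≡ κφ a ⊕ κφ b
  colour f = klein-colour κ _ _ _ (e _ _ _ f)
  κ₃₄ : κφ (f3 t) ≡ κφ (f4 t)
  κ₃₄ = trans (colour e123) (sym (colour e124))
  κ₅ : κφ (f5 t) ≡ 𝟘
  κ₅ = trans (colour e345) (trans (cong (_⊕ κφ (f4 t)) κ₃₄) (⊕-self (κφ (f4 t))))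
  κ₆₇ : κφ (f7 t) ≡ κφ (f6 t)
  κ₆₇ = trans (colour e567) (cong (_⊕ κφ (f6 t)) κ₅)
  κg : ∀ i → κφ (gv t i) ≡ 𝟘
  κg i = trans (colour (e67g i)) (trans (cong (κφ (f6 t) ⊕_) κ₆₇) (⊕-self (κφ (f6 t))))
  ψ : Fin (suc t) → Fin n
  ψ = φ (f5 t) ◃ λ i → φ (gv t i)
  ψ-inj : Injective _≡_ _≡_ ψ
  ψ-inj = ◃-injective (λ i p → case inj p of λ ()) (λ p → Fin.↑ʳ-injective 7 _ _ (inj p))
  ψ-𝟘 : ∀ i → (κ (ψ i) =ᴷ 𝟘) ≡ true
  ψ-𝟘 zero    = cong (_=ᴷ 𝟘) κ₅
  ψ-𝟘 (suc i) = cong (_=ᴷ 𝟘) (κg i)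

class-suc : (κ : Fin (suc n) → K) (i : Fin (suc n)) (x : K) →
            class κ x ≡ ⟦ κ i =ᴷ x ⟧ + class (λ j → κ (punchIn i j)) x
class-suc κ i x = ∑-remove _ i

-- Vertex `zero` is matched with any vertex of its colour under `κ′`; deleting both keeps the class
-- sizes equal.
recolour : (κ κ′ : Fin n → K) → (∀ x → class κ x ≡ class κ′ x) →
           ∃ λ (π : Permutation n n) → ∀ v → κ′ (π ⟨$⟩ʳ v) ≡ κ v
recolour {zero}  κ κ′ e = Perm.id , λ ()
recolour {suc n} κ κ′ e with #-witness (λ v → κ′ v =ᴷ κ zero) positive
  where
  positive : 0 < class κ′ (κ zero)
  positive = ≤-trans (≤-trans (≤-reflexive (cong ⟦_⟧ (sym (=ᴷ-refl (κ zero)))))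
    (≤∑ (λ v → ⟦ κ v =ᴷ κ zero ⟧) zero)) (≤-reflexive (e (κ zero)))
... | j , κ′j with recolour (λ i → κ (suc i)) (λ i → κ′ (punchIn j i)) rest
  where
  rest : ∀ x → class (λ i → κ (suc i)) x ≡ class (λ i → κ′ (punchIn j i)) x
  rest x = +-cancelˡ-≡ ⟦ κ zero =ᴷ x ⟧ _ _
    (trans (sym (class-suc κ zero x)) (trans (e x) (trans (class-suc κ′ j x)
      (cong (λ c → ⟦ c =ᴷ x ⟧ + class (λ i → κ′ (punchIn j i)) x) (=ᴷ⇒≡ _ _ κ′j)))))
...   | π , same = Perm.insert zero j π , coloured
  where
  coloured : ∀ v → κ′ (Perm.insert zero j π ⟨$⟩ʳ v) ≡ κ v
  coloured zero    = =ᴷ⇒≡ _ _ κ′j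
  coloured (suc v) = trans (cong κ′ (Perm.insert-punchIn zero j π v)) (same v)

klein-permute : (κ κ′ : Fin n → K) (π : Permutation n n) → (∀ v → κ′ (π ⟨$⟩ʳ v) ≡ κ v) →
  ∀ x y z → klein κ x y z ≡ klein κ′ (π ⟨$⟩ʳ x) (π ⟨$⟩ʳ y) (π ⟨$⟩ʳ z)
klein-permute κ κ′ π e x y z = cong₂ _∧_
  (cong₂ _∧_ (cong not (eq x y)) (cong₂ _∧_ (cong not (eq y z)) (cong not (eq x z))))
  (trans (cong₂ (λ a b → a =ᴷ b ⊕ κ y) (sym (e z)) (sym (e x))) (cong (λ b → κ′ (π ⟨$⟩ʳ z) =ᴷ κ′ (π ⟨$⟩ʳ x) ⊕ b) (sym (e y))))
  where
  eq : ∀ u v → (u == v) ≡ ((π ⟨$⟩ʳ u) == (π ⟨$⟩ʳ v))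
  eq u v with u Fin.≟ v | (π ⟨$⟩ʳ u) Fin.≟ (π ⟨$⟩ʳ v)
  ... | yes _ | yes _ = refl
  ... | no _  | no _  = refl
  ... | yes p | no ¬q = contradiction (cong (π ⟨$⟩ʳ_) p) ¬q
  ... | no ¬p | yes q = contradiction (trans (sym (Perm.inverseˡ π)) (trans (cong (π Perm.⟨$⟩ˡ_) q) (Perm.inverseˡ π))) ¬p

klein-aut : (ρ : Aut) (κ : Fin n → K) → ∀ x y z → klein (λ v → Aut.to ρ (κ v)) x y z ≡ klein κ x y z
klein-aut ρ κ x y z = cong (((x ≠ y) ∧ (y ≠ z) ∧ (x ≠ z)) ∧_)
  (trans (cong (to (κ z) =ᴷ_) (sym (hom (κ x) (κ y)))) (to-=ᴷ (κ z) (κ x ⊕ κ y)))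
  where
  open Aut ρ
  to-=ᴷ : ∀ a b → (to a =ᴷ to b) ≡ (a =ᴷ b)
  to-=ᴷ a b with a =ᴷ b in e
  ... | true  with refl ← =ᴷ⇒≡ a b e = =ᴷ-refl (to a)
  ... | false = ¬-not λ f → true≢false (trans (cong (_=ᴷ b) (trans (sym (from-to a)) (trans (cong from (=ᴷ⇒≡ _ _ f)) (from-to b)))) (=ᴷ-refl b)) e

size-permute : (h k : Graph3 n) (π : Permutation n n) →
  (∀ x y z → h x y z ≡ k (π ⟨$⟩ʳ x) (π ⟨$⟩ʳ y) (π ⟨$⟩ʳ z)) → size h ≡ size k
size-permute h k π e = trans (∑₃-cong λ x y z → cong ⟦_⟧ (e x y z))
  (trans (∑-cong λ x → trans (∑-cong λ y → ∑-perm _ π) (∑-perm (λ y → # (k (π ⟨$⟩ʳ x) y)) π))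
         (∑-perm (λ x → #₂ (k x)) π))

partColour : ℕ → K
partColour 0 = 𝟙
partColour 1 = 𝟚
partColour _ = 𝟛

constructionColour : ℕ → ℕ → K
constructionColour t v = if v <ᵇ t then 𝟘 else partColour ((v ∸ t) % 3)

consColour : (t : ℕ) → Fin n → K
consColour t v = constructionColour t (toℕ v)

isQ : K → Bool
isQ 𝟘 = true
isQ _ = false

-- On Q the truncated difference `toℕ v ∸ t` is 0, so `part` is 0 there, as it is for colour 𝟙;
-- `isQ` tells the two apart.
partIndex : K → ℕ
partIndex 𝟘 = 0
partIndex 𝟙 = 0
partIndex 𝟚 = 1
partIndex 𝟛 = 2

inQ-colour : (t : ℕ) (v : Fin n) → inQ t v ≡ isQ (consColour t v)
inQ-colour t v with toℕ v <ᵇ t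
... | true  = refl
... | false with (toℕ v ∸ t) % 3
...   | 0           = refl
...   | 1           = refl
...   | suc (suc _) = refl

part-colour : (t : ℕ) (v : Fin n) → part t v ≡ partIndex (consColour t v)
part-colour t v with toℕ v <ᵇ t in e
... | true  = cong (_% 3) (m≤n⇒m∸n≡0 (<⇒≤ (<ᵇ⇒< (toℕ v) t (Equivalence.from T-≡ e))))
... | false with (toℕ v ∸ t) % 3 | m%n<n (toℕ v ∸ t) 3
...   | 0                 | _ = refl
...   | 1                 | _ = refl
...   | 2                 | _ = refl
...   | suc (suc (suc _)) | s≤s (s≤s (s≤s ()))

≡ᵇ-== : (x y : Fin n) → (toℕ x ≡ᵇ toℕ y) ≡ (x == y)
≡ᵇ-== x y with x Fin.≟ y
... | yes refl = Equivalence.to T-≡ (≡⇒≡ᵇ (toℕ x) (toℕ x) refl)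
... | no ¬p    = ¬-not λ e → ¬p (Fin.toℕ-injective (≡ᵇ⇒≡ (toℕ x) (toℕ y) (Equivalence.from T-≡ e)))

module _ (bx by bz : Bool) (px py pz : ℕ) where
  private
    same : Bool → Bool → ℕ → ℕ → Bool
    same b b′ p p′ = not b ∧ not b′ ∧ (p ≡ᵇ p′)

  edgeShape′ : Bool
  edgeShape′ =
      (bx ∧ by ∧ bz)
    ∨ (bx ∧ same by bz py pz)
    ∨ (by ∧ same bx bz px pz)
    ∨ (bz ∧ same bx by px py)
    ∨ (not bx ∧ not by ∧ not bz ∧ not (px ≡ᵇ py) ∧ not (py ≡ᵇ pz) ∧ not (px ≡ᵇ pz))

edgeShape : K → K → K → Bool
edgeShape x y z = edgeShape′ (isQ x) (isQ y) (isQ z) (partIndex x) (partIndex y) (partIndex z)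

edgeShape-⊕ : ∀ x y z → edgeShape x y z ≡ (z =ᴷ x ⊕ y)
edgeShape-⊕ = byTableᵇ₃ edgeShape (λ x y z → z =ᴷ x ⊕ y) refl

consEdge-klein : (t : ℕ) → ∀ x y z → consEdge n t x y z ≡ klein (consColour t) x y z
consEdge-klein t x y z = cong₂ _∧_
  (cong₂ _∧_ (cong not (≡ᵇ-== x y)) (cong₂ _∧_ (cong not (≡ᵇ-== y z)) (cong not (≡ᵇ-== x z))))
  (trans shape (edgeShape-⊕ (consColour t x) (consColour t y) (consColour t z)))
  where
  cong₆ : ∀ {a a′ b b′ c c′ p p′ q q′ r r′} → a ≡ a′ → b ≡ b′ → c ≡ c′ → p ≡ p′ → q ≡ q′ → r ≡ r′ →
          edgeShape′ a b c p q r ≡ edgeShape′ a′ b′ c′ p′ q′ r′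
  cong₆ refl refl refl refl refl refl = refl
  shape : edgeShape′ (inQ t x) (inQ t y) (inQ t z) (part t x) (part t y) (part t z)
        ≡ edgeShape (consColour t x) (consColour t y) (consColour t z)
  shape = cong₆ (inQ-colour t x) (inQ-colour t y) (inQ-colour t z)
                (part-colour t x) (part-colour t y) (part-colour t z)

∑-append : ∀ a {b} (g : ℕ → ℕ) →
           ∑ {a + b} (λ i → g (toℕ i)) ≡ ∑ {a} (λ i → g (toℕ i)) + ∑ {b} (λ j → g (a + toℕ j))
∑-append zero    g = sym (cong (_+ ∑ (λ j → g (toℕ j))) (∑-empty _))
∑-append (suc a) g = trans (∑-suc _) (trans (cong (g 0 +_) (∑-append a (λ i → g (suc i))))
  (trans (sym (+-assoc (g 0) _ _)) (cong₂ _+_ (sym (∑-suc _)) refl)))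

partCount : ℕ → K → ℕ
partCount m x = ∑ {m} λ j → ⟦ partColour (toℕ j % 3) =ᴷ x ⟧

partCount-+3 : ∀ m {x} → x ≢ 𝟘 → partCount (3 + m) x ≡ suc (partCount m x)
partCount-+3 m {x} ne =
  trans (∑-suc _) (trans (cong (⟦ 𝟙 =ᴷ x ⟧ +_) (trans (∑-suc _) (cong (⟦ 𝟚 =ᴷ x ⟧ +_) (∑-suc _)))) (one x ne))
  where
  one : ∀ x → x ≢ 𝟘 → ⟦ 𝟙 =ᴷ x ⟧ + (⟦ 𝟚 =ᴷ x ⟧ + (⟦ 𝟛 =ᴷ x ⟧ + partCount m x)) ≡ suc (partCount m x)
  one 𝟘 ne = contradiction refl ne
  one 𝟙 _  = refl
  one 𝟚 _  = refl
  one 𝟛 _  = refl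

partCount-≤2 : ∀ m → m ≤ 2 → ∀ x → partCount m x ≤ 1
partCount-≤2 0 _ x = ≤-trans (≤-reflexive (∑-empty _)) z≤n
partCount-≤2 1 _ x = ≤-trans (≤-reflexive (trans (∑-suc _) (cong (⟦ 𝟙 =ᴷ x ⟧ +_) (∑-empty _))))
  (≤-trans (≤-reflexive (+-identityʳ _)) (⟦⟧-≤1 (𝟙 =ᴷ x)))
partCount-≤2 2 _ x = ≤-trans (≤-reflexive (trans (∑-suc _) (cong (⟦ 𝟙 =ᴷ x ⟧ +_)
  (trans (∑-suc _) (cong (⟦ 𝟚 =ᴷ x ⟧ +_) (∑-empty _)))))) (two x)
  where
  two : ∀ x → ⟦ 𝟙 =ᴷ x ⟧ + (⟦ 𝟚 =ᴷ x ⟧ + 0) ≤ 1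
  two 𝟘 = z≤n
  two 𝟙 = s≤s z≤n
  two 𝟚 = s≤s z≤n
  two 𝟛 = z≤n
partCount-≤2 (suc (suc (suc m))) (s≤s (s≤s ())) x

partCount-balanced : ∀ m → BalancedK (partCount m)
partCount-balanced 0 {x} p q = ≤-trans (partCount-≤2 0 z≤n x) (s≤s z≤n)
partCount-balanced 1 {x} p q = ≤-trans (partCount-≤2 1 (s≤s z≤n) x) (s≤s z≤n)
partCount-balanced 2 {x} p q = ≤-trans (partCount-≤2 2 (s≤s (s≤s z≤n)) x) (s≤s z≤n)
partCount-balanced (suc (suc (suc m))) p q =
  ≤-trans (≤-reflexive (partCount-+3 m p)) (s≤s (≤-trans (partCount-balanced m p q) (≤-reflexive (sym (partCount-+3 m q)))))

sum-class : (κ : Fin n → K) (f : K → ℕ) →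
  ∑ (λ v → f (κ v)) ≡ class κ 𝟘 * f 𝟘 + (class κ 𝟙 * f 𝟙 + (class κ 𝟚 * f 𝟚 + class κ 𝟛 * f 𝟛))
sum-class κ f = trans (∑-cong λ v → expand (κ v))
  (trans (∑-+ _ _) (cong₂ _+_ (∑-*ʳ _ _) (trans (∑-+ _ _) (cong₂ _+_ (∑-*ʳ _ _)
    (trans (∑-+ _ _) (cong₂ _+_ (∑-*ʳ _ _) (∑-*ʳ _ _)))))))
  where
  p₀ : ∀ a b c d → a ≡ 1 * a + (0 * b + (0 * c + 0 * d))
  p₀ = solve-∀
  p₁ : ∀ a b c d → b ≡ 0 * a + (1 * b + (0 * c + 0 * d))
  p₁ = solve-∀
  p₂ : ∀ a b c d → c ≡ 0 * a + (0 * b + (1 * c + 0 * d))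
  p₂ = solve-∀
  p₃ : ∀ a b c d → d ≡ 0 * a + (0 * b + (0 * c + 1 * d))
  p₃ = solve-∀
  expand : ∀ x → f x ≡ ⟦ x =ᴷ 𝟘 ⟧ * f 𝟘 + (⟦ x =ᴷ 𝟙 ⟧ * f 𝟙 + (⟦ x =ᴷ 𝟚 ⟧ * f 𝟚 + ⟦ x =ᴷ 𝟛 ⟧ * f 𝟛))
  expand 𝟘 = p₀ (f 𝟘) (f 𝟙) (f 𝟚) (f 𝟛)
  expand 𝟙 = p₁ (f 𝟘) (f 𝟙) (f 𝟚) (f 𝟛)
  expand 𝟚 = p₂ (f 𝟘) (f 𝟙) (f 𝟚) (f 𝟛)
  expand 𝟛 = p₃ (f 𝟘) (f 𝟙) (f 𝟚) (f 𝟛)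

class-total : (κ : Fin n → K) → class κ 𝟘 + total (class κ) ≡ n
class-total {n} κ = trans (rearrange (class κ 𝟘) (class κ 𝟙) (class κ 𝟚) (class κ 𝟛))
  (trans (sym (sum-class κ (λ _ → 1))) (trans (∑-const n 1) (*-identityʳ n)))
  where
  rearrange : ∀ w a b c → w + (a + b + c) ≡ w * 1 + (a * 1 + (b * 1 + c * 1))
  rearrange = solve-∀

module _ (t m : ℕ) where
  private
    κ : Fin (t + m) → K
    κ = consColour t

    split : ∀ x → class κ x ≡ ∑ {t} (λ i → ⟦ constructionColour t (toℕ i) =ᴷ x ⟧)
                            + ∑ {m} (λ j → ⟦ constructionColour t (t + toℕ j) =ᴷ x ⟧)
    split x = ∑-append t (λ v → ⟦ constructionColour t v =ᴷ x ⟧)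

    low : ∀ (i : Fin t) → constructionColour t (toℕ i) ≡ 𝟘
    low i rewrite Equivalence.to T-≡ (<⇒<ᵇ (Fin.toℕ<n i)) = refl

    high : ∀ j → constructionColour t (t + j) ≡ partColour (j % 3)
    high j rewrite ¬-not {t + j <ᵇ t} (λ e → <⇒≱ (<ᵇ⇒< (t + j) t (Equivalence.from T-≡ e)) (m≤m+n t j))
                 | m+n∸m≡n t j = refl

    partColour≢𝟘 : ∀ r → (partColour r =ᴷ 𝟘) ≡ false
    partColour≢𝟘 0             = refl
    partColour≢𝟘 1             = refl
    partColour≢𝟘 (suc (suc r)) = refl

  cons-class-𝟘 : class κ 𝟘 ≡ t
  cons-class-𝟘 = trans (split 𝟘) (trans (cong₂ _+_
    (trans (∑-cong λ i → cong (λ c → ⟦ c =ᴷ 𝟘 ⟧) (low i)) (trans (∑-const t 1) (*-identityʳ t)))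
    (∑-zero _ λ j → cong ⟦_⟧ (trans (cong (_=ᴷ 𝟘) (high (toℕ j))) (partColour≢𝟘 (toℕ j % 3))))) (+-identityʳ t))

  cons-class : ∀ {x} → x ≢ 𝟘 → class κ x ≡ partCount m x
  cons-class {x} ne = trans (split x) (cong₂ _+_
    (∑-zero _ λ i → trans (cong (λ c → ⟦ c =ᴷ x ⟧) (low i)) (zero-colour x ne))
    (∑-cong λ j → cong (λ c → ⟦ c =ᴷ x ⟧) (high (toℕ j))))
    where
    zero-colour : ∀ x → x ≢ 𝟘 → ⟦ 𝟘 =ᴷ x ⟧ ≡ 0
    zero-colour 𝟘 ne = contradiction refl ne
    zero-colour 𝟙 ne = refl
    zero-colour 𝟚 ne = refl
    zero-colour 𝟛 ne = refl

  cons-balanced : BalancedK (class κ)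
  cons-balanced p q = subst₂ (λ a b → a ≤ suc b) (sym (cons-class p)) (sym (cons-class q)) (partCount-balanced m p q)

  cons-total : total (class κ) ≡ m
  cons-total = +-cancelˡ-≡ t _ _ (trans (cong (_+ total (class κ)) (sym cons-class-𝟘)) (class-total κ))

∑-δ : (f : Fin n → ℕ) (x : Fin n) → ∑ (λ y → ⟦ y == x ⟧ * f y) ≡ f x
∑-δ {suc n} f zero = trans (∑-suc _) (trans (cong₂ _+_ (+-identityʳ (f zero)) (∑-zero (λ i → ⟦ suc i == zero ⟧ * f (suc i)) λ _ → refl)) (+-identityʳ _))
∑-δ {suc n} f (suc x) = trans (∑-suc _) (∑-δ (λ i → f (suc i)) x)

module _ (κ : Fin n → K) where
  private
    s : Fin n → Fin n → Fin n → ℕ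
    s x y z = ⟦ κ z =ᴷ κ x ⊕ κ y ⟧

    w = class κ 𝟘

    inclusion-exclusion : ∀ x y z →
      ⟦ klein κ x y z ⟧ + (⟦ y == x ⟧ * s x y z + (⟦ z == x ⟧ * s x y z + ⟦ z == y ⟧ * s x y z))
      ≡ s x y z + 2 * (⟦ y == x ⟧ * (⟦ z == x ⟧ * s x y z))
    inclusion-exclusion x y z
      rewrite ==-comm y x | ==-comm z x | ==-comm z y
      with x Fin.≟ y | y Fin.≟ z | x Fin.≟ z
    ... | yes _ | yes _ | yes _ = e (s x y z)
      where
      e : ∀ a → 0 + (1 * a + (1 * a + 1 * a)) ≡ a + 2 * (1 * (1 * a))
      e = solve-∀
    ... | yes p | no ¬q | yes r = contradiction (trans (sym p) r) ¬q
    ... | yes p | yes q | no ¬r = contradiction (trans p q) ¬r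
    ... | no ¬p | yes q | yes r = contradiction (trans r (sym q)) ¬p
    ... | yes _ | no _  | no _  = e (s x y z)
      where
      e : ∀ a → 0 + (1 * a + (0 * a + 0 * a)) ≡ a + 2 * (1 * (0 * a))
      e = solve-∀
    ... | no _  | yes _ | no _  = e (s x y z)
      where
      e : ∀ a → 0 + (0 * a + (0 * a + 1 * a)) ≡ a + 2 * (0 * (0 * a))
      e = solve-∀
    ... | no _  | no _  | yes _ = e (s x y z)
      where
      e : ∀ a → 0 + (0 * a + (1 * a + 0 * a)) ≡ a + 2 * (0 * (1 * a))
      e = solve-∀
    ... | no _  | no _  | no _  = e (s x y z)
      where
      e : ∀ a → a + (0 * a + (0 * a + 0 * a)) ≡ a + 2 * (0 * (0 * a))
      e = solve-∀

    =ᴷ-⊕ˡ : ∀ a b → (a =ᴷ a ⊕ b) ≡ (b =ᴷ 𝟘)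
    =ᴷ-⊕ˡ = byTableᵇ₂ (λ a b → a =ᴷ a ⊕ b) (λ a b → b =ᴷ 𝟘) refl

    diag-yx : ∑₃ (λ x y z → ⟦ y == x ⟧ * s x y z) ≡ n * w
    diag-yx = trans (∑-cong λ x → trans (∑-cong λ y → ∑-*ˡ ⟦ y == x ⟧ (s x y)) (trans (∑-δ (λ y → ∑ (s x y)) x)
      (∑-cong λ z → cong (λ c → ⟦ κ z =ᴷ c ⟧) (⊕-self (κ x))))) (∑-const n w)

    diag-zx : ∑₃ (λ x y z → ⟦ z == x ⟧ * s x y z) ≡ n * w
    diag-zx = trans (∑-cong λ x → ∑-cong λ y → trans (∑-δ (s x y) x) (cong ⟦_⟧ (=ᴷ-⊕ˡ (κ x) (κ y)))) (∑-const n w)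

    diag-zy : ∑₃ (λ x y z → ⟦ z == y ⟧ * s x y z) ≡ n * w
    diag-zy = trans (∑-cong λ x → ∑-cong λ y → trans (∑-δ (s x y) y)
        (cong ⟦_⟧ (trans (cong (κ y =ᴷ_) (⊕-comm (κ x) (κ y))) (=ᴷ-⊕ˡ (κ y) (κ x)))))
      (trans (∑₂-swap (λ x y → ⟦ κ y =ᴷ 𝟘 ⟧)) (∑-const n w))

    diag-zyx : ∑₃ (λ x y z → ⟦ y == x ⟧ * (⟦ z == x ⟧ * s x y z)) ≡ w
    diag-zyx = ∑-cong λ x → trans (∑-cong λ y → trans (∑-*ˡ ⟦ y == x ⟧ _) (cong (⟦ y == x ⟧ *_) (∑-δ (s x y) x)))
      (trans (∑-δ (λ y → s x y x) x) (cong ⟦_⟧ (=ᴷ-⊕ˡ (κ x) (κ x))))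

    all-triples : ∑₃ s ≡ w * w * w + 6 * (class κ 𝟙 * class κ 𝟚 * class κ 𝟛)
      + 3 * (w * (class κ 𝟙 * class κ 𝟙 + class κ 𝟚 * class κ 𝟚 + class κ 𝟛 * class κ 𝟛))
    all-triples = trans (∑-cong λ x → sum-class κ (λ j → class κ (κ x ⊕ j)))
      (trans (sum-class κ (λ i → w * class κ (i ⊕ 𝟘) + (class κ 𝟙 * class κ (i ⊕ 𝟙) + (class κ 𝟚 * class κ (i ⊕ 𝟚) + class κ 𝟛 * class κ (i ⊕ 𝟛)))))
        (expand w (class κ 𝟙) (class κ 𝟚) (class κ 𝟛)))
      where
      expand : ∀ w a b c →
        w * (w * w + (a * a + (b * b + c * c))) + (a * (w * a + (a * w + (b * c + c * b)))
          + (b * (w * b + (a * c + (b * w + c * a))) + c * (w * c + (a * b + (b * a + c * w)))))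
        ≡ w * w * w + 6 * (a * b * c) + 3 * (w * (a * a + b * b + c * c))
      expand = solve-∀

  -- Inclusion-exclusion over coincidences among x, y, z, with negative terms moved across. In a
  -- triple of colour sum 𝟘 two equal vertices force the third to have colour 𝟘, so each of the
  -- three diagonals contributes n w; the full diagonal contributes w and enters twice.
  klein-size : size (klein κ) + 3 * (n * w) ≡ w * w * w + 6 * (class κ 𝟙 * class κ 𝟚 * class κ 𝟛)
    + 3 * (w * (class κ 𝟙 * class κ 𝟙 + class κ 𝟚 * class κ 𝟚 + class κ 𝟛 * class κ 𝟛)) + 2 * w
  klein-size = begin
    size (klein κ) + 3 * (n * w)
      ≡⟨ three (size (klein κ)) (n * w) ⟩
    size (klein κ) + (n * w + (n * w + n * w))
      ≡⟨ cong (size (klein κ) +_) (sym (trans (∑₃-+ _ _) (cong₂ _+_ diag-yx (trans (∑₃-+ _ _) (cong₂ _+_ diag-zx diag-zy))))) ⟩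
    size (klein κ) + ∑₃ (λ x y z → ⟦ y == x ⟧ * s x y z + (⟦ z == x ⟧ * s x y z + ⟦ z == y ⟧ * s x y z))
      ≡⟨ trans (sym (∑₃-+ _ _)) (trans (∑₃-cong inclusion-exclusion) (∑₃-+ _ _)) ⟩
    ∑₃ s + ∑₃ (λ x y z → 2 * (⟦ y == x ⟧ * (⟦ z == x ⟧ * s x y z)))
      ≡⟨ cong₂ _+_ all-triples (trans (∑₃-*ˡ 2 _) (cong (2 *_) diag-zyx)) ⟩
    _ ∎
    where
    open ≡-Reasoning
    three : ∀ a b → a + 3 * b ≡ a + (b + (b + b))
    three = solve-∀

  -- The objective appears with the actual number w of vertices of colour 𝟘 in place of t. The
  -- comparison needs this generality, because w is not yet known there.
  klein-size-objective : size (klein κ) ≡ 6 * (objective w (class κ 𝟙) (class κ 𝟚) (class κ 𝟛) + w C 3)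
  klein-size-objective = +-cancelʳ-≡ (3 * (n * w)) _ _ (trans klein-size (sym (begin
    6 * (objective w N₁ N₂ N₃ + w C 3) + 3 * (n * w)
      ≡⟨ cong (λ k → 6 * (objective w N₁ N₂ N₃ + w C 3) + 3 * (k * w)) (sym (class-total κ)) ⟩
    6 * (objective w N₁ N₂ N₃ + w C 3) + 3 * ((w + (N₁ + N₂ + N₃)) * w)
      ≡⟨ ring₁ (objective w N₁ N₂ N₃) (w C 3) w (N₁ + N₂ + N₃) ⟩
    3 * (2 * objective w N₁ N₂ N₃ + w * (N₁ + N₂ + N₃)) + (6 * (w C 3) + 3 * (w * w))
      ≡⟨ cong₂ (λ p q → 3 * p + q) (objective-Φ w N₁ N₂ N₃) (C3-cube w) ⟩
    3 * Φ w N₁ N₂ N₃ + (w * w * w + 2 * w)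
      ≡⟨ ring₂ w N₁ N₂ N₃ ⟩
    w * w * w + 6 * (N₁ * N₂ * N₃) + 3 * (w * (N₁ * N₁ + N₂ * N₂ + N₃ * N₃)) + 2 * w ∎)))
    where
    open ≡-Reasoning
    N₁ = class κ 𝟙
    N₂ = class κ 𝟚
    N₃ = class κ 𝟛
    ring₁ : ∀ p q w m → 6 * (p + q) + 3 * ((w + m) * w) ≡ 3 * (2 * p + w * m) + (6 * q + 3 * (w * w))
    ring₁ = solve-∀
    ring₂ : ∀ w a b c → 3 * (2 * (a * b * c) + w * (a * a + b * b + c * c)) + (w * w * w + 2 * w)
          ≡ w * w * w + 6 * (a * b * c) + 3 * (w * (a * a + b * b + c * c)) + 2 * w
    ring₂ = solve-∀

-- Completing F_sim(t)

codeg : Graph3 n → Fin n → Fin n → ℕ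
codeg h x y = # (h x y)

Extension : (t : ℕ) → Graph3 n → Fin n → List (Fin n) → Set
Extension {n} t h v L =
  ∃₂ λ p q → ∃ λ (g : Fin t → Fin n) → h v p q ≡ true × (∀ i → h p q (g i) ≡ true) ×
    Injective _≡_ _≡_ g × Avoids L p × Avoids L q × (∀ i → Avoids (v ∷ L) (g i))

-- v can be f₅: with any images of f₁, …, f₄ avoided, f₆, f₇ and the gᵢ can still be chosen.
Supported : ℕ → Graph3 n → Fin n → Set
Supported t h v = ∀ L → length L ≤ 4 → Extension t h v L

-- v plays the role of f₅ in a copy of {f₁f₂f₃, f₁f₂f₄, f₃f₄f₅} that avoids any t + 2 given vertices.
RobustApex : ℕ → Graph3 n → Fin n → Set
RobustApex {n} t h v = (L : List (Fin n)) → length L ≤ 2 + t →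
  ∃₂ λ f₁ f₂ → ∃₂ λ f₃ f₄ → h f₁ f₂ f₃ ≡ true × h f₁ f₂ f₄ ≡ true × h f₃ f₄ v ≡ true ×
    Avoids (v ∷ L) f₁ × Avoids (v ∷ L) f₂ × Avoids L f₃ × Avoids L f₄

module _ {t : ℕ} {h : Graph3 n} (H : Is3Graph h) (free : Free t h) where

  -- Vertices in a common edge are distinct because `h` is loopless. The hypotheses on distinctness
  -- cover the pairs of vertices of the copy that share no edge.
  forbid : ∀ {f₁ f₂ f₃ f₄ v p q} {g : Fin t → Fin n} →
    h f₁ f₂ f₃ ≡ true → h f₁ f₂ f₄ ≡ true → h f₃ f₄ v ≡ true → h v p q ≡ true →
    (∀ i → h p q (g i) ≡ true) → f₁ ≢ v → f₂ ≢ v →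
    Avoids (f₁ ∷ f₂ ∷ f₃ ∷ f₄ ∷ []) p → Avoids (f₁ ∷ f₂ ∷ f₃ ∷ f₄ ∷ []) q →
    Injective _≡_ _≡_ g → (∀ i → Avoids (v ∷ f₁ ∷ f₂ ∷ f₃ ∷ f₄ ∷ []) (g i)) → ⊥
  forbid {f₁} {f₂} {f₃} {f₄} {v} {p} {q} {g} e₁₂₃ e₁₂₄ e₃₄ᵥ eᵥ eg 1≢v 2≢v
    (p≢1 ∷ p≢2 ∷ p≢3 ∷ p≢4 ∷ []) (q≢1 ∷ q≢2 ∷ q≢3 ∷ q≢4 ∷ []) g-inj g-avoid =
    free (f₁ ◃ f₂ ◃ f₃ ◃ f₄ ◃ v ◃ p ◃ q ◃ g) inj edges
    where
    g≢ : ∀ i → v ≢ g i × f₁ ≢ g i × f₂ ≢ g i × f₃ ≢ g i × f₄ ≢ g i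
    g≢ i with g-avoid i
    ... | a ∷ b ∷ c ∷ d ∷ e ∷ [] = a ∘ sym , b ∘ sym , c ∘ sym , d ∘ sym , e ∘ sym
    inj : Injective _≡_ _≡_ (f₁ ◃ f₂ ◃ f₃ ◃ f₄ ◃ v ◃ p ◃ q ◃ g)
    inj =
      ◃-injective (◃-avoids (edge⇒≢₁₂ H e₁₂₃) (◃-avoids (edge⇒≢₁₃ H e₁₂₃) (◃-avoids (edge⇒≢₁₃ H e₁₂₄)
        (◃-avoids 1≢v (◃-avoids (p≢1 ∘ sym) (◃-avoids (q≢1 ∘ sym) λ i → proj₁ (proj₂ (g≢ i)))))))) (
      ◃-injective (◃-avoids (edge⇒≢₂₃ H e₁₂₃) (◃-avoids (edge⇒≢₂₃ H e₁₂₄) (◃-avoids 2≢v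
        (◃-avoids (p≢2 ∘ sym) (◃-avoids (q≢2 ∘ sym) λ i → proj₁ (proj₂ (proj₂ (g≢ i)))))))) (
      ◃-injective (◃-avoids (edge⇒≢₁₂ H e₃₄ᵥ) (◃-avoids (edge⇒≢₁₃ H e₃₄ᵥ) (◃-avoids (p≢3 ∘ sym)
        (◃-avoids (q≢3 ∘ sym) λ i → proj₁ (proj₂ (proj₂ (proj₂ (g≢ i)))))))) (
      ◃-injective (◃-avoids (edge⇒≢₂₃ H e₃₄ᵥ) (◃-avoids (p≢4 ∘ sym) (◃-avoids (q≢4 ∘ sym)
        λ i → proj₂ (proj₂ (proj₂ (proj₂ (g≢ i))))))) (
      ◃-injective (◃-avoids (edge⇒≢₁₂ H eᵥ) (◃-avoids (edge⇒≢₁₃ H eᵥ) λ i → proj₁ (g≢ i))) (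
      ◃-injective (◃-avoids (edge⇒≢₂₃ H eᵥ) λ i → edge⇒≢₁₃ H (eg i)) (
      ◃-injective (λ i → edge⇒≢₂₃ H (eg i)) g-inj))))))
    edges : ∀ a b c → FsimEdge t a b c → h _ _ _ ≡ true
    edges _ _ _ e123     = e₁₂₃
    edges _ _ _ e124     = e₁₂₄
    edges _ _ _ e345     = e₃₄ᵥ
    edges _ _ _ e567     = eᵥ
    edges _ _ _ (e67g i) = eg i

  supported⇒no-apex : ∀ {f₁ f₂ f₃ f₄ v} → Supported t h v →
    h f₁ f₂ f₃ ≡ true → h f₁ f₂ f₄ ≡ true → h f₃ f₄ v ≡ true → f₁ ≢ v → f₂ ≢ v → ⊥
  supported⇒no-apex {f₁} {f₂} {f₃} {f₄} sup e₁ e₂ e₃ n₁ n₂ with sup (f₁ ∷ f₂ ∷ f₃ ∷ f₄ ∷ []) ≤-refl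
  ... | p , q , g , eᵥ , eg , inj , p∉ , q∉ , g∉ = forbid e₁ e₂ e₃ eᵥ eg n₁ n₂ p∉ q∉ inj g∉

  -- If N(pq) had t + 1 vertices, then apart from `v`, which is one of its members, there would be t
  -- left for the gᵢ. The apex avoids the 2 + t vertices p, q, gᵢ and completes the copy.
  robust⇒light : ∀ {v p q} → RobustApex t h v → h v p q ≡ true → codeg h p q ≤ t
  robust⇒light {v} {p} {q} rob eᵥ = ≮⇒≥ contra
    where
    contra : ¬ t < codeg h p q
    contra t< with pickMany t (h p q) (v ∷ []) (≤-trans (≤-reflexive (+-comm t 1)) t<)
    ... | g , inj , eg , g∉ with rob (p ∷ q ∷ tabulate g) (≤-reflexive (cong (2 +_) (length-tabulate g)))
    ...   | f₁ , f₂ , f₃ , f₄ , e₁ , e₂ , e₃ , (1≢v ∷ 1≢p ∷ 1≢q ∷ 1∉g) , (2≢v ∷ 2≢p ∷ 2≢q ∷ 2∉g)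
          , (3≢p ∷ 3≢q ∷ 3∉g) , (4≢p ∷ 4≢q ∷ 4∉g) =
      forbid e₁ e₂ e₃ eᵥ eg 1≢v 2≢v
        ((1≢p ∘ sym) ∷ (2≢p ∘ sym) ∷ (3≢p ∘ sym) ∷ (4≢p ∘ sym) ∷ [])
        ((1≢q ∘ sym) ∷ (2≢q ∘ sym) ∷ (3≢q ∘ sym) ∷ (4≢q ∘ sym) ∷ []) inj
        λ i → All.head (g∉ i) ∷ (All.tabulate⁻ 1∉g i ∘ sym) ∷ (All.tabulate⁻ 2∉g i ∘ sym)
            ∷ (All.tabulate⁻ 3∉g i ∘ sym) ∷ (All.tabulate⁻ 4∉g i ∘ sym) ∷ []

-- Deleting pairs of small codegree

shadow : Graph3 n → ℕ
shadow h = #₂ λ x y → 0 <ᵇ codeg h x y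

-- The field `loss` is a potential argument: a deleted pair lies in fewer than D edges, hence in at
-- most 6 D ordered ones, and its deletion removes at least one ordered pair from the shadow. As the
-- shadow has at most n² pairs, the total loss is at most 6 D n².
record Cleaned (D : ℕ) (h : Graph3 n) : Set where
  field
    graph    : Graph3 n
    is3      : Is3Graph graph
    subgraph : ∀ {x y z} → graph x y z ≡ true → h x y z ≡ true
    clean    : ∀ {x y z} → graph x y z ≡ true → D ≤ codeg graph x y
    loss     : size h + 6 * D * shadow graph ≤ size graph + 6 * D * shadow h

codeg-pos : ∀ {h : Graph3 n} {x y z} → h x y z ≡ true → 0 < codeg h x y
codeg-pos {h = h} {x} {y} {z} e = ≤-trans (≤-reflexive (cong ⟦_⟧ (sym e))) (≤∑ (λ z → ⟦ h x y z ⟧) z)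

module Delete {h : Graph3 n} (H : Is3Graph h) (u v : Fin n) where
  at : Graph3 n
  at x y z = (x == u) ∧ (y == v)

  deleted : Graph3 n
  deleted x y z = h x y z ∧ not (orbitOr at x y z)

  deleted-3graph : Is3Graph deleted
  deleted-3graph .swap₁₂ x y z = cong₂ (λ a b → a ∧ not b) (swap₁₂ H x y z) (orbitOr-swap₁₂ at x y z)
  deleted-3graph .swap₂₃ x y z = cong₂ (λ a b → a ∧ not b) (swap₂₃ H x y z) (orbitOr-swap₂₃ at x y z)
  deleted-3graph .loopless x z rewrite loopless H x z = refl

  deleted-size : size h ≤ size deleted + 6 * codeg h u v
  deleted-size = begin
    size h
      ≤⟨ ∑₃-mono bound ⟩
    ∑₃ (λ x y z → ⟦ deleted x y z ⟧ + orbitSum f x y z)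
      ≡⟨ trans (∑₃-+ _ _) (cong (size deleted +_) (trans (∑₃-orbitSum f) (cong (6 *_) total-at))) ⟩
    size deleted + 6 * codeg h u v ∎
    where
    open ≤-Reasoning
    f : Fin n → Fin n → Fin n → ℕ
    f x y z = ⟦ x == u ⟧ * (⟦ y == v ⟧ * ⟦ h x y z ⟧)
    total-at : ∑₃ f ≡ codeg h u v
    total-at = trans (∑-cong λ x → trans (∑-cong λ y → trans (∑-*ˡ ⟦ x == u ⟧ _) (cong (⟦ x == u ⟧ *_) (∑-*ˡ ⟦ y == v ⟧ _)))
        (trans (∑-*ˡ ⟦ x == u ⟧ _) (cong (⟦ x == u ⟧ *_) (∑-δ (λ y → codeg h x y) v))))
      (∑-δ (λ x → codeg h x v) u)
    six : ∀ b a₁ a₂ a₃ a₄ a₅ a₆ → ⟦ b ⟧ ≤ ⟦ b ∧ not (a₁ ∨ a₂ ∨ a₃ ∨ a₄ ∨ a₅ ∨ a₆) ⟧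
      + (⟦ a₁ ∧ b ⟧ + ⟦ a₂ ∧ b ⟧ + ⟦ a₃ ∧ b ⟧ + ⟦ a₄ ∧ b ⟧ + ⟦ a₅ ∧ b ⟧ + ⟦ a₆ ∧ b ⟧)
    six false a₁ a₂ a₃ a₄ a₅ a₆ = z≤n
    six true true  a₂    a₃    a₄    a₅    a₆    = s≤s z≤n
    six true false true  a₃    a₄    a₅    a₆    = s≤s z≤n
    six true false false true  a₄    a₅    a₆    = s≤s z≤n
    six true false false false true  a₅    a₆    = s≤s z≤n
    six true false false false false true  a₆    = s≤s z≤n
    six true false false false false false true  = s≤s z≤n
    six true false false false false false false = s≤s z≤n
    term : ∀ x y z → ∀ {b} → h x y z ≡ b → ⟦ at x y z ∧ b ⟧ ≡ f x y z
    term x y z refl = trans (⟦⟧-∧ (at x y z) (h x y z)) (trans (cong (_* ⟦ h x y z ⟧) (⟦⟧-∧ (x == u) (y == v))) (*-assoc ⟦ x == u ⟧ _ _))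
    bound : ∀ x y z → ⟦ h x y z ⟧ ≤ ⟦ deleted x y z ⟧ + orbitSum f x y z
    bound x y z = ≤-trans (six (h x y z) (at x y z) (at x z y) (at y x z) (at y z x) (at z x y) (at z y x))
      (≤-reflexive (cong (⟦ deleted x y z ⟧ +_) (cong₂ _+_ (cong₂ _+_ (cong₂ _+_ (cong₂ _+_ (cong₂ _+_
        (term x y z refl) (term x z y (sym (swap₂₃ H x y z)))) (term y x z (sym (swap₁₂ H x y z))))
        (term y z x (sym (rotate H x y z)))) (term z x y (rotate H z x y))) (term z y x (sym (swap₁₃ H x y z))))))

  deleted-uv : codeg deleted u v ≡ 0
  deleted-uv = ∑-zero _ λ z → cong ⟦_⟧ (gone z)
    where
    gone : ∀ z → deleted u v z ≡ false
    gone z rewrite ==-refl u | ==-refl v = ∧-zeroʳ (h u v z)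

  deleted-shadow : 0 < codeg h u v → shadow deleted < shadow h
  deleted-shadow pos = ≰⇒> λ ge → <-irrefl refl (begin-strict
    0                              <⟨ s≤s z≤n ⟩
    1                              ≡⟨ cong ⟦_⟧ (Equivalence.to T-≡ (<⇒<ᵇ pos)) ⟨
    ⟦ 0 <ᵇ codeg h u v ⟧           ≡⟨ ∑-tight (mono u) (≤-reflexive (sym (rows ge u))) v ⟨
    ⟦ 0 <ᵇ codeg deleted u v ⟧     ≡⟨ cong (λ c → ⟦ 0 <ᵇ c ⟧) deleted-uv ⟩
    0                              ∎)
    where
    open ≤-Reasoning
    mono : ∀ x y → ⟦ 0 <ᵇ codeg deleted x y ⟧ ≤ ⟦ 0 <ᵇ codeg h x y ⟧
    mono x y = ⟦⟧-mono λ e → Equivalence.to T-≡ (<⇒<ᵇ (≤-trans (<ᵇ⇒< 0 _ (Equivalence.from T-≡ e)) (#-mono λ z → ∧-trueˡ)))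
    rows : shadow h ≤ shadow deleted → ∀ x → _
    rows ge = ∑-tight (λ x → ∑-mono (mono x)) ge

-- The recursion is on the bound `m` for the shadow, which every deletion decreases.
clean-up : ∀ D m (h : Graph3 n) → Is3Graph h → shadow h ≤ m → Cleaned D h
clean-up D m h H S≤m with Fin.any? (λ u → Fin.any? λ v → (0 <? codeg h u v) ×-dec (codeg h u v <? D))
... | no none = record
  { graph = h ; is3 = H ; subgraph = id ; loss = ≤-refl
  ; clean = λ {x} {y} e → ≮⇒≥ λ lt → none (x , y , codeg-pos {h = h} e , lt) }
... | yes (u , v , pos , lt) with m
...   | zero   = contradiction (≤-trans (Delete.deleted-shadow H u v pos) S≤m) λ ()
...   | suc m′ = record
  { graph = graph ; is3 = is3 ; clean = clean
  ; subgraph = λ e → ∧-trueˡ (subgraph e)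
  ; loss = accumulate D (size h) (size deleted) (size graph) (shadow graph) (shadow deleted) (shadow h)
      (≤-trans deleted-size (+-monoʳ-≤ (size deleted) (*-monoʳ-≤ 6 (<⇒≤ lt)))) loss (deleted-shadow pos) }
  where
  open Delete H u v
  open Cleaned (clean-up D m′ deleted deleted-3graph (≤-pred (≤-trans (deleted-shadow pos) S≤m)))
  accumulate : ∀ D T T′ T″ s s′ S → T ≤ T′ + 6 * D → T′ + 6 * D * s ≤ T″ + 6 * D * s′ → suc s′ ≤ S →
               T + 6 * D * s ≤ T″ + 6 * D * S
  accumulate D T T′ T″ s s′ S p q r = begin
    T + 6 * D * s                  ≤⟨ +-monoˡ-≤ (6 * D * s) p ⟩
    T′ + 6 * D + 6 * D * s         ≡⟨ ring₁ T′ (6 * D) (6 * D * s) ⟩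
    T′ + 6 * D * s + 6 * D         ≤⟨ +-monoˡ-≤ (6 * D) q ⟩
    T″ + 6 * D * s′ + 6 * D        ≡⟨ ring₂ T″ (6 * D) s′ ⟩
    T″ + 6 * D * suc s′            ≤⟨ +-monoʳ-≤ T″ (*-monoʳ-≤ (6 * D) r) ⟩
    T″ + 6 * D * S                 ∎
    where
    open ≤-Reasoning
    ring₁ : ∀ a b c → a + b + c ≡ a + c + b
    ring₁ = solve-∀
    ring₂ : ∀ a b s → a + b * s + b ≡ a + b * (1 + s)
    ring₂ = solve-∀

-- Cancellative 3-graphs

∑₂-witness : (f g : Fin n → Fin n → ℕ) → ∑₂ f < ∑₂ g → ∃₂ λ x y → f x y < g x y
∑₂-witness f g lt with ∑-witness _ _ lt
... | x , lt₁ with ∑-witness _ _ lt₁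
...   | y , lt₂ = x , y , lt₂

∑₃-witness : (f g : Fin n → Fin n → Fin n → ℕ) → ∑₃ f < ∑₃ g →
             ∃₂ λ x y → ∃ λ z → f x y z < g x y z
∑₃-witness f g lt with ∑-witness _ _ lt
... | x , lt₁ with ∑₂-witness (f x) (g x) lt₁
...   | y , z , lt₂ = x , y , z , lt₂

2ab≤a²+b² : ∀ a b → 2 * (a * b) ≤ a * a + b * b
2ab≤a²+b² a b with ≤-total a b
... | inj₁ le with m≤n⇒∃[o]m+o≡n le
...   | d , refl = ≤-trans (m≤m+n _ (d * d)) (≤-reflexive (ring a d))
  where
  ring : ∀ a d → 2 * (a * (a + d)) + d * d ≡ a * a + (a + d) * (a + d)
  ring = solve-∀
2ab≤a²+b² a b | inj₂ le with m≤n⇒∃[o]m+o≡n le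
...   | d , refl = ≤-trans (m≤m+n _ (d * d)) (≤-reflexive (ring b d))
  where
  ring : ∀ b d → 2 * ((b + d) * b) + d * d ≡ (b + d) * (b + d) + b * b
  ring = solve-∀

power-mean : ∀ a b c → (a + b + c) * (a + b + c) ≤ 3 * (a * a + b * b + c * c)
power-mean a b c = lin 0 (+-mono-≤ (+-mono-≤ (2ab≤a²+b² a b) (2ab≤a²+b² b c)) (2ab≤a²+b² a c)) (ring a b c)
  where
  ring : ∀ a b c → (a + b + c) * (a + b + c) + (a * a + b * b + (b * b + c * c) + (a * a + c * c)) + 0
       ≡ 3 * (a * a + b * b + c * c) + (2 * (a * b) + 2 * (b * c) + 2 * (a * c))
  ring = solve-∀

-- Cauchy–Schwarz on the support of f, obtained from 2ab ≤ a² + b² with a = S f and b = ∑ f.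
cauchy-schwarz : (f : Fin n → Fin n → ℕ) →
  ∑₂ f * ∑₂ f ≤ #₂ (λ x y → 0 <ᵇ f x y) * ∑₂ (λ x y → f x y * f x y)
cauchy-schwarz f = cancel S refl
  where
  open ≤-Reasoning
  S = #₂ (λ x y → 0 <ᵇ f x y)
  T = ∑₂ f
  Q = ∑₂ (λ x y → f x y * f x y)
  pointwise : ∀ v → 2 * S * T * v ≤ S * S * (v * v) + T * T * ⟦ 0 <ᵇ v ⟧
  pointwise zero      = ≤-trans (≤-reflexive (*-zeroʳ (2 * S * T))) z≤n
  pointwise v@(suc _) = begin
    2 * S * T * v                     ≡⟨ ring₁ S T v ⟩
    2 * (S * v * T)                   ≤⟨ 2ab≤a²+b² (S * v) T ⟩
    S * v * (S * v) + T * T           ≡⟨ ring₂ S T v ⟩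
    S * S * (v * v) + T * T * 1       ∎
    where
    ring₁ : ∀ S T v → 2 * S * T * v ≡ 2 * (S * v * T)
    ring₁ = solve-∀
    ring₂ : ∀ S T v → S * v * (S * v) + T * T ≡ S * S * (v * v) + T * T * 1
    ring₂ = solve-∀
  summed : 2 * S * T * T ≤ S * S * Q + T * T * S
  summed = begin
    2 * S * T * T
      ≡⟨ ∑₂-*ˡ (2 * S * T) f ⟨
    ∑₂ (λ x y → 2 * S * T * f x y)
      ≤⟨ ∑₂-mono (λ x y → pointwise (f x y)) ⟩
    ∑₂ (λ x y → S * S * (f x y * f x y) + T * T * ⟦ 0 <ᵇ f x y ⟧)
      ≡⟨ trans (∑₂-+ _ _) (cong₂ _+_ (∑₂-*ˡ (S * S) _) (∑₂-*ˡ (T * T) _)) ⟩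
    S * S * Q + T * T * S ∎
  T≡0 : S ≡ 0 → T ≡ 0
  T≡0 S≡0 = n≤0⇒n≡0 (≮⇒≥ λ pos → contra (∑₂-witness (λ _ _ → 0) f
    (<-≤-trans (s≤s (≤-reflexive (trans (∑-zero _ λ _ → ∑-zero _ λ _ → refl) refl))) pos)))
    where
    contra : ¬ ∃₂ λ x y → 0 < f x y
    contra (x , y , lt) = <-irrefl (sym S≡0) (≤-trans (≤-reflexive (cong ⟦_⟧ (sym (Equivalence.to T-≡ (<⇒<ᵇ lt)))))
      (≤-trans (≤∑ (λ y → ⟦ 0 <ᵇ f x y ⟧) y) (≤∑ (λ x → ∑ λ y → ⟦ 0 <ᵇ f x y ⟧) x)))
  cancel : ∀ s → S ≡ s → T * T ≤ S * Q
  cancel zero    e = ≤-trans (≤-reflexive (cong (_* T) (T≡0 e))) z≤n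
  cancel (suc s) e = *-cancelˡ-≤ S {{subst NonZero (sym e) _}} (lin 0 summed (ring S T Q))
    where
    ring : ∀ S T Q → S * (T * T) + (S * S * Q + T * T * S) + 0 ≡ S * (S * Q) + 2 * S * T * T
    ring = solve-∀

module Cancellative {t : ℕ} {h k : Graph3 n} (H : Is3Graph h) (free : Free t h) (k-is3 : Is3Graph k)
  (k⊆h : ∀ {x y z} → k x y z ≡ true → h x y z ≡ true)
  (clean : ∀ {x y z} → k x y z ≡ true → t + 6 ≤ codeg k x y) where

  -- Greedy choice along `k`: first p in N(vx), then q in N(vp), then the gᵢ in N(pq). Each of these
  -- pairs lies in an edge of `k`, so it has codegree at least t + 6, enough for t vertices off `v`
  -- and the list of length at most 4.
  supported : ∀ {x y v} → k x y v ≡ true → Supported t h v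
  supported {x} {y} {v} e L L≤4
    with pick (k v x) L (≤-trans (s≤s L≤4) (≤-trans (n≤1+n 5) (≤-trans (m≤n+m 6 t) (clean (trans (rotate k-is3 v x y) e)))))
  ... | p , e₁ , p∉L
    with pick (k v p) L (≤-trans (s≤s L≤4) (≤-trans (n≤1+n 5) (≤-trans (m≤n+m 6 t) (clean (trans (swap₂₃ k-is3 v p x) e₁)))))
  ... | q , e₂ , q∉L
    with pickMany t (k p q) (v ∷ L) (≤-trans (+-monoʳ-≤ t (≤-trans (s≤s L≤4) (n≤1+n 5))) (clean (trans (sym (rotate k-is3 v p q)) e₂)))
  ... | g , inj , e₃ , g∉ = p , q , g , k⊆h e₂ , (λ i → k⊆h (e₃ i)) , inj , p∉L , q∉L , g∉

  -- Here u, v, p, q play f₁, f₂, f₃, f₄. The vertex r may coincide with u or v, so f₅ is another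
  -- vertex w of N(pq), which is supported because it lies in an edge of `k`.
  no-shadow : ∀ {u v p q r} → k u v p ≡ true → k u v q ≡ true → k p q r ≡ true → ⊥
  no-shadow {u} {v} {p} {q} {r} e₁ e₂ e₃
    with pick (k p q) (u ∷ v ∷ []) (≤-trans (s≤s (s≤s (s≤s z≤n))) (≤-trans (m≤n+m 6 t) (clean e₃)))
  ... | w , e₄ , (w≢u ∷ w≢v ∷ []) =
    supported⇒no-apex H free (supported e₄) (k⊆h e₁) (k⊆h e₂) (k⊆h e₄) (w≢u ∘ sym) (w≢v ∘ sym)

  -- Otherwise y and z would both lie in N(xw) while sharing the edge xyz.
  codegs-disjoint : ∀ {x y z w} → k x y z ≡ true → k x y w ≡ true → k x z w ≡ true → ⊥
  codegs-disjoint {x} {y} {z} {w} e e₁ e₂ =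
    no-shadow (trans (swap₂₃ k-is3 x w y) e₁) (trans (swap₂₃ k-is3 x w z) e₂)
              (trans (rotate k-is3 y z x) (trans (rotate k-is3 z x y) e))

  T S : ℕ
  T = size k
  S = shadow k

  span : Fin n → Fin n → Fin n → ℕ
  span x y z = codeg k x y + codeg k y z + codeg k x z

  private
    Q : ℕ
    Q = ∑₂ λ x y → codeg k x y * codeg k x y

    weighted : ∑₃ (λ x y z → ⟦ k x y z ⟧ * span x y z) ≡ 3 * Q
    weighted = trans (∑₃-cong λ x y z → trans (*-distribˡ-+ ⟦ k x y z ⟧ _ _) (cong (_+ ⟦ k x y z ⟧ * codeg k x z) (*-distribˡ-+ ⟦ k x y z ⟧ _ _)))
      (trans (∑₃-+ _ _) (trans (cong₂ _+_ (trans (∑₃-+ _ _) (cong₂ _+_ base yz)) xz) (three Q)))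
      where
      base : ∑₃ (λ x y z → ⟦ k x y z ⟧ * codeg k x y) ≡ Q
      base = ∑₂-cong λ x y → ∑-*ʳ (codeg k x y) _
      xz : ∑₃ (λ x y z → ⟦ k x y z ⟧ * codeg k x z) ≡ Q
      xz = trans (∑₃-cong λ x y z → cong (λ b → ⟦ b ⟧ * codeg k x z) (swap₂₃ k-is3 x y z))
        (trans (∑₃-swap₂₃ (λ x y z → ⟦ k x y z ⟧ * codeg k x y)) base)
      yz : ∑₃ (λ x y z → ⟦ k x y z ⟧ * codeg k y z) ≡ Q
      yz = trans (∑₃-cong λ x y z → cong (λ b → ⟦ b ⟧ * codeg k y z) (swap₁₂ k-is3 x y z))
        (trans (∑₃-swap₁₂ (λ x y z → ⟦ k x y z ⟧ * codeg k x z)) xz)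
      three : ∀ q → q + q + q ≡ 3 * q
      three = solve-∀

  private
    share : Fin n → Fin n → Fin n → ℕ
    share x y z = ⟦ k x y z ⟧ * span x y z

    -- The summand ⟦ k x y z ⟧ makes the comparison strict, as a witness requires. At a witness the
    -- indicator must be 1, and there the strict inequality with 1 added is just
    -- `3 * T ≤ S * span x y z`.
    excess : 0 < T → ∑₃ (λ x y z → 3 * T * ⟦ k x y z ⟧) < ∑₃ (λ x y z → S * share x y z + ⟦ k x y z ⟧)
    excess T>0 = begin-strict
      ∑₃ (λ x y z → 3 * T * ⟦ k x y z ⟧)        ≡⟨ ∑₃-*ˡ (3 * T) (λ x y z → ⟦ k x y z ⟧) ⟩
      3 * T * T                                  ≡⟨ *-assoc 3 T T ⟩
      3 * (T * T)                                ≤⟨ *-monoʳ-≤ 3 (cauchy-schwarz (codeg k)) ⟩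
      3 * (S * Q)                                ≡⟨ ring S Q ⟩
      S * (3 * Q)                                <⟨ m<m+n (S * (3 * Q)) T>0 ⟩
      S * (3 * Q) + T                            ≡⟨ cong (λ q → S * q + T) weighted ⟨
      S * ∑₃ share + T                           ≡⟨ cong (_+ T) (∑₃-*ˡ S share) ⟨
      ∑₃ (λ x y z → S * share x y z) + T         ≡⟨ ∑₃-+ (λ x y z → S * share x y z) (λ x y z → ⟦ k x y z ⟧) ⟨
      ∑₃ (λ x y z → S * share x y z + ⟦ k x y z ⟧) ∎
      where
      open ≤-Reasoning
      ring : ∀ S Q → 3 * (S * Q) ≡ S * (3 * Q)
      ring = solve-∀

    positive-share : ∀ b {a s c} → a * ⟦ b ⟧ < s * (⟦ b ⟧ * c) + ⟦ b ⟧ → b ≡ true × a ≤ s * c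
    positive-share true  {a} {s} {c} lt = refl , ≤-trans (≤-reflexive (sym (*-identityʳ a)))
      (≤-pred (≤-trans lt (≤-reflexive (ring s c))))
      where
      ring : ∀ s c → s * (1 * c) + 1 ≡ 1 + s * c
      ring = solve-∀
    positive-share false {a} {s} {c} lt = contradiction (≤-trans lt (≤-reflexive (ring s c))) λ ()
      where
      ring : ∀ s c → s * (0 * c) + 0 ≡ 0
      ring = solve-∀

  -- Averaging over edges: the spans of all ordered edges sum to 3 Q, where Q is the sum of the
  -- squared codegrees, and Cauchy-Schwarz gives T² ≤ S Q.
  rich-edge : 0 < T → ∃₂ λ x y → ∃ λ z → k x y z ≡ true × 3 * T ≤ S * span x y z
  rich-edge T>0 =
    let x , y , z , lt = ∑₃-witness (λ x y z → 3 * T * ⟦ k x y z ⟧) (λ x y z → S * share x y z + ⟦ k x y z ⟧) (excess T>0)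
    in  x , y , z , positive-share (k x y z) {3 * T} {S} lt

  module _ {x y z : Fin n} (e : k x y z ≡ true) where
    private
      ¬both₁ : ∀ {w} → k x y w ≡ true → k y z w ≡ true → ⊥
      ¬both₁ {w} a b = codegs-disjoint (trans (swap₁₂ k-is3 y x z) e) (trans (swap₁₂ k-is3 y x w) a) b
      ¬both₂ : ∀ {w} → k x y w ≡ true → k x z w ≡ true → ⊥
      ¬both₂ = codegs-disjoint e
      ¬both₃ : ∀ {w} → k y z w ≡ true → k x z w ≡ true → ⊥
      ¬both₃ {w} a b = codegs-disjoint (trans (rotate k-is3 z x y) e)
        (trans (swap₁₂ k-is3 z x w) b) (trans (swap₁₂ k-is3 z y w) a)

    colour-of : Bool → Bool → Bool → K
    colour-of true  _     _     = 𝟙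
    colour-of false true  _     = 𝟚
    colour-of false false true  = 𝟛
    colour-of false false false = 𝟘

    -- The classes are N(xy), N(yz) and N(xz), with 𝟘 for the vertices in none of them. This is the
    -- approximate partition.
    link-colour : Fin n → K
    link-colour w = colour-of (k x y w) (k y z w) (k x z w)

    mono-colour : ∀ {p q r} → link-colour p ≢ 𝟘 → link-colour p ≡ link-colour q → k p q r ≡ true → ⊥
    mono-colour {p} {q} ne eq e′
      with k x y p in a₁ | k y z p in a₂ | k x z p in a₃ | k x y q in b₁ | k y z q in b₂ | k x z q in b₃
    ... | true  | _     | _     | true  | _     | _     = no-shadow a₁ b₁ e′
    ... | false | true  | _     | false | true  | _     = no-shadow a₂ b₂ e′
    ... | false | false | true  | false | false | true  = no-shadow a₃ b₃ e′
    ... | false | false | false | _     | _     | _     = ne refl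
    ... | true  | _     | _     | false | true  | _     = case eq of λ ()
    ... | true  | _     | _     | false | false | true  = case eq of λ ()
    ... | true  | _     | _     | false | false | false = case eq of λ ()
    ... | false | true  | _     | true  | _     | _     = case eq of λ ()
    ... | false | true  | _     | false | false | true  = case eq of λ ()
    ... | false | true  | _     | false | false | false = case eq of λ ()
    ... | false | false | true  | true  | _     | _     = case eq of λ ()
    ... | false | false | true  | false | true  | _     = case eq of λ ()
    ... | false | false | true  | false | false | false = case eq of λ ()

    span≤total : span x y z ≤ total (class link-colour)
    span≤total = +-mono-≤ (+-mono-≤ (#-mono c₁) (#-mono c₂)) (#-mono c₃)
      where
      c₁ : ∀ w → k x y w ≡ true → (link-colour w =ᴷ 𝟙) ≡ true
      c₁ w a rewrite a = refl
      c₂ : ∀ w → k y z w ≡ true → (link-colour w =ᴷ 𝟚) ≡ true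
      c₂ w b with k x y w in a
      ... | true  = ⊥-elim (¬both₁ a b)
      ... | false rewrite b = refl
      c₃ : ∀ w → k x z w ≡ true → (link-colour w =ᴷ 𝟛) ≡ true
      c₃ w c with k x y w in a | k y z w in b
      ... | true  | _     = ⊥-elim (¬both₂ a c)
      ... | false | true  = ⊥-elim (¬both₃ b c)
      ... | false | false rewrite c = refl

square-sum : (K → ℕ) → ℕ
square-sum N = N 𝟙 * N 𝟙 + N 𝟚 * N 𝟚 + N 𝟛 * N 𝟛

-- The ordered pairs inside a class, diagonal included, all miss the shadow, and there are
-- `square-sum` of them.
shadow-bound : (k : Graph3 n) (κ : Fin n → K) →
  (∀ {p q r} → κ p ≢ 𝟘 → κ p ≡ κ q → k p q r ≡ true → ⊥) →
  shadow k + square-sum (class κ) ≤ n * n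
shadow-bound {n} k κ mono = begin
  shadow k + square-sum (class κ)
    ≡⟨ cong (shadow k +_) (sym (trans (∑₂-+ _ _) (cong₂ _+_ (trans (∑₂-+ _ _) (cong₂ _+_ (sq 𝟙) (sq 𝟚))) (sq 𝟛)))) ⟩
  shadow k + ∑₂ (λ p q → same p q)
    ≡⟨ ∑₂-+ _ _ ⟨
  ∑₂ (λ p q → ⟦ 0 <ᵇ codeg k p q ⟧ + same p q)
    ≤⟨ ∑₂-mono (λ p q → pointwise p q (κ p) refl (κ q) refl) ⟩
  ∑₂ {n} (λ p q → 1)
    ≡⟨ trans (∑-cong λ _ → ∑-const n 1) (trans (∑-const n (n * 1)) (cong (n *_) (*-identityʳ n))) ⟩
  n * n ∎
  where
  open ≤-Reasoning
  mark : K → K → K → ℕ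
  mark i a b = ⟦ a =ᴷ i ⟧ * ⟦ b =ᴷ i ⟧
  same : Fin n → Fin n → ℕ
  same p q = mark 𝟙 (κ p) (κ q) + mark 𝟚 (κ p) (κ q) + mark 𝟛 (κ p) (κ q)
  sq : ∀ i → ∑₂ (λ p q → mark i (κ p) (κ q)) ≡ class κ i * class κ i
  sq i = ∑∑-product (λ p → ⟦ κ p =ᴷ i ⟧) (λ q → ⟦ κ q =ᴷ i ⟧)
  none : ∀ p q → κ p ≢ 𝟘 → κ p ≡ κ q → ⟦ 0 <ᵇ codeg k p q ⟧ ≡ 0
  none p q ne eq = cong (λ c → ⟦ 0 <ᵇ c ⟧) (∑-zero _ λ r → cong ⟦_⟧ (¬-not λ e → mono ne eq e))
  unshadowed : ∀ p q a → κ p ≡ a → κ q ≡ a → a ≢ 𝟘 → ⟦ 0 <ᵇ codeg k p q ⟧ ≡ 0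
  unshadowed p q a refl e ne = none p q ne (sym e)
  pointwise : ∀ p q a → κ p ≡ a → ∀ b → κ q ≡ b →
    ⟦ 0 <ᵇ codeg k p q ⟧ + (mark 𝟙 a b + mark 𝟚 a b + mark 𝟛 a b) ≤ 1
  pointwise p q 𝟙 ea 𝟙 eb rewrite unshadowed p q 𝟙 ea eb (λ ()) = ≤-refl
  pointwise p q 𝟚 ea 𝟚 eb rewrite unshadowed p q 𝟚 ea eb (λ ()) = ≤-refl
  pointwise p q 𝟛 ea 𝟛 eb rewrite unshadowed p q 𝟛 ea eb (λ ()) = ≤-refl
  pointwise p q 𝟘 _ 𝟘 _ = ≤-trans (≤-reflexive (+-identityʳ _)) (⟦⟧-≤1 (0 <ᵇ codeg k p q))
  pointwise p q 𝟘 _ 𝟙 _ = ≤-trans (≤-reflexive (+-identityʳ _)) (⟦⟧-≤1 (0 <ᵇ codeg k p q))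
  pointwise p q 𝟘 _ 𝟚 _ = ≤-trans (≤-reflexive (+-identityʳ _)) (⟦⟧-≤1 (0 <ᵇ codeg k p q))
  pointwise p q 𝟘 _ 𝟛 _ = ≤-trans (≤-reflexive (+-identityʳ _)) (⟦⟧-≤1 (0 <ᵇ codeg k p q))
  pointwise p q 𝟙 _ 𝟘 _ = ≤-trans (≤-reflexive (+-identityʳ _)) (⟦⟧-≤1 (0 <ᵇ codeg k p q))
  pointwise p q 𝟙 _ 𝟚 _ = ≤-trans (≤-reflexive (+-identityʳ _)) (⟦⟧-≤1 (0 <ᵇ codeg k p q))
  pointwise p q 𝟙 _ 𝟛 _ = ≤-trans (≤-reflexive (+-identityʳ _)) (⟦⟧-≤1 (0 <ᵇ codeg k p q))
  pointwise p q 𝟚 _ 𝟘 _ = ≤-trans (≤-reflexive (+-identityʳ _)) (⟦⟧-≤1 (0 <ᵇ codeg k p q))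
  pointwise p q 𝟚 _ 𝟙 _ = ≤-trans (≤-reflexive (+-identityʳ _)) (⟦⟧-≤1 (0 <ᵇ codeg k p q))
  pointwise p q 𝟚 _ 𝟛 _ = ≤-trans (≤-reflexive (+-identityʳ _)) (⟦⟧-≤1 (0 <ᵇ codeg k p q))
  pointwise p q 𝟛 _ 𝟘 _ = ≤-trans (≤-reflexive (+-identityʳ _)) (⟦⟧-≤1 (0 <ᵇ codeg k p q))
  pointwise p q 𝟛 _ 𝟙 _ = ≤-trans (≤-reflexive (+-identityʳ _)) (⟦⟧-≤1 (0 <ᵇ codeg k p q))
  pointwise p q 𝟛 _ 𝟚 _ = ≤-trans (≤-reflexive (+-identityʳ _)) (⟦⟧-≤1 (0 <ᵇ codeg k p q))

size-vs-classes : ∀ T S σ q n → 3 * T ≤ S * σ → S + q ≤ n * n → σ * σ ≤ 3 * q →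
                  9 * T + σ * σ * σ ≤ 3 * (n * n) * σ
size-vs-classes T S σ q n 3T≤ S+q≤ σ²≤ =
  lin 0 (+-mono-≤ (+-mono-≤ (*-monoʳ-≤ 3 3T≤) (*-monoʳ-≤ (3 * σ) S+q≤)) (*-monoʳ-≤ σ σ²≤)) (ring T S σ q n)
  where
  ring : ∀ T S σ q n → 9 * T + σ * σ * σ + (3 * (S * σ) + 3 * σ * (n * n) + σ * (3 * q)) + 0
       ≡ 3 * (n * n) * σ + (3 * (3 * T) + 3 * σ * (S + q) + σ * (σ * σ))
  ring = solve-∀

-- With σ = n - δ the upper bound 3 n² σ - σ³ equals 2 n³ - δ² (3 n - δ), and 3 n - δ ≥ 2 n. A
-- deficit of C n² edges therefore allows only δ = O(√n).
leftover-bound : ∀ T σ δ C n → δ + σ ≡ n → 1 ≤ n → 9 * T + σ * σ * σ ≤ 3 * (n * n) * σ →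
                 2 * (n * n * n) ≤ 9 * T + C * (n * n) → 2 * (δ * δ) ≤ C * n
leftover-bound T σ δ C n refl 1≤n upper lower = *-cancelʳ-≤ _ _ n {{>-nonZero 1≤n}}
  (lin (σ * (δ * δ)) (+-mono-≤ upper lower) (ring T σ δ C))
  where
  ring : ∀ T σ δ C → 2 * (δ * δ) * (δ + σ) + (3 * ((δ + σ) * (δ + σ)) * σ + (9 * T + C * ((δ + σ) * (δ + σ)))) + σ * (δ * δ)
       ≡ C * (δ + σ) * (δ + σ) + (9 * T + σ * σ * σ + 2 * ((δ + σ) * (δ + σ) * (δ + σ)))
  ring = solve-∀

-- The pairs of coloured vertices whose colours sum to i: pairs across the two parts other than i
-- if i ≢ 𝟘, and pairs inside a part if i ≡ 𝟘.
cross : (Fin n → K) → K → Fin n → Fin n → Bool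
cross κ i y z = (nz (κ y) ∧ nz (κ z)) ∧ (κ z =ᴷ i ⊕ κ y)

pairs : (Fin n → K) → K → ℕ
pairs κ i = #₂ (cross κ i)

degIn : (Fin n → K) → Graph3 n → K → Fin n → ℕ
degIn κ h i v = #₂ λ y z → cross κ i y z ∧ h v y z

-- Nonzero colours that sum to 𝟘 are distinct, so this counts the ordered edges with one vertex in
-- each part.
rainbow : (Fin n → K) → Graph3 n → ℕ
rainbow κ h = ∑ λ v → ⟦ nz (κ v) ⟧ * degIn κ h (κ v) v

size≤rainbow : (k : Graph3 n) → Is3Graph k → (κ : Fin n → K) →
  (∀ {p q r} → κ p ≢ 𝟘 → κ p ≡ κ q → k p q r ≡ true → ⊥) →
  size k ≤ rainbow κ k + 3 * (class κ 𝟘 * (n * n))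
size≤rainbow {n} k k-is3 κ mono = begin
  size k
    ≤⟨ ∑₃-mono pointwise ⟩
  ∑₃ (λ x y z → r x y z + (⟦ κ x =ᴷ 𝟘 ⟧ + ⟦ κ y =ᴷ 𝟘 ⟧ + ⟦ κ z =ᴷ 𝟘 ⟧))
    ≡⟨ trans (∑₃-+ _ _) (cong₂ _+_ (∑-cong λ x → ∑₂-*ˡ ⟦ nz (κ x) ⟧ _)
         (trans (∑₃-+ _ _) (cong₂ _+_ (trans (∑₃-+ _ _) (cong₂ _+_ in-x in-y)) in-z))) ⟩
  rainbow κ k + (δ * (n * n) + δ * (n * n) + δ * (n * n))
    ≡⟨ cong (rainbow κ k +_) (three (δ * (n * n))) ⟩
  rainbow κ k + 3 * (δ * (n * n)) ∎
  where
  open ≤-Reasoning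
  δ = class κ 𝟘
  r : Fin n → Fin n → Fin n → ℕ
  r x y z = ⟦ nz (κ x) ⟧ * ⟦ cross κ (κ x) y z ∧ k x y z ⟧
  three : ∀ a → a + a + a ≡ 3 * a
  three = solve-∀
  in-x : ∑₃ (λ (x y z : Fin n) → ⟦ κ x =ᴷ 𝟘 ⟧) ≡ δ * (n * n)
  in-x = trans (∑-cong λ x → trans (∑-cong λ _ → ∑-const n _) (trans (∑-const n (n * _)) (swap n ⟦ κ x =ᴷ 𝟘 ⟧)))
    (∑-*ʳ (n * n) _)
    where
    swap : ∀ n a → n * (n * a) ≡ a * (n * n)
    swap = solve-∀
  in-y : ∑₃ (λ (x y z : Fin n) → ⟦ κ y =ᴷ 𝟘 ⟧) ≡ δ * (n * n)
  in-y = trans (∑₃-swap₁₂ (λ x y z → ⟦ κ x =ᴷ 𝟘 ⟧)) in-x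
  in-z : ∑₃ (λ (x y z : Fin n) → ⟦ κ z =ᴷ 𝟘 ⟧) ≡ δ * (n * n)
  in-z = trans (∑₃-swap₂₃ (λ x y z → ⟦ κ y =ᴷ 𝟘 ⟧)) in-y
  differ : ∀ {p q r} → nz (κ p) ≡ true → k p q r ≡ true → κ p ≢ κ q
  differ ne e eq = mono (nz⇒≢𝟘 ne) eq e
  pointwise : ∀ x y z → ⟦ k x y z ⟧ ≤ r x y z + (⟦ κ x =ᴷ 𝟘 ⟧ + ⟦ κ y =ᴷ 𝟘 ⟧ + ⟦ κ z =ᴷ 𝟘 ⟧)
  pointwise x y z with k x y z in e
  ... | false = z≤n
  ... | true with nz (κ x) in a | nz (κ y) in b | nz (κ z) in c
  ...   | false | _     | _     = zero-x (κ x) a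
    where
    zero-x : ∀ i → nz i ≡ false → 1 ≤ 0 + (⟦ i =ᴷ 𝟘 ⟧ + ⟦ κ y =ᴷ 𝟘 ⟧ + ⟦ κ z =ᴷ 𝟘 ⟧)
    zero-x 𝟘 _ = s≤s z≤n
  ...   | true  | false | _     = ≤-trans (zero-y (κ y) b) (≤-trans (m≤n+m _ ⟦ κ x =ᴷ 𝟘 ⟧) (m≤m+n _ ⟦ κ z =ᴷ 𝟘 ⟧))
    where
    zero-y : ∀ i → nz i ≡ false → 1 ≤ ⟦ i =ᴷ 𝟘 ⟧
    zero-y 𝟘 _ = s≤s z≤n
  ...   | true  | true  | false = ≤-trans (zero-z (κ z) c) (m≤n+m _ (⟦ κ x =ᴷ 𝟘 ⟧ + ⟦ κ y =ᴷ 𝟘 ⟧))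
    where
    zero-z : ∀ i → nz i ≡ false → 1 ≤ ⟦ i =ᴷ 𝟘 ⟧
    zero-z 𝟘 _ = s≤s z≤n
  ...   | true  | true  | true  = ≤-trans (≤-reflexive (sym (cong (λ b → 1 * ⟦ b ∧ true ⟧) sum-ok))) (m≤m+n _ _)
    where
    sum-ok : (κ z =ᴷ κ x ⊕ κ y) ≡ true
    sum-ok = trans (cong (_=ᴷ κ x ⊕ κ y) (third-colour (κ x) (κ y) (κ z) (nz⇒≢𝟘 a) (nz⇒≢𝟘 b) (nz⇒≢𝟘 c)
      (differ a e) (differ b (trans (sym (rotate k-is3 x y z)) e)) (differ a (trans (sym (swap₂₃ k-is3 x y z)) e))))
      (=ᴷ-refl (κ x ⊕ κ y))

-- The core

-- The difference of the two sides is the sum of (a + b + 7 c)(a - b)² and its two analogues for the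
-- other pairs.
amgm : ∀ a b c → 54 * (a * b * c) ≤ 2 * ((a + b + c) * (a + b + c) * (a + b + c))
amgm a b c = lin 0
  (+-mono-≤ (+-mono-≤ (pair a b (a + b + 7 * c)) (pair b c (b + c + 7 * a))) (pair a c (a + c + 7 * b)))
  (ring a b c)
  where
  pair : ∀ x y m → m * (2 * (x * y)) ≤ m * (x * x + y * y)
  pair x y m = *-monoʳ-≤ m (2ab≤a²+b² x y)
  ring : ∀ a b c → 54 * (a * b * c)
    + ((a + b + 7 * c) * (a * a + b * b) + (b + c + 7 * a) * (b * b + c * c) + (a + c + 7 * b) * (a * a + c * c)) + 0
    ≡ 2 * ((a + b + c) * (a + b + c) * (a + b + c))
    + ((a + b + 7 * c) * (2 * (a * b)) + (b + c + 7 * a) * (2 * (b * c)) + (a + c + 7 * b) * (2 * (a * c)))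
  ring = solve-∀

pairs-value : (κ : Fin n → K) → ∀ {i} → i ≢ 𝟘 →
  class κ i * pairs κ i ≡ 2 * (class κ 𝟙 * class κ 𝟚 * class κ 𝟛)
pairs-value κ = ≢𝟘-cases (λ i → N i * pairs κ i ≡ 2 * (N 𝟙 * N 𝟚 * N 𝟛))
  (trans (cong (N 𝟙 *_) (by-class 𝟙)) (r₁ (N 𝟘) (N 𝟙) (N 𝟚) (N 𝟛)))
  (trans (cong (N 𝟚 *_) (by-class 𝟚)) (r₂ (N 𝟘) (N 𝟙) (N 𝟚) (N 𝟛)))
  (trans (cong (N 𝟛 *_) (by-class 𝟛)) (r₃ (N 𝟘) (N 𝟙) (N 𝟚) (N 𝟛)))
  where
  N = class κ
  row : K → K → ℕ
  row i b = N 𝟘 * ⟦ (nz b ∧ false) ∧ (𝟘 =ᴷ i ⊕ b) ⟧ + (N 𝟙 * ⟦ (nz b ∧ true) ∧ (𝟙 =ᴷ i ⊕ b) ⟧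
          + (N 𝟚 * ⟦ (nz b ∧ true) ∧ (𝟚 =ᴷ i ⊕ b) ⟧ + N 𝟛 * ⟦ (nz b ∧ true) ∧ (𝟛 =ᴷ i ⊕ b) ⟧))
  by-class : ∀ i → pairs κ i ≡ N 𝟘 * row i 𝟘 + (N 𝟙 * row i 𝟙 + (N 𝟚 * row i 𝟚 + N 𝟛 * row i 𝟛))
  by-class i = trans (∑-cong λ y → sum-class κ (λ c → ⟦ (nz (κ y) ∧ nz c) ∧ (c =ᴷ i ⊕ κ y) ⟧))
    (sum-class κ (row i))
  r₁ : ∀ w a b c → a * (w * (w * 0 + (a * 0 + (b * 0 + c * 0))) + (a * (w * 0 + (a * 0 + (b * 0 + c * 0)))
     + (b * (w * 0 + (a * 0 + (b * 0 + c * 1))) + c * (w * 0 + (a * 0 + (b * 1 + c * 0)))))) ≡ 2 * (a * b * c)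
  r₁ = solve-∀
  r₂ : ∀ w a b c → b * (w * (w * 0 + (a * 0 + (b * 0 + c * 0))) + (a * (w * 0 + (a * 0 + (b * 0 + c * 1)))
     + (b * (w * 0 + (a * 0 + (b * 0 + c * 0))) + c * (w * 0 + (a * 1 + (b * 0 + c * 0)))))) ≡ 2 * (a * b * c)
  r₂ = solve-∀
  r₃ : ∀ w a b c → c * (w * (w * 0 + (a * 0 + (b * 0 + c * 0))) + (a * (w * 0 + (a * 0 + (b * 1 + c * 0)))
     + (b * (w * 0 + (a * 1 + (b * 0 + c * 0))) + c * (w * 0 + (a * 0 + (b * 0 + c * 0)))))) ≡ 2 * (a * b * c)
  r₃ = solve-∀

missing : (Fin n → K) → Graph3 n → Fin n → ℕ
missing κ h v = #₂ λ y z → cross κ (κ v) y z ∧ not (h v y z)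

pairs-split : (κ : Fin n → K) (h : Graph3 n) (v : Fin n) →
              pairs κ (κ v) ≡ degIn κ h (κ v) v + missing κ h v
pairs-split κ h v = trans (∑₂-cong λ y z → ⟦⟧-split (cross κ (κ v) y z) (h v y z)) (∑₂-+ _ _)

rainbow+missing : (κ : Fin n → K) (h : Graph3 n) →
  rainbow κ h + ∑ (λ v → ⟦ nz (κ v) ⟧ * missing κ h v) ≡ 6 * (class κ 𝟙 * class κ 𝟚 * class κ 𝟛)
rainbow+missing κ h = begin
  rainbow κ h + ∑ (λ v → ⟦ nz (κ v) ⟧ * missing κ h v)
    ≡⟨ ∑-+ _ _ ⟨
  ∑ (λ v → ⟦ nz (κ v) ⟧ * degIn κ h (κ v) v + ⟦ nz (κ v) ⟧ * missing κ h v)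
    ≡⟨ ∑-cong (λ v → trans (sym (*-distribˡ-+ ⟦ nz (κ v) ⟧ _ _)) (cong (⟦ nz (κ v) ⟧ *_) (sym (pairs-split κ h v)))) ⟩
  ∑ (λ v → ⟦ nz (κ v) ⟧ * pairs κ (κ v))
    ≡⟨ sum-class κ (λ i → ⟦ nz i ⟧ * pairs κ i) ⟩
  N 𝟘 * (0 * pairs κ 𝟘) + (N 𝟙 * (1 * pairs κ 𝟙) + (N 𝟚 * (1 * pairs κ 𝟚) + N 𝟛 * (1 * pairs κ 𝟛)))
    ≡⟨ ring₁ (N 𝟘) (pairs κ 𝟘) (N 𝟙) (pairs κ 𝟙) (N 𝟚) (pairs κ 𝟚) (N 𝟛) (pairs κ 𝟛) ⟩
  N 𝟙 * pairs κ 𝟙 + N 𝟚 * pairs κ 𝟚 + N 𝟛 * pairs κ 𝟛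
    ≡⟨ cong₂ _+_ (cong₂ _+_ (pairs-value κ {𝟙} λ ()) (pairs-value κ {𝟚} λ ())) (pairs-value κ {𝟛} λ ()) ⟩
  2 * m + 2 * m + 2 * m
    ≡⟨ ring₂ m ⟩
  6 * m ∎
  where
  open ≡-Reasoning
  N = class κ
  m = N 𝟙 * N 𝟚 * N 𝟛
  ring₁ : ∀ w p a q b r c s → w * (0 * p) + (a * (1 * q) + (b * (1 * r) + c * (1 * s))) ≡ a * q + b * r + c * s
  ring₁ = solve-∀
  ring₂ : ∀ m → 2 * m + 2 * m + 2 * m ≡ 6 * m
  ring₂ = solve-∀

-- Here colour 𝟘 marks the discarded vertices, not Q.
record Core (u : ℕ) (h : Graph3 n) : Set where
  field
    κ       : Fin n → K
    few     : class κ 𝟘 ≤ u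
    large   : ∀ {i} → i ≢ 𝟘 → n ≤ 8 * class κ i
    typical : ∀ v → κ v ≢ 𝟘 → pairs κ (κ v) ≤ degIn κ h (κ v) v + 8 * u * n

module Discard (h : Graph3 n) (κ : Fin n → K) (q : ℕ) where
  atypical : Fin n → Bool
  atypical v = nz (κ v) ∧ not (missing κ h v ≤ᵇ q)

  κ′ : Fin n → K
  κ′ v = if atypical v then 𝟘 else κ v

  κ′-nz : ∀ v → κ′ v ≢ 𝟘 → κ′ v ≡ κ v × atypical v ≡ false
  κ′-nz v ne with atypical v
  ... | true  = contradiction refl ne
  ... | false = refl , refl

  -- Markov's inequality: an atypical vertex misses at least q + 1 pairs.
  few-atypical : suc q * # atypical ≤ ∑ (λ v → ⟦ nz (κ v) ⟧ * missing κ h v)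
  few-atypical = ≤-trans (≤-reflexive (sym (∑-*ˡ (suc q) _))) (∑-mono pointwise)
    where
    pointwise : ∀ v → suc q * ⟦ atypical v ⟧ ≤ ⟦ nz (κ v) ⟧ * missing κ h v
    pointwise v with nz (κ v) | missing κ h v ≤ᵇ q in e
    ... | false | _     = ≤-trans (≤-reflexive (*-zeroʳ (suc q))) z≤n
    ... | true  | true  = ≤-trans (≤-reflexive (*-zeroʳ (suc q))) z≤n
    ... | true  | false = ≤-trans (≤-reflexive (*-identityʳ (suc q)))
      (≤-trans (≰⇒> λ le → true≢false (Equivalence.to T-≡ (≤⇒≤ᵇ le)) e) (≤-reflexive (sym (*-identityˡ _))))

  class-𝟘 : class κ′ 𝟘 ≤ class κ 𝟘 + # atypical
  class-𝟘 = ≤-trans (∑-mono pointwise) (≤-reflexive (∑-+ _ _))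
    where
    pointwise : ∀ v → ⟦ κ′ v =ᴷ 𝟘 ⟧ ≤ ⟦ κ v =ᴷ 𝟘 ⟧ + ⟦ atypical v ⟧
    pointwise v with atypical v
    ... | true  = m≤n+m 1 _
    ... | false = m≤m+n _ 0

  class-≤ : ∀ i → class κ i ≤ class κ′ i + # atypical
  class-≤ i = ≤-trans (∑-mono pointwise) (≤-reflexive (∑-+ _ _))
    where
    pointwise : ∀ v → ⟦ κ v =ᴷ i ⟧ ≤ ⟦ κ′ v =ᴷ i ⟧ + ⟦ atypical v ⟧
    pointwise v with atypical v
    ... | true  = ≤-trans (⟦⟧-≤1 (κ v =ᴷ i)) (m≤n+m 1 _)
    ... | false = m≤m+n _ 0

  cross-⊆ : ∀ i y z → cross κ′ i y z ≡ true → cross κ i y z ≡ true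
  cross-⊆ i y z e with κ′-nz y (nz⇒≢𝟘 (∧-trueˡ (∧-trueˡ e))) | κ′-nz z (nz⇒≢𝟘 (∧-trueʳ {nz (κ′ y)} (∧-trueˡ e)))
  ... | a , _ | b , _ = subst₂ (λ c d → ((nz c ∧ nz d) ∧ (d =ᴷ i ⊕ c)) ≡ true) a b e

  typical′ : ∀ v → κ′ v ≢ 𝟘 → pairs κ′ (κ′ v) ≤ degIn κ′ h (κ′ v) v + q
  typical′ v ne = ≤-trans (≤-reflexive (pairs-split κ′ h v)) (+-monoʳ-≤ _ (≤-trans shrink small))
    where
    κ≡ = proj₁ (κ′-nz v ne)
    shrink : missing κ′ h v ≤ missing κ h v
    shrink = ∑₂-mono λ y z → ⟦⟧-mono λ e → ∧-true
      (subst (λ i → cross κ i y z ≡ true) κ≡ (cross-⊆ (κ′ v) y z (∧-trueˡ e))) (∧-trueʳ {cross κ′ (κ′ v) y z} e)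
    small : missing κ h v ≤ q
    small = ≤ᵇ⇒≤ _ q (Equivalence.from T-≡ (not-false (subst (λ b → (b ∧ not (missing κ h v ≤ᵇ q)) ≡ false)
      (≢𝟘⇒nz (subst (_≢ 𝟘) κ≡ ne)) (proj₂ (κ′-nz v ne)))))
      where
      not-false : ∀ {b} → not b ≡ false → b ≡ true
      not-false {true} _ = refl

module _ {δ M E u n : ℕ} (2δ²≤ : 2 * (δ * δ) ≤ E * n) (n≤ : n ≤ M * u) (big : 9 * (M * M * M * E) ≤ u)
  (2≤M : 2 ≤ M) (1≤u : 1 ≤ u) where

  -- The leftover is O(√n) and `u` is linear in n. The hypotheses give 2 (3 M δ)² ≤ 9 M³ E u ≤ u²,
  -- which is why the bound on `u` contains the cube of `M`.
  leftover-small : 3 * M * δ ≤ 2 * u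
  leftover-small = ≮⇒≥ λ lt → <-irrefl refl (begin-strict
    8 * (u * u)                      ≡⟨ ring₁ u ⟩
    2 * (2 * u * (2 * u))            <⟨ *-monoʳ-< 2 (*-mono-< lt lt) ⟩
    2 * (3 * M * δ * (3 * M * δ))    ≡⟨ ring₂ M δ ⟩
    9 * (M * M) * (2 * (δ * δ))      ≤⟨ *-monoʳ-≤ (9 * (M * M)) (≤-trans 2δ²≤ (*-monoʳ-≤ E n≤)) ⟩
    9 * (M * M) * (E * (M * u))      ≡⟨ ring₃ M E u ⟩
    9 * (M * M * M * E) * u          ≤⟨ *-monoˡ-≤ u big ⟩
    u * u                            ≤⟨ m≤m+n (u * u) (7 * (u * u)) ⟩
    8 * (u * u)                      ∎)
    where
    open ≤-Reasoning
    ring₁ : ∀ u → 8 * (u * u) ≡ 2 * (2 * u * (2 * u))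
    ring₁ = solve-∀
    ring₂ : ∀ M δ → 2 * (3 * M * δ * (3 * M * δ)) ≡ 9 * (M * M) * (2 * (δ * δ))
    ring₂ = solve-∀
    ring₃ : ∀ M E u → 9 * (M * M) * (E * (M * u)) ≡ 9 * (M * M * M * E) * u
    ring₃ = solve-∀

  2δ≤u : 2 * δ ≤ u
  2δ≤u = *-cancelˡ-≤ 2 (begin
    2 * (2 * δ)        ≤⟨ m≤m+n _ (2 * δ) ⟩
    2 * (2 * δ) + 2 * δ ≡⟨ ring δ ⟩
    3 * 2 * δ          ≤⟨ *-monoˡ-≤ δ (*-monoʳ-≤ 3 2≤M) ⟩
    3 * M * δ          ≤⟨ leftover-small ⟩
    2 * u              ∎)
    where
    open ≤-Reasoning
    ring : ∀ δ → 2 * (2 * δ) + 2 * δ ≡ 3 * 2 * δ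
    ring = solve-∀

  -- The factor E + 27 δ collects, after multiplication by 9, the edge deficit E n² and the 3 δ n²
  -- ordered edges at uncoloured vertices. The constant 36 is 9 times the 4 of `miss≤`.
  error-small : (E + 27 * δ) * n ≤ 36 * (u * u)
  error-small = begin
    (E + 27 * δ) * n                      ≤⟨ *-monoʳ-≤ (E + 27 * δ) n≤ ⟩
    (E + 27 * δ) * (M * u)                ≡⟨ ring₁ E δ M u ⟩
    (M * E * 1 + 9 * (3 * M * δ)) * u     ≤⟨ *-monoˡ-≤ u (+-mono-≤ (*-monoʳ-≤ (M * E) 1≤9MM) (*-monoʳ-≤ 9 leftover-small)) ⟩
    (M * E * (9 * (M * M)) + 9 * (2 * u)) * u ≡⟨ cong (λ x → (x + 9 * (2 * u)) * u) (ring₂ M E) ⟩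
    (9 * (M * M * M * E) + 9 * (2 * u)) * u ≤⟨ *-monoˡ-≤ u (+-monoˡ-≤ (9 * (2 * u)) big) ⟩
    (u + 9 * (2 * u)) * u                 ≤⟨ m≤m+n _ (17 * (u * u)) ⟩
    (u + 9 * (2 * u)) * u + 17 * (u * u)  ≡⟨ ring₃ u ⟩
    36 * (u * u)                          ∎
    where
    open ≤-Reasoning
    1≤9MM : 1 ≤ 9 * (M * M)
    1≤9MM = *-mono-≤ {1} {9} (s≤s z≤n) (*-mono-≤ {1} {M} {1} {M} (≤-trans (s≤s z≤n) 2≤M) (≤-trans (s≤s z≤n) 2≤M))
    ring₁ : ∀ E δ M u → (E + 27 * δ) * (M * u) ≡ (M * E * 1 + 9 * (3 * M * δ)) * u
    ring₁ = solve-∀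
    ring₂ : ∀ M E → M * E * (9 * (M * M)) ≡ 9 * (M * M * M * E)
    ring₂ = solve-∀
    ring₃ : ∀ u → (u + 9 * (2 * u)) * u + 17 * (u * u) ≡ 36 * (u * u)
    ring₃ = solve-∀

-- Since 4 b c ≤ n², a product abc near n³/27 forces a to be at least about 4 n / 27. This exceeds n
-- / 8, which leaves room for discarding vertices in `large-part′`.
large-part : ∀ a b c u n → a + b + c ≤ n → 216 * u ≤ n → 1 ≤ n →
  2 * (n * n * n) ≤ 54 * (a * b * c) + 36 * (u * u) * n → 8 * n ≤ 54 * a + u
large-part a b c u n abc≤ 216u≤n 1≤n lower =
  *-cancelʳ-≤ _ _ n {{>-nonZero 1≤n}} (*-cancelʳ-≤ _ _ n {{>-nonZero 1≤n}}
    (lin (72 * u * u * n) (+-mono-≤ (+-mono-≤ (*-monoʳ-≤ 4 lower) (*-monoʳ-≤ (54 * a) 4bc≤)) (*-monoʳ-≤ (u * n) 216u≤n)) (ring a b c u n)))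
  where
  b+c≤n : b + c ≤ n
  b+c≤n = ≤-trans (≤-trans (m≤n+m (b + c) a) (≤-reflexive (sym (+-assoc a b c)))) abc≤
  4bc≤ : 4 * (b * c) ≤ n * n
  4bc≤ = ≤-trans (lin 0 (2ab≤a²+b² b c) (sq b c)) (*-mono-≤ b+c≤n b+c≤n)
    where
    sq : ∀ b c → 4 * (b * c) + (b * b + c * c) + 0 ≡ (b + c) * (b + c) + 2 * (b * c)
    sq = solve-∀
  ring : ∀ a b c u n → 8 * n * n * n + (4 * (54 * (a * b * c) + 36 * (u * u) * n) + 54 * a * (n * n) + u * n * n) + 72 * u * u * n
       ≡ (54 * a + u) * n * n + (4 * (2 * (n * n * n)) + 54 * a * (4 * (b * c)) + u * n * (216 * u))
  ring = solve-∀

large-part′ : ∀ a a′ A u n → a ≤ a′ + A → 2 * A ≤ u → 216 * u ≤ n → 8 * n ≤ 54 * a + u → n ≤ 8 * a′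
large-part′ a a′ A u n a≤ 2A≤u 216u≤n 8n≤ = *-cancelˡ-≤ 27
  (lin (n + 752 * u) (+-mono-≤ (+-mono-≤ (+-mono-≤ (*-monoʳ-≤ 4 8n≤) (*-monoʳ-≤ 216 a≤)) (*-monoʳ-≤ 108 2A≤u)) (*-monoʳ-≤ 4 216u≤n)) (ring a a′ A u n))
  where
  ring : ∀ a a′ A u n → 27 * n + (4 * (54 * a + u) + 216 * (a′ + A) + 108 * u + 4 * n) + (n + 752 * u)
       ≡ 27 * (8 * a′) + (4 * (8 * n) + 216 * a + 108 * (2 * A) + 4 * (216 * u))
  ring = solve-∀

module _ {t : ℕ} {h : Graph3 n} (H : Is3Graph h) (free : Free t h) (E₀ M u : ℕ)
  (n≤ : n ≤ M * u) (216u≤n : 216 * u ≤ n) (2≤M : 2 ≤ M) (1≤u : 1 ≤ u)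
  (big : 9 * (M * M * M * (E₀ + 54 * (t + 6))) ≤ u)
  (dense : 2 * (n * n * n) ≤ 9 * size h + E₀ * (n * n)) where

  private
    -- Cleaning loses at most 6 (t + 6) n² ordered edges, and the density bound counts edges nine
    -- times.
    E = E₀ + 54 * (t + 6)

    cleaned : Cleaned (t + 6) h
    cleaned = clean-up (t + 6) (shadow h) h H ≤-refl

    open Cleaned cleaned renaming (graph to k)
    open Cancellative H free is3 subgraph clean

    1≤n : 1 ≤ n
    1≤n = ≤-trans 1≤u (≤-trans (m≤m+n u _) 216u≤n)

    shadow≤n² : shadow h ≤ n * n
    shadow≤n² = ≤-trans (∑-bound n λ x → ≤-trans (∑-bound 1 λ y → ⟦⟧-≤1 _) (≤-reflexive (*-identityʳ n))) ≤-refl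

    lower : 2 * (n * n * n) ≤ 9 * size k + E * (n * n)
    lower = lin 0 (+-mono-≤ (+-mono-≤ dense (*-monoʳ-≤ 9 (≤-trans (m≤m+n (size h) _) loss)))
        (*-monoʳ-≤ (54 * (t + 6)) shadow≤n²)) (ring (n * n * n) (n * n) (size h) (size k) (shadow h) (t + 6) E₀)
      where
      ring : ∀ n³ n² T T′ S D E → 2 * n³ + (9 * T + E * n² + 9 * (T′ + 6 * D * S) + 54 * D * n²) + 0
           ≡ 9 * T′ + (E + 54 * D) * n² + (2 * n³ + 9 * T + 54 * D * S)
      ring = solve-∀

    E≤n : E ≤ n
    E≤n = begin
      E                          ≤⟨ m≤m*n E (9 * (M * M * M)) {{>-nonZero pos}} ⟩
      E * (9 * (M * M * M))      ≡⟨ ring E M ⟩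
      9 * (M * M * M * E)        ≤⟨ big ⟩
      u                          ≤⟨ m≤m+n u _ ⟩
      216 * u                    ≤⟨ 216u≤n ⟩
      n                          ∎
      where
      open ≤-Reasoning
      1≤M : 1 ≤ M
      1≤M = ≤-trans (s≤s z≤n) 2≤M
      pos : 1 ≤ 9 * (M * M * M)
      pos = *-mono-≤ {1} {9} (s≤s z≤n) (*-mono-≤ {1} {M * M} (*-mono-≤ {1} {M} 1≤M 1≤M) 1≤M)
      ring : ∀ E M → E * (9 * (M * M * M)) ≡ 9 * (M * M * M * E)
      ring = solve-∀

    T>0 : 0 < size k
    T>0 = n≢0⇒n>0 λ T≡0 → <-irrefl refl (begin-strict
      n * n * n                    <⟨ m<m+n (n * n * n) (*-mono-≤ {1} {n * n} (*-mono-≤ {1} {n} 1≤n 1≤n) 1≤n) ⟩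
      n * n * n + n * n * n        ≡⟨ ring n ⟩
      2 * (n * n * n)              ≤⟨ lower ⟩
      9 * size k + E * (n * n)     ≡⟨ cong (λ x → 9 * x + E * (n * n)) T≡0 ⟩
      E * (n * n)                  ≤⟨ *-monoˡ-≤ (n * n) E≤n ⟩
      n * (n * n)                  ≡⟨ *-assoc n n n ⟨
      n * n * n                    ∎)
      where
      open ≤-Reasoning
      ring : ∀ n → n * n * n + n * n * n ≡ 2 * (n * n * n)
      ring = solve-∀

  module FromEdge {x y z : Fin n} (e : k x y z ≡ true) (rich : 3 * size k ≤ shadow k * span x y z) where
    private
      κ : Fin n → K
      κ = link-colour e

      mono : ∀ {p q r} → κ p ≢ 𝟘 → κ p ≡ κ q → k p q r ≡ true → ⊥
      mono = mono-colour e

      N = class κ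
      σ = total N
      δ = N 𝟘
      m = N 𝟙 * N 𝟚 * N 𝟛

      δ+σ≡n : δ + σ ≡ n
      δ+σ≡n = class-total κ

      σ≤n : σ ≤ n
      σ≤n = ≤-trans (m≤n+m σ δ) (≤-reflexive δ+σ≡n)

      2δ²≤ : 2 * (δ * δ) ≤ E * n
      2δ²≤ = leftover-bound (size k) σ δ E n δ+σ≡n 1≤n
        (size-vs-classes (size k) (shadow k) σ (square-sum N) n
          (≤-trans rich (*-monoʳ-≤ (shadow k) (span≤total e))) (shadow-bound k κ mono) (power-mean (N 𝟙) (N 𝟚) (N 𝟛)))
        lower

      error : (E + 27 * δ) * n ≤ 36 * (u * u)
      error = error-small {δ = δ} {M = M} 2δ²≤ n≤ big 2≤M 1≤u

      size-k≤ : size k ≤ rainbow κ k + 3 * (δ * (n * n))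
      size-k≤ = size≤rainbow k is3 κ mono

      -- The colouring comes from the cleaned graph, but from here on the missing triples are
      -- counted in `h` itself, to which the conclusion refers.
      rainbow-mono : rainbow κ k ≤ rainbow κ h
      rainbow-mono = ∑-mono λ v → *-monoʳ-≤ ⟦ nz (κ v) ⟧ (∑₂-mono λ y z → ⟦⟧-mono λ f →
        ∧-true (∧-trueˡ f) (subgraph (∧-trueʳ {cross κ (κ v) y z} f)))

      miss = ∑ λ v → ⟦ nz (κ v) ⟧ * missing κ h v

      -- Present and missing rainbow triples together number 6 m, and 54 m ≤ 2 n³ by AM-GM. The
      -- density bound says that nine times the present ones is at least 2 n³ up to the error, so
      -- few are missing.
      miss≤ : miss ≤ 4 * (u * u) * n
      miss≤ = *-cancelˡ-≤ 9 (lin 0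
        (+-mono-≤ (+-mono-≤ (+-mono-≤ (+-mono-≤ (+-mono-≤ (*-monoʳ-≤ 9 (≤-reflexive (rainbow+missing κ h)))
          (amgm (N 𝟙) (N 𝟚) (N 𝟛))) (*-monoʳ-≤ 2 (*-mono-≤ (*-mono-≤ σ≤n σ≤n) σ≤n))) lower) (*-monoʳ-≤ 9 (≤-trans size-k≤ (+-monoˡ-≤ _ rainbow-mono))))
          (*-monoˡ-≤ n error))
        (ring miss (rainbow κ h) m (2 * (σ * σ * σ)) (size k) δ E u n))
        where
        ring : ∀ miss R m s T δ E u n →
          9 * miss + (9 * (6 * m) + s + 2 * (n * n * n) + (9 * T + E * (n * n)) + 9 * (R + 3 * (δ * (n * n))) + 36 * (u * u) * n) + 0
          ≡ 9 * (4 * (u * u) * n) + (9 * (R + miss) + 54 * m + s + 2 * (n * n * n) + 9 * T + (E + 27 * δ) * n * n)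
        ring = solve-∀

      -- At most 4 u² n missing triples leave at most u / 2 vertices that miss more than 8 u n
      -- pairs. The uncoloured vertices are at most u / 2 as well, hence at most `u` are discarded.
      open Discard h κ (8 * u * n)

      A = # atypical

      2A≤u : 2 * A ≤ u
      2A≤u = *-cancelˡ-≤ (4 * u * n) {{>-nonZero (*-mono-≤ {1} {4 * u} (*-mono-≤ {1} {4} (s≤s z≤n) 1≤u) 1≤n)}} (begin
        4 * u * n * (2 * A)       ≡⟨ ring₁ u n A ⟩
        8 * u * n * A             ≤⟨ *-monoˡ-≤ A (n≤1+n (8 * u * n)) ⟩
        suc (8 * u * n) * A       ≤⟨ few-atypical ⟩
        miss                      ≤⟨ miss≤ ⟩
        4 * (u * u) * n           ≡⟨ ring₂ u n ⟩
        4 * u * n * u             ∎)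
        where
        open ≤-Reasoning
        ring₁ : ∀ u n A → 4 * u * n * (2 * A) ≡ 8 * u * n * A
        ring₁ = solve-∀
        ring₂ : ∀ u n → 4 * (u * u) * n ≡ 4 * u * n * u
        ring₂ = solve-∀

      volume : 2 * (n * n * n) ≤ 54 * m + 36 * (u * u) * n
      volume = lin 0 (+-mono-≤ (+-mono-≤ (+-mono-≤ lower (*-monoʳ-≤ 9 (≤-trans size-k≤ (+-monoˡ-≤ _ rainbow-mono))))
          (*-monoʳ-≤ 9 (≤-trans (m≤m+n (rainbow κ h) miss) (≤-reflexive (rainbow+missing κ h))))) (*-monoˡ-≤ n error))
        (ring (rainbow κ h) m (size k) δ E u n)
        where
        ring : ∀ R m T δ E u n →
          2 * (n * n * n) + (9 * T + E * (n * n) + 9 * (R + 3 * (δ * (n * n))) + 9 * (6 * m) + 36 * (u * u) * n) + 0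
          ≡ 54 * m + 36 * (u * u) * n + (2 * (n * n * n) + 9 * T + 9 * R + (E + 27 * δ) * n * n)
        ring = solve-∀

      large-class : ∀ i b c → N i + b + c ≡ σ → N i * b * c ≡ m → n ≤ 8 * class κ′ i
      large-class i b c s p = large-part′ (N i) (class κ′ i) A u n (class-≤ i) 2A≤u 216u≤n
        (large-part (N i) b c u n (≤-trans (≤-reflexive s) σ≤n) 216u≤n 1≤n
          (≤-trans volume (≤-reflexive (cong (λ x → 54 * x + 36 * (u * u) * n) (sym p)))))

    core : Core u h
    core = record
      { κ = κ′
      ; few = *-cancelˡ-≤ 2 (≤-trans (*-monoʳ-≤ 2 class-𝟘) (≤-trans (≤-reflexive (*-distribˡ-+ 2 δ A))
          (≤-trans (+-mono-≤ (2δ≤u {δ = δ} {M = M} 2δ²≤ n≤ big 2≤M 1≤u) 2A≤u) (≤-reflexive (cong (u +_) (sym (+-identityʳ u)))))))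
      ; large = λ {i} → ≢𝟘-cases (λ i → n ≤ 8 * class κ′ i)
          (large-class 𝟙 (N 𝟚) (N 𝟛) refl refl)
          (large-class 𝟚 (N 𝟙) (N 𝟛) (cong (_+ N 𝟛) (+-comm (N 𝟚) (N 𝟙))) (cong (_* N 𝟛) (*-comm (N 𝟚) (N 𝟙))))
          (large-class 𝟛 (N 𝟙) (N 𝟚) (rot (N 𝟛) (N 𝟙) (N 𝟚)) (rot* (N 𝟛) (N 𝟙) (N 𝟚)))
      ; typical = typical′ }
      where
      rot : ∀ c a b → c + a + b ≡ a + b + c
      rot = solve-∀
      rot* : ∀ c a b → c * a * b ≡ a * b * c
      rot* = solve-∀

  core-exists : Core u h
  core-exists = let x , y , z , e , rich = rich-edge T>0 in FromEdge.core e rich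

-- Classification of the vertices

degree : Graph3 n → Fin n → ℕ
degree h v = #₂ (h v)

degree-split : (h : Graph3 n) (κ : Fin n → K) (v : Fin n) → degree h v ≤
  degIn κ h 𝟘 v + degIn κ h 𝟙 v + degIn κ h 𝟚 v + degIn κ h 𝟛 v + 2 * (class κ 𝟘 * n)
degree-split {n} h κ v = begin
  degree h v
    ≤⟨ ∑₂-mono (λ y z → pointwise (κ y) (κ z) (h v y z)) ⟩
  ∑₂ (λ y z → c 𝟘 y z + c 𝟙 y z + c 𝟚 y z + c 𝟛 y z + (⟦ κ y =ᴷ 𝟘 ⟧ + ⟦ κ z =ᴷ 𝟘 ⟧))
    ≡⟨ trans (∑₂-+ _ _) (cong₂ _+_ (trans (∑₂-+ _ _) (cong₂ _+_ (trans (∑₂-+ _ _)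
         (cong₂ _+_ (∑₂-+ _ _) refl)) refl)) (trans (∑₂-+ _ _) (cong₂ _+_ in-y in-z))) ⟩
  degIn κ h 𝟘 v + degIn κ h 𝟙 v + degIn κ h 𝟚 v + degIn κ h 𝟛 v + (class κ 𝟘 * n + class κ 𝟘 * n)
    ≡⟨ cong (λ x → degIn κ h 𝟘 v + degIn κ h 𝟙 v + degIn κ h 𝟚 v + degIn κ h 𝟛 v + (class κ 𝟘 * n + x)) (sym (+-identityʳ _)) ⟩
  degIn κ h 𝟘 v + degIn κ h 𝟙 v + degIn κ h 𝟚 v + degIn κ h 𝟛 v + 2 * (class κ 𝟘 * n) ∎
  where
  open ≤-Reasoning
  c : K → Fin n → Fin n → ℕ
  c i y z = ⟦ cross κ i y z ∧ h v y z ⟧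
  in-y : ∑₂ (λ (y z : Fin n) → ⟦ κ y =ᴷ 𝟘 ⟧) ≡ class κ 𝟘 * n
  in-y = trans (∑-cong λ y → trans (∑-const n _) (*-comm n _)) (∑-*ʳ n _)
  in-z : ∑₂ (λ (y z : Fin n) → ⟦ κ z =ᴷ 𝟘 ⟧) ≡ class κ 𝟘 * n
  in-z = trans (∑₂-swap (λ y z → ⟦ κ y =ᴷ 𝟘 ⟧)) in-y
  cell : K → K → K → Bool → ℕ
  cell i a b e = ⟦ ((nz a ∧ nz b) ∧ (b =ᴷ i ⊕ a)) ∧ e ⟧
  covered : ∀ a b → ((1 ≤ᵇ cell 𝟘 a b true + cell 𝟙 a b true + cell 𝟚 a b true + cell 𝟛 a b true
    + (⟦ a =ᴷ 𝟘 ⟧ + ⟦ b =ᴷ 𝟘 ⟧))) ≡ true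
  covered = byTableᵇ₂ _ (λ _ _ → true) refl
  pointwise : ∀ a b e → ⟦ e ⟧ ≤ cell 𝟘 a b e + cell 𝟙 a b e + cell 𝟚 a b e + cell 𝟛 a b e
    + (⟦ a =ᴷ 𝟘 ⟧ + ⟦ b =ᴷ 𝟘 ⟧)
  pointwise a b false = z≤n
  pointwise a b true  = ≤ᵇ⇒≤ 1 _ (Equivalence.from T-≡ (covered a b))

cross-colours : (κ : Fin n → K) (i : K) (y z : Fin n) → cross κ i y z ≡ true →
                κ y ≢ 𝟘 × κ z ≢ 𝟘 × κ z ≡ i ⊕ κ y
cross-colours κ i y z e =
    nz⇒≢𝟘 (∧-trueˡ (∧-trueˡ e))
  , nz⇒≢𝟘 (∧-trueʳ {nz (κ y)} (∧-trueˡ e))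
  , =ᴷ⇒≡ (κ z) (i ⊕ κ y) (∧-trueʳ {nz (κ y) ∧ nz (κ z)} e)

module _ {t : ℕ} {h : Graph3 n} (H : Is3Graph h) (free : Free t h) (κ : Fin n → K) where

  -- Two sets of pairs inside `cross κ i` whose sizes exceed `pairs κ i` in sum overlap in at least
  -- the excess, from which a pair f₁f₂ off the list is chosen.
  common-pair : ∀ i x y L → pairs κ i + length L * (2 * n) < degIn κ h i x + degIn κ h i y →
    ∃₂ λ f₁ f₂ → h f₁ f₂ x ≡ true × h f₁ f₂ y ≡ true × Avoids L f₁ × Avoids L f₂
  common-pair i x y L lt = step (pickPair both L (+-cancelˡ-< (pairs κ i) _ _ (<-≤-trans lt shared)))
    where
    both : Fin n → Fin n → Bool
    both f₁ f₂ = h x f₁ f₂ ∧ h y f₁ f₂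
    shared : degIn κ h i x + degIn κ h i y ≤ pairs κ i + #₂ both
    shared = ≤-trans (≤-reflexive (sym (∑₂-+ _ _)))
      (≤-trans (∑₂-mono λ f₁ f₂ → pointwise (cross κ i f₁ f₂) (h x f₁ f₂) (h y f₁ f₂)) (≤-reflexive (∑₂-+ _ _)))
      where
      pointwise : ∀ a b c → ⟦ a ∧ b ⟧ + ⟦ a ∧ c ⟧ ≤ ⟦ a ⟧ + ⟦ b ∧ c ⟧
      pointwise false b     c     = z≤n
      pointwise true  false c     = ≤-trans (⟦⟧-≤1 c) (m≤m+n 1 _)
      pointwise true  true  false = s≤s z≤n
      pointwise true  true  true  = ≤-refl
    step : (∃₂ λ f₁ f₂ → both f₁ f₂ ≡ true × Avoids L f₁ × Avoids L f₂) → _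
    step (f₁ , f₂ , e , a₁ , a₂) = f₁ , f₂
      , trans (sym (rotate H x f₁ f₂)) (∧-trueˡ e)
      , trans (sym (rotate H y f₁ f₂)) (∧-trueʳ {h x f₁ f₂} e) , a₁ , a₂

  no-edge : ∀ i {x y z} → Supported t h z → pairs κ i + 2 * n < degIn κ h i x + degIn κ h i y →
            h x y z ≡ true → ⊥
  no-edge i {x} {y} {z} sup lt e = step (common-pair i x y (z ∷ []) (≤-trans (s≤s (≤-reflexive (cong (pairs κ i +_) (+-identityʳ (2 * n))))) lt))
    where
    step : (∃₂ λ f₁ f₂ → h f₁ f₂ x ≡ true × h f₁ f₂ y ≡ true × Avoids (z ∷ []) f₁ × Avoids (z ∷ []) f₂) → ⊥
    step (f₁ , f₂ , e₁ , e₂ , (n₁ ∷ []) , (n₂ ∷ [])) = supported⇒no-apex H free sup e₁ e₂ e n₁ n₂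

-- A `bad` vertex still receives a part: placed there in the construction it would have degree about
-- `pairs κ i`, so replacing its edges would gain at least 6 u n pairs in its link. The colour 𝟘 is
-- reserved for `light` vertices, which form Q.
data Verdict (t u : ℕ) (h : Graph3 n) (κ : Fin n → K) (v : Fin n) : K → Bool → Set where
  good  : ∀ {i} → i ≢ 𝟘 → Supported t h v → pairs κ i ≤ degIn κ h i v + 8 * u * n → Verdict t u h κ v i false
  bad   : ∀ {i} → i ≢ 𝟘 → degree h v + 6 * u * n ≤ pairs κ i → Verdict t u h κ v i true
  light : (∀ p q → h v p q ≡ true → codeg h p q ≤ t) → κ v ≡ 𝟘 → Verdict t u h κ v 𝟘 false

record Classified (t u : ℕ) (h : Graph3 n) (κ : Fin n → K) (v : Fin n) : Set where
  constructor classified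
  field
    colour  : K
    isBad   : Bool
    verdict : Verdict t u h κ v colour isBad
    extends : κ v ≢ 𝟘 → colour ≡ κ v × isBad ≡ false

module Classify {t : ℕ} {h : Graph3 n} (H : Is3Graph h) (free : Free t h) (u : ℕ)
  (t≤u : 2 * t + 10 ≤ u) (u≤n : 9000 * u ≤ n) (the-core : Core u h) where
  open Core the-core

  private
    P : K → ℕ
    P = pairs κ

    d : K → Fin n → ℕ
    d = degIn κ h

    Good : K → Fin n → Set
    Good i v = P i ≤ d i v + 8 * u * n

    1≤u : 1 ≤ u
    1≤u = ≤-trans (s≤s z≤n) (≤-trans (m≤n+m 10 (2 * t)) t≤u)

    1≤n : 1 ≤ n
    1≤n = ≤-trans 1≤u (≤-trans (m≤m+n u _) u≤n)

    instance
      n≢0 : NonZero n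
      n≢0 = >-nonZero 1≤n

    -- The number of pairs is 2 b c for the sizes b, c ≥ n / 8 of the other two parts, hence at
    -- least n² / 32; and 9000 / 32 exceeds 281.
    many-pairs : ∀ {i} → i ≢ 𝟘 → 281 * (u * n) ≤ P i
    many-pairs {i} ne = *-cancelˡ-≤ 32 (lin (8 * (u * n)) (+-mono-≤ (*-monoˡ-≤ n u≤n) (32P ne)) (ring u n (P i)))
      where
      ring : ∀ u n P → 32 * (281 * (u * n)) + (n * n + 32 * P) + 8 * (u * n) ≡ 32 * P + (9000 * u * n + n * n)
      ring = solve-∀
      product : ∀ a b c P → n ≤ 8 * a → n ≤ 8 * b → n ≤ 8 * c → a * P ≡ 2 * (a * b * c) → n * n ≤ 32 * P
      product a b c P a≥ b≥ c≥ e = *-cancelˡ-≤ a {{>-nonZero (n≢0⇒n>0 λ { refl → contradiction (≤-trans 1≤n a≥) λ () })}}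
        (≤-trans (*-monoʳ-≤ a (*-mono-≤ b≥ c≥)) (≤-reflexive (trans (r₁ a b c) (trans (cong (32 *_) (sym e)) (r₂ a P)))))
        where
        r₁ : ∀ a b c → a * (8 * b * (8 * c)) ≡ 32 * (2 * (a * b * c))
        r₁ = solve-∀
        r₂ : ∀ a P → 32 * (a * P) ≡ a * (32 * P)
        r₂ = solve-∀
      L : ∀ j → j ≢ 𝟘 → n ≤ 8 * class κ j
      L j = large
      32P : ∀ {i} → i ≢ 𝟘 → n * n ≤ 32 * P i
      32P = ≢𝟘-cases (λ i → n * n ≤ 32 * P i)
        (product (class κ 𝟙) (class κ 𝟚) (class κ 𝟛) (P 𝟙) (L 𝟙 λ ()) (L 𝟚 λ ()) (L 𝟛 λ ()) (pairs-value κ {𝟙} λ ()))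
        (product (class κ 𝟚) (class κ 𝟙) (class κ 𝟛) (P 𝟚) (L 𝟚 λ ()) (L 𝟙 λ ()) (L 𝟛 λ ()) (trans (pairs-value κ {𝟚} λ ()) (s₁ (class κ 𝟙) (class κ 𝟚) (class κ 𝟛))))
        (product (class κ 𝟛) (class κ 𝟙) (class κ 𝟚) (P 𝟛) (L 𝟛 λ ()) (L 𝟙 λ ()) (L 𝟚 λ ()) (trans (pairs-value κ {𝟛} λ ()) (s₂ (class κ 𝟙) (class κ 𝟚) (class κ 𝟛))))
        where
        s₁ : ∀ a b c → 2 * (a * b * c) ≡ 2 * (b * a * c)
        s₁ = solve-∀
        s₂ : ∀ a b c → 2 * (a * b * c) ≡ 2 * (c * a * b)
        s₂ = solve-∀

  -- From t + 5 neighbours t remain for the gᵢ after f₁, ..., f₅ are avoided.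
  isLight : Fin n → Fin n → Bool
  isLight y z = codeg h y z <ᵇ t + 5

  private
    missing≤ : ∀ y → κ y ≢ 𝟘 → missing κ h y ≤ 8 * u * n
    missing≤ y ne = +-cancelˡ-≤ (d (κ y) y) _ _ (≤-trans (≤-reflexive (sym (pairs-split κ h y))) (typical y ne))

    small-t : 72 * (t + 5) ≤ n
    small-t = lin (8964 * u) (+-mono-≤ (*-monoʳ-≤ 36 t≤u) u≤n) (ring t u n)
      where
      ring : ∀ t u n → 72 * (t + 5) + (36 * u + n) + 8964 * u ≡ n + (36 * (2 * t + 10) + 9000 * u)
      ring = solve-∀

    -- If yz has fewer than t + 5 neighbours, then y misses the pairs zv for all but t + 5 vertices
    -- v of part i. That is at least n / 8 - n / 72 = n / 9 missing pairs per z, while y misses at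
    -- most 8 u n in all, so there are at most 72 u such z.
    light-row : ∀ i → i ≢ 𝟘 → ∀ y → # (λ z → cross κ i y z ∧ isLight y z) ≤ 72 * u
    light-row i ne y = step (κ y ≟ᴷ 𝟘)
      where
      ℓ = # (λ z → cross κ i y z ∧ isLight y z)
      N = class κ i
      miss : Fin n → ℕ
      miss z = # λ v → cross κ (κ y) z v ∧ not (h y z v)
      arithmetic : ℓ * N ≤ (t + 5) * ℓ + 8 * u * n → ℓ ≤ 72 * u
      arithmetic le = *-cancelʳ-≤ _ _ (8 * n) {{>-nonZero (*-mono-≤ {1} {8} (s≤s z≤n) 1≤n)}}
        (lin 0 (+-mono-≤ (+-mono-≤ (*-monoʳ-≤ 72 le) (*-monoʳ-≤ (9 * ℓ) (large ne))) (*-monoʳ-≤ ℓ small-t)) (ring ℓ N t u n))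
        where
        ring : ∀ ℓ N t u n → ℓ * (8 * n) + (72 * ((t + 5) * ℓ + 8 * u * n) + 9 * ℓ * (8 * N) + ℓ * n) + 0
             ≡ 72 * u * (8 * n) + (72 * (ℓ * N) + 9 * ℓ * n + ℓ * (72 * (t + 5)))
        ring = solve-∀
      third : ∀ z v → cross κ i y z ≡ true → (κ v =ᴷ i) ≡ true → cross κ (κ y) z v ≡ true
      third z v e f = subst (λ c → ((nz (κ z) ∧ nz c) ∧ (c =ᴷ κ y ⊕ κ z)) ≡ true) (sym κv≡i)
        (∧-true (∧-true (≢𝟘⇒nz κz≢𝟘) (≢𝟘⇒nz ne))
          (trans (cong (i =ᴷ_) (trans (cong (κ y ⊕_) (trans κz≡ (⊕-comm i (κ y)))) (⊕-cancel (κ y) i))) (=ᴷ-refl i)))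
        where
        κv≡i = =ᴷ⇒≡ (κ v) i f
        κz≢𝟘 = proj₁ (proj₂ (cross-colours κ i y z e))
        κz≡ = proj₂ (proj₂ (cross-colours κ i y z e))
      row : ∀ z b → (cross κ i y z ∧ isLight y z) ≡ b → ⟦ b ⟧ * N ≤ (t + 5) * ⟦ b ⟧ + miss z
      row z false e = z≤n
      row z true  e = begin
        1 * N                                            ≡⟨ *-identityˡ N ⟩
        N                                                ≤⟨ ∑-mono (λ v → split (κ v =ᴷ i) (h y z v) (cross κ (κ y) z v) (third z v (∧-trueˡ e))) ⟩
        ∑ (λ v → ⟦ h y z v ⟧ + ⟦ cross κ (κ y) z v ∧ not (h y z v) ⟧) ≡⟨ ∑-+ _ _ ⟩
        codeg h y z + miss z                             ≤⟨ +-monoˡ-≤ (miss z) (<⇒≤ (<ᵇ⇒< _ _ (Equivalence.from T-≡ (∧-trueʳ {cross κ i y z} e)))) ⟩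
        t + 5 + miss z                                   ≡⟨ cong (_+ miss z) (*-identityʳ (t + 5)) ⟨
        (t + 5) * 1 + miss z                             ∎
        where
        open ≤-Reasoning
        split : ∀ a b c → (a ≡ true → c ≡ true) → ⟦ a ⟧ ≤ ⟦ b ⟧ + ⟦ c ∧ not b ⟧
        split false b     c f = z≤n
        split true  true  c f = s≤s z≤n
        split true  false c f rewrite f refl = ≤-refl
      step : Dec (κ y ≡ 𝟘) → ℓ ≤ 72 * u
      step (yes e) = ≤-trans (≤-reflexive (∑-zero _ λ z →
        cong (λ a → ⟦ ((nz a ∧ nz (κ z)) ∧ (κ z =ᴷ i ⊕ a)) ∧ isLight y z ⟧) e)) z≤n
      step (no y≢𝟘) = arithmetic (begin
        ℓ * N                                            ≡⟨ ∑-*ʳ N _ ⟨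
        ∑ (λ z → ⟦ cross κ i y z ∧ isLight y z ⟧ * N)    ≤⟨ ∑-mono (λ z → row z _ refl) ⟩
        ∑ (λ z → (t + 5) * ⟦ cross κ i y z ∧ isLight y z ⟧ + miss z) ≡⟨ trans (∑-+ _ _) (cong (_+ ∑ miss) (∑-*ˡ (t + 5) _)) ⟩
        (t + 5) * ℓ + missing κ h y                      ≤⟨ +-monoʳ-≤ ((t + 5) * ℓ) (missing≤ y y≢𝟘) ⟩
        (t + 5) * ℓ + 8 * u * n                          ∎)
        where open ≤-Reasoning

  -- At most 72 u n of the 80 u n pairs are light. The remaining 8 u n exceed the 4 · 2 n pairs that
  -- four vertices can block, so a heavy pair is available as f₆f₇.
  supported-by-degree : ∀ {i v} → i ≢ 𝟘 → 80 * (u * n) ≤ d i v → Supported t h v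
  supported-by-degree {i} {v} ne deg L L≤4 = step (pickPair heavy L enough)
    where
    open ≤-Reasoning
    heavy : Fin n → Fin n → Bool
    heavy p q = (cross κ i p q ∧ h v p q) ∧ not (isLight p q)
    split : d i v ≤ #₂ heavy + n * (72 * u)
    split = begin
      d i v
        ≤⟨ ∑₂-mono (λ p q → pointwise (cross κ i p q) (h v p q) (isLight p q)) ⟩
      ∑₂ (λ p q → ⟦ heavy p q ⟧ + ⟦ cross κ i p q ∧ isLight p q ⟧)
        ≡⟨ ∑₂-+ _ _ ⟩
      #₂ heavy + ∑ (λ p → # λ q → cross κ i p q ∧ isLight p q)
        ≤⟨ +-monoʳ-≤ (#₂ heavy) (∑-bound (72 * u) (light-row i ne)) ⟩
      #₂ heavy + n * (72 * u) ∎
      where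
      pointwise : ∀ a b c → ⟦ a ∧ b ⟧ ≤ ⟦ (a ∧ b) ∧ not c ⟧ + ⟦ a ∧ c ⟧
      pointwise false b     c     = z≤n
      pointwise true  false c     = z≤n
      pointwise true  true  true  = s≤s z≤n
      pointwise true  true  false = s≤s z≤n
    enough : length L * (2 * n) < #₂ heavy
    enough = lin (7 * n) (+-mono-≤ (+-mono-≤ (+-mono-≤ (+-mono-≤ (*-monoˡ-≤ (2 * n) L≤4) deg) split) (*-monoˡ-≤ (8 * n) 2≤u)) 1≤n)
        (ring (length L) n (d i v) (#₂ heavy) u)
      where
      2≤u : 2 ≤ u
      2≤u = ≤-trans (s≤s (s≤s z≤n)) (≤-trans (m≤n+m 10 (2 * t)) t≤u)
      ring : ∀ L n d X u → suc (L * (2 * n)) + (4 * (2 * n) + d + (X + n * (72 * u)) + u * (8 * n) + n) + 7 * n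
           ≡ X + (L * (2 * n) + 80 * (u * n) + d + 2 * (8 * n) + 1)
      ring = solve-∀
    step : (∃₂ λ p q → heavy p q ≡ true × Avoids L p × Avoids L q) → Extension t h v L
    step (p , q , e , p∉ , q∉) = found (pickMany t (h p q) (v ∷ L) (≤-trans (+-monoʳ-≤ t (s≤s L≤4)) codeg≥))
      where
      codeg≥ : t + 5 ≤ codeg h p q
      codeg≥ = ≮⇒≥ λ lt → true≢false (Equivalence.to T-≡ (<⇒<ᵇ lt)) (not-true (∧-trueʳ {cross κ i p q ∧ h v p q} e))
      found : (∃ λ (g : Fin t → Fin n) → Injective _≡_ _≡_ g × (∀ i → h p q (g i) ≡ true) × (∀ i → Avoids (v ∷ L) (g i))) → Extension t h v L
      found (g , inj , eg , g∉) = p , q , g , ∧-trueʳ {cross κ i p q} (∧-trueˡ e) , eg , inj , p∉ , q∉ , g∉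

  private
    good⇒degree : ∀ {i v} → i ≢ 𝟘 → Good i v → 80 * (u * n) ≤ d i v
    good⇒degree {i} {v} ne g = lin (193 * (u * n)) (+-mono-≤ g (many-pairs ne)) (ring u n (P i) (d i v))
      where
      ring : ∀ u n P d → 80 * (u * n) + (d + 8 * u * n + P) + 193 * (u * n) ≡ d + (P + 281 * (u * n))
      ring = solve-∀

    core-supported : ∀ {v} → κ v ≢ 𝟘 → Supported t h v
    core-supported ne = supported-by-degree ne (good⇒degree ne (typical _ ne))


  private
    n<un : n < u * n
    n<un = ≤-trans (m<m+n n 1≤n) (≤-trans (≤-reflexive (cong (n +_) (sym (+-identityʳ n))))
      (*-monoˡ-≤ n {2} {u} (≤-trans (s≤s (s≤s z≤n)) (≤-trans (m≤n+m 10 (2 * t)) t≤u))))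

  no-good-pair : ∀ {i x y z} → i ≢ 𝟘 → Supported t h z → Good i x → Good i y → h x y z ≡ true → ⊥
  no-good-pair {i} {x} {y} ne sup gx gy = no-edge H free κ i sup
    (lin (263 * (u * n) + 1) (+-mono-≤ (+-mono-≤ (+-mono-≤ gx gy) (many-pairs ne)) (*-monoʳ-≤ 2 n<un)) (ring u n (P i) (d i x) (d i y)))
    where
    ring : ∀ u n P d d′ → suc (P + 2 * n) + (d + 8 * u * n + (d′ + 8 * u * n) + P + 2 * (u * n)) + (263 * (u * n) + 1)
         ≡ d + d′ + (P + P + 281 * (u * n) + 2 * (1 + n))
    ring = solve-∀

  -- A nearly complete link misses only 8 u n pairs, so any other link with 80 u n pairs of the same
  -- type must meet it. This handles vertices not yet known to be good.
  no-mixed-pair : ∀ {i x y z} → i ≢ 𝟘 → Supported t h z → 80 * (u * n) ≤ d i x → Good i y → h x y z ≡ true → ⊥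
  no-mixed-pair {i} {x} {y} ne sup dx gy = no-edge H free κ i sup
    (lin (70 * (u * n) + 1) (+-mono-≤ (+-mono-≤ dx gy) (*-monoʳ-≤ 2 n<un)) (ring u n (P i) (d i x) (d i y)))
    where
    ring : ∀ u n P d d′ → suc (P + 2 * n) + (d + (d′ + 8 * u * n) + 2 * (u * n)) + (70 * (u * n) + 1)
         ≡ d + d′ + (80 * (u * n) + P + 2 * (1 + n))
    ring = solve-∀

  private
    empty : ∀ {p : Fin n → Fin n → Bool} → (∀ y z → p y z ≡ true → ⊥) → #₂ p ≡ 0
    empty none = ∑-zero _ λ y → ∑-zero _ λ z → cong ⟦_⟧ (¬-not (none y z))

    degree≤ : ∀ v → degree h v ≤ d 𝟘 v + d 𝟙 v + d 𝟚 v + d 𝟛 v + 2 * (u * n)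
    degree≤ v = ≤-trans (degree-split h κ v) (+-monoʳ-≤ (d 𝟘 v + d 𝟙 v + d 𝟚 v + d 𝟛 v) (*-monoʳ-≤ 2 (*-monoˡ-≤ n few)))

    few-few : (2 + t) * (2 * n) ≤ u * n
    few-few = lin (6 * n) (*-monoˡ-≤ n t≤u) (ring t n u)
      where
      ring : ∀ t n u → (2 + t) * (2 * n) + u * n + 6 * n ≡ u * n + (2 * t + 10) * n
      ring = solve-∀

  -- A link pair xy inside a part serves as f₃f₄. Both vertices are typical for that part, so their
  -- links share far more pairs f₁f₂ than the forbidden vertices can block.
  robust : ∀ {v} → (2 + t) * (2 * n) < d 𝟘 v → RobustApex t h v
  robust {v} many L L≤ = step (pickPair (λ x y → cross κ 𝟘 x y ∧ h v x y) L (≤-<-trans (*-monoˡ-≤ (2 * n) L≤) many))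
    where
    step : (∃₂ λ x y → (cross κ 𝟘 x y ∧ h v x y) ≡ true × Avoids L x × Avoids L y) → _
    step (x , y , e , x∉ , y∉) = found (common-pair H free κ (κ x) x y (v ∷ L)
      (≤-<-trans (+-monoʳ-≤ (P (κ x)) (*-monoˡ-≤ (2 * n) (s≤s L≤)))
        (lin (264 * (u * n) + 3 * n) (+-mono-≤ (+-mono-≤ (+-mono-≤ (+-mono-≤ gx gy) (many-pairs x≢𝟘)) (*-monoˡ-≤ n t≤u)) 1≤n)
          (ring t u n (P (κ x)) (d (κ x) x) (d (κ x) y)))))
      where
      colours = cross-colours κ 𝟘 x y (∧-trueˡ e)
      x≢𝟘 = proj₁ colours
      same : κ y ≡ κ x
      same = proj₂ (proj₂ colours)
      gx : Good (κ x) x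
      gx = typical x x≢𝟘
      gy : Good (κ x) y
      gy = subst (λ i → Good i y) same (typical y (proj₁ (proj₂ colours)))
      ring : ∀ t u n P d d′ → suc (P + (3 + t) * (2 * n)) + (d + 8 * u * n + (d′ + 8 * u * n) + P + u * n + n) + (264 * (u * n) + 3 * n)
           ≡ d + d′ + (P + P + 281 * (u * n) + (2 * t + 10) * n + 1)
      ring = solve-∀
      found : (∃₂ λ f₁ f₂ → h f₁ f₂ x ≡ true × h f₁ f₂ y ≡ true × Avoids (v ∷ L) f₁ × Avoids (v ∷ L) f₂) → _
      found (f₁ , f₂ , e₁ , e₂ , n₁ , n₂) = f₁ , f₂ , x , y , e₁ , e₂
        , trans (sym (rotate H v x y)) (∧-trueʳ {cross κ 𝟘 x y} e) , n₁ , n₂ , x∉ , y∉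

  private
    -- The dense link makes `v` supported, so no link pair lies inside a part: it would be f₃f₄ with
    -- f₅ = v. In a link pair of type j ≢ i one vertex has colour i; that vertex and `v` would be
    -- f₃f₄, and the other vertex of the pair would be f₅. Hence the link is of type i up to 2 u n
    -- pairs.
    typed : ∀ {i v} → i ≢ 𝟘 → κ v ≡ 𝟘 → 80 * (u * n) ≤ d i v → Classified t u h κ v
    typed {i} {v} ne v≡𝟘 deg = decide (P i ≤? d i v + 8 * u * n)
      where
      sup = supported-by-degree ne deg
      none-𝟘 : d 𝟘 v ≡ 0
      none-𝟘 = empty λ y z e → let y≢𝟘 , z≢𝟘 , same = cross-colours κ 𝟘 y z (∧-trueˡ e) in
        no-good-pair y≢𝟘 sup (typical y y≢𝟘) (subst (λ c → Good c z) same (typical z z≢𝟘))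
          (trans (sym (rotate H v y z)) (∧-trueʳ {cross κ 𝟘 y z} e))
      -- The colours c and j ⊕ c are the two nonzero colours other than j, and i is one of these.
      third : ∀ i j c → i ≢ 𝟘 → j ≢ 𝟘 → j ≢ i → c ≢ 𝟘 → j ⊕ c ≢ 𝟘 → (c ≡ i) ⊎ (j ⊕ c ≡ i)
      third i j c i≢ j≢ j≢i c≢ jc≢ = either (c =ᴷ i) (j ⊕ c =ᴷ i) refl refl
        where
        check : ∀ i j c → ((nz i ∧ nz j ∧ not (j =ᴷ i) ∧ nz c ∧ nz (j ⊕ c)) ∧ not ((c =ᴷ i) ∨ (j ⊕ c =ᴷ i))) ≡ false
        check = byTableᵇ₃ (λ i j c → (nz i ∧ nz j ∧ not (j =ᴷ i) ∧ nz c ∧ nz (j ⊕ c)) ∧ not ((c =ᴷ i) ∨ (j ⊕ c =ᴷ i))) (λ _ _ _ → false) refl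
        either : ∀ a b → (c =ᴷ i) ≡ a → (j ⊕ c =ᴷ i) ≡ b → (c ≡ i) ⊎ (j ⊕ c ≡ i)
        either true  b    e f = inj₁ (=ᴷ⇒≡ c i e)
        either false true e f = inj₂ (=ᴷ⇒≡ (j ⊕ c) i f)
        either false false e f = true≢false
          (∧-true (∧-true (≢𝟘⇒nz i≢) (∧-true (≢𝟘⇒nz j≢) (∧-true (cong not (¬-not λ g → j≢i (=ᴷ⇒≡ j i g)))
            (∧-true (≢𝟘⇒nz c≢) (≢𝟘⇒nz jc≢))))) (cong₂ (λ a b → not (a ∨ b)) e f)) (check i j c)
      none : ∀ j → j ≢ 𝟘 → j ≢ i → d j v ≡ 0
      none j j≢ j≢i = empty λ y z e → contra y z e (cross-colours κ j y z (∧-trueˡ e))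
        where
        contra : ∀ y z → (cross κ j y z ∧ h v y z) ≡ true → κ y ≢ 𝟘 × κ z ≢ 𝟘 × κ z ≡ j ⊕ κ y → ⊥
        contra y z e (y≢𝟘 , z≢𝟘 , κz) with third i j (κ y) ne j≢ j≢i y≢𝟘 (subst (_≢ 𝟘) κz z≢𝟘)
        ... | inj₁ y≡i = no-mixed-pair ne (core-supported z≢𝟘) deg (subst (λ c → Good c y) y≡i (typical y y≢𝟘))
                           (∧-trueʳ {cross κ j y z} e)
        ... | inj₂ z≡i = no-mixed-pair ne (core-supported y≢𝟘) deg (subst (λ c → Good c z) (trans κz z≡i) (typical z z≢𝟘))
                           (trans (swap₂₃ H v z y) (∧-trueʳ {cross κ j y z} e))
      concentrated : degree h v ≤ d i v + 2 * (u * n)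
      concentrated = ≤-trans (degree≤ v) (+-monoˡ-≤ (2 * (u * n)) (only i ne refl))
        where
        zeros : ∀ {a b c d x} → a ≡ 0 → b ≡ 0 → c ≡ 0 → d ≤ x → a + d + b + c ≤ x
        zeros {d = d} refl refl refl le = ≤-trans (≤-reflexive (trans (+-identityʳ _) (+-identityʳ d))) le
        only : ∀ j → j ≢ 𝟘 → j ≡ i → d 𝟘 v + d 𝟙 v + d 𝟚 v + d 𝟛 v ≤ d i v
        only 𝟘 j≢ _ = contradiction refl j≢
        only 𝟙 _ refl = zeros none-𝟘 (none 𝟚 (λ ()) (λ ())) (none 𝟛 (λ ()) (λ ())) ≤-refl
        only 𝟚 _ refl = ≤-trans (≤-reflexive (cong (λ x → d 𝟘 v + x + d 𝟚 v + d 𝟛 v) (none 𝟙 (λ ()) (λ ()))))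
          (≤-trans (≤-reflexive (cong (λ x → x + d 𝟚 v + d 𝟛 v) (+-identityʳ (d 𝟘 v)))) (≤-trans (≤-reflexive (sym (+-identityʳ _)))
            (zeros {b = d 𝟛 v} {c = 0} none-𝟘 (none 𝟛 (λ ()) (λ ())) refl ≤-refl)))
        only 𝟛 _ refl = ≤-trans (≤-reflexive (cong₂ (λ x y → x + y + d 𝟛 v) (cong₂ _+_ none-𝟘 (none 𝟙 (λ ()) (λ ()))) (none 𝟚 (λ ()) (λ ())))) ≤-refl
      decide : Dec (P i ≤ d i v + 8 * u * n) → Classified t u h κ v
      decide (yes g) = classified i false (good ne sup g) (λ v≢𝟘 → contradiction v≡𝟘 v≢𝟘)
      -- A shortage of 8 u n pairs of type i, less the 2 u n pairs that may meet discarded vertices,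
      -- leaves the deficit 6 u n.
      decide (no ¬g) = classified i true (bad ne (lin 0 (+-mono-≤ concentrated (<⇒≤ (≰⇒> ¬g))) (ring (degree h v) (d i v) (P i) u n)))
          (λ v≢𝟘 → contradiction v≡𝟘 v≢𝟘)
        where
        ring : ∀ D d P u n → D + 6 * u * n + (d + 2 * (u * n) + P) + 0 ≡ P + (D + (d + 8 * u * n))
        ring = solve-∀

  classify : ∀ v → Classified t u h κ v
  classify v = by-core (κ v ≟ᴷ 𝟘)
    where
    -- The degree is at most (1 + 3 · 80 + 2) u n = 243 u n, against at least 281 u n pairs for any
    -- part. The colour 𝟙 is an arbitrary choice.
    low : κ v ≡ 𝟘 → d 𝟘 v ≤ (2 + t) * (2 * n) → d 𝟙 v ≤ 80 * (u * n) → d 𝟚 v ≤ 80 * (u * n) → d 𝟛 v ≤ 80 * (u * n) →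
          Classified t u h κ v
    low v≡𝟘 b₀ b₁ b₂ b₃ = classified 𝟙 true (bad (λ ())
        (lin (32 * (u * n)) (+-mono-≤ (+-mono-≤ (degree≤ v) (+-mono-≤ (+-mono-≤ (+-mono-≤ (≤-trans b₀ few-few) b₁) b₂) b₃)) (many-pairs {𝟙} λ ()))
          (ring (degree h v) (d 𝟘 v) (d 𝟙 v) (d 𝟚 v) (d 𝟛 v) (P 𝟙) u n)))
        (λ v≢𝟘 → contradiction v≡𝟘 v≢𝟘)
      where
      ring : ∀ D a b c e P u n → D + 6 * u * n + (a + b + c + e + 2 * (u * n) + (u * n + 80 * (u * n) + 80 * (u * n) + 80 * (u * n)) + P) + 32 * (u * n)
           ≡ P + (D + (a + b + c + e) + 281 * (u * n))
      ring = solve-∀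
    by-type : κ v ≡ 𝟘 → d 𝟘 v ≤ (2 + t) * (2 * n) → Dec (80 * (u * n) ≤ d 𝟙 v) → Dec (80 * (u * n) ≤ d 𝟚 v) →
              Dec (80 * (u * n) ≤ d 𝟛 v) → Classified t u h κ v
    by-type z b (yes p) _ _ = typed (λ ()) z p
    by-type z b _ (yes p) _ = typed (λ ()) z p
    by-type z b _ _ (yes p) = typed (λ ()) z p
    by-type z b (no p) (no q) (no r) = low z b (<⇒≤ (≰⇒> p)) (<⇒≤ (≰⇒> q)) (<⇒≤ (≰⇒> r))
    by-apex : κ v ≡ 𝟘 → Dec (d 𝟘 v ≤ (2 + t) * (2 * n)) → Classified t u h κ v
    by-apex z (yes b) = by-type z b (_ ≤? _) (_ ≤? _) (_ ≤? _)
    by-apex z (no ¬b) = classified 𝟘 false (light (λ p q → robust⇒light H free (robust (≰⇒> ¬b))) z)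
      (λ v≢𝟘 → contradiction z v≢𝟘)
    by-core : Dec (κ v ≡ 𝟘) → Classified t u h κ v
    by-core (yes z) = by-apex z (_ ≤? _)
    by-core (no ne) = classified (κ v) false (good ne (core-supported ne) (typical v ne)) (λ _ → refl , refl)

-- Comparison with the construction

weighted : (Fin n → Bool) → (Fin n → Bool) → (Fin n → Bool) → Graph3 n → ℕ
weighted a b c g = ∑₃ λ x y z → ⟦ a x ∧ b y ∧ c z ∧ g x y z ⟧

module _ {g : Graph3 n} (G : Is3Graph g) where
  weighted-swap₁₂ : ∀ a b c → weighted a b c g ≡ weighted b a c g
  weighted-swap₁₂ a b c = trans (∑₃-cong λ x y z → cong ⟦_⟧ (trans (shuffle (a x) (b y) (c z ∧ g x y z))
    (cong (λ e → b y ∧ a x ∧ c z ∧ e) (swap₁₂ G x y z)))) (∑₃-swap₁₂ (λ x y z → ⟦ b x ∧ a y ∧ c z ∧ g x y z ⟧))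
    where
    shuffle : ∀ p q r → p ∧ q ∧ r ≡ q ∧ p ∧ r
    shuffle p q r = trans (sym (∧-assoc p q r)) (trans (cong (_∧ r) (∧-comm p q)) (∧-assoc q p r))

  weighted-swap₂₃ : ∀ a b c → weighted a b c g ≡ weighted a c b g
  weighted-swap₂₃ a b c = trans (∑₃-cong λ x y z → cong ⟦_⟧ (cong (a x ∧_) (trans (shuffle (b y) (c z) (g x y z))
    (cong (λ e → c z ∧ b y ∧ e) (swap₂₃ G x y z))))) (∑₃-swap₂₃ (λ x y z → ⟦ a x ∧ c y ∧ b z ∧ g x y z ⟧))
    where
    shuffle : ∀ p q r → p ∧ q ∧ r ≡ q ∧ p ∧ r
    shuffle p q r = trans (sym (∧-assoc p q r)) (trans (cong (_∧ r) (∧-comm p q)) (∧-assoc q p r))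

  weighted-rotate : ∀ a b c → weighted a b c g ≡ weighted b c a g
  weighted-rotate a b c = trans (weighted-swap₁₂ a b c) (weighted-swap₂₃ b a c)

module Decompose (κ : Fin n → K) (B : Fin n → Bool) (bad⇒nz : ∀ v → B v ≡ true → nz (κ v) ≡ true) where

  nb pm ωm : Fin n → Bool
  nb v = not (B v)
  pm v = nz (κ v) ∧ not (B v)
  ωm v = κ v =ᴷ 𝟘

  nonbad : Graph3 n → ℕ
  nonbad g = weighted nb nb nb g

  same diff : Fin n → Fin n → Bool
  same x y = (pm x ∧ pm y) ∧ (κ x =ᴷ κ y)
  diff x y = (pm x ∧ pm y) ∧ not (κ x =ᴷ κ y)

  dp dω dsame : Graph3 n → Fin n → Fin n → ℕ
  dp g x y    = # λ z → pm z ∧ g x y z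
  dω g x y    = # λ z → ωm z ∧ g x y z
  dsame g x y = # λ z → same x z ∧ g x y z

  -- An edge with one vertex of colour 𝟘 is charged to its pair of part vertices if these lie in
  -- different parts (𝔼), and to its two mixed pairs if they lie in one part (𝔽). With this charging
  -- each pair separately gets at most what it gets in the construction.
  𝔼 𝔽 𝕊 Ω : Graph3 n → ℕ
  𝔼 g = ∑₂ λ x y → ⟦ diff x y ⟧ * (dp g x y + 3 * dω g x y)
  𝕊 g = ∑₂ λ x y → ⟦ same x y ⟧ * dp g x y
  𝔽 g = ∑₂ λ x y → ⟦ pm x ∧ ωm y ⟧ * (dsame g x y + dω g x y)
  Ω g = weighted ωm ωm ωm g

  mask-split : ∀ v → (nb v ≡ pm v ∨ ωm v) × (pm v ∧ ωm v ≡ false)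
  mask-split v = step (κ v) (B v) refl refl
    where
    step : ∀ i b → κ v ≡ i → B v ≡ b → (not b ≡ (nz i ∧ not b) ∨ (i =ᴷ 𝟘)) × ((nz i ∧ not b) ∧ (i =ᴷ 𝟘) ≡ false)
    step 𝟘 true  e f = true≢false (bad⇒nz v f) (cong nz e)
    step 𝟘 false _ _ = refl , refl
    step 𝟙 true  _ _ = refl , refl
    step 𝟙 false _ _ = refl , refl
    step 𝟚 true  _ _ = refl , refl
    step 𝟚 false _ _ = refl , refl
    step 𝟛 true  _ _ = refl , refl
    step 𝟛 false _ _ = refl , refl

  ⟦nb⟧ : ∀ v c → ⟦ nb v ∧ c ⟧ ≡ ⟦ pm v ∧ c ⟧ + ⟦ ωm v ∧ c ⟧
  ⟦nb⟧ v c = trans (cong (λ m → ⟦ m ∧ c ⟧) (proj₁ (mask-split v))) (union (pm v) (ωm v) c (proj₂ (mask-split v)))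
    where
    union : ∀ a b c → a ∧ b ≡ false → ⟦ (a ∨ b) ∧ c ⟧ ≡ ⟦ a ∧ c ⟧ + ⟦ b ∧ c ⟧
    union true  false c _ = sym (+-identityʳ ⟦ c ⟧)
    union false b     c _ = refl

  module _ {g : Graph3 n} (G : Is3Graph g) where
    private
      W = weighted

      by-masks : nonbad g ≡ W pm pm pm g + 3 * W pm pm ωm g + 3 * W pm ωm ωm g + Ω g
      by-masks = begin
        nonbad g
          ≡⟨ ∑₃-cong expand ⟩
        ∑₃ (λ x y z → t pm pm pm x y z + t pm pm ωm x y z + (t pm ωm pm x y z + t pm ωm ωm x y z)
           + (t ωm pm pm x y z + t ωm pm ωm x y z + (t ωm ωm pm x y z + t ωm ωm ωm x y z)))
          ≡⟨ trans (∑₃-+ _ _) (cong₂ _+_ (four pm) (four ωm)) ⟩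
        W pm pm pm g + W pm pm ωm g + (W pm ωm pm g + W pm ωm ωm g)
          + (W ωm pm pm g + W ωm pm ωm g + (W ωm ωm pm g + W ωm ωm ωm g))
          ≡⟨ cong₂ (λ a b → W pm pm pm g + W pm pm ωm g + (a + W pm ωm ωm g) + b) (weighted-swap₂₃ G pm ωm pm)
               (cong₂ (λ a b → a + b) (cong₂ _+_ (weighted-rotate G ωm pm pm) (weighted-swap₁₂ G ωm pm ωm))
                 (cong (_+ Ω g) (trans (weighted-swap₂₃ G ωm ωm pm) (weighted-swap₁₂ G ωm pm ωm)))) ⟩
        W pm pm pm g + W pm pm ωm g + (W pm pm ωm g + W pm ωm ωm g) + (W pm pm ωm g + W pm ωm ωm g + (W pm ωm ωm g + Ω g))
          ≡⟨ ring (W pm pm pm g) (W pm pm ωm g) (W pm ωm ωm g) (Ω g) ⟩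
        W pm pm pm g + 3 * W pm pm ωm g + 3 * W pm ωm ωm g + Ω g ∎
        where
        open ≡-Reasoning
        ring : ∀ a b c d → a + b + (b + c) + (b + c + (c + d)) ≡ a + 3 * b + 3 * c + d
        ring = solve-∀
        t : (a b c : Fin n → Bool) → Fin n → Fin n → Fin n → ℕ
        t a b c x y z = ⟦ a x ∧ b y ∧ c z ∧ g x y z ⟧
        four : ∀ a → ∑₃ (λ x y z → t a pm pm x y z + t a pm ωm x y z + (t a ωm pm x y z + t a ωm ωm x y z))
             ≡ W a pm pm g + W a pm ωm g + (W a ωm pm g + W a ωm ωm g)
        four a = trans (∑₃-+ _ _) (cong₂ _+_ (∑₃-+ _ _) (∑₃-+ _ _))
        inner : ∀ a y z e → ⟦ a ∧ nb y ∧ nb z ∧ e ⟧ ≡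
          ⟦ a ∧ pm y ∧ pm z ∧ e ⟧ + ⟦ a ∧ pm y ∧ ωm z ∧ e ⟧ + (⟦ a ∧ ωm y ∧ pm z ∧ e ⟧ + ⟦ a ∧ ωm y ∧ ωm z ∧ e ⟧)
        inner false y z e = refl
        inner true  y z e = trans (⟦nb⟧ y (nb z ∧ e)) (cong₂ _+_ (deep (pm y)) (deep (ωm y)))
          where
          deep : ∀ b → ⟦ b ∧ nb z ∧ e ⟧ ≡ ⟦ b ∧ pm z ∧ e ⟧ + ⟦ b ∧ ωm z ∧ e ⟧
          deep false = refl
          deep true  = ⟦nb⟧ z e
        expand : ∀ x y z → ⟦ nb x ∧ nb y ∧ nb z ∧ g x y z ⟧ ≡ t pm pm pm x y z + t pm pm ωm x y z + (t pm ωm pm x y z + t pm ωm ωm x y z)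
           + (t ωm pm pm x y z + t ωm pm ωm x y z + (t ωm ωm pm x y z + t ωm ωm ωm x y z))
        expand x y z = trans (⟦nb⟧ x (nb y ∧ nb z ∧ g x y z))
          (cong₂ _+_ (inner (pm x) y z (g x y z)) (inner (ωm x) y z (g x y z)))

      factor : ∀ a b c → ⟦ a ∧ b ∧ c ⟧ ≡ ⟦ a ∧ b ⟧ * ⟦ c ⟧
      factor a b c = trans (cong ⟦_⟧ (sym (∧-assoc a b c))) (⟦⟧-∧ (a ∧ b) c)

      rows : ∀ a b c → W a b c g ≡ ∑₂ λ x y → ⟦ a x ∧ b y ⟧ * # (λ z → c z ∧ g x y z)
      rows a b c = ∑₂-cong λ x y → trans (∑-cong λ z → factor (a x) (b y) (c z ∧ g x y z)) (∑-*ˡ ⟦ a x ∧ b y ⟧ _)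

      by-colour : (f : Fin n → Fin n → ℕ) → ∑₂ (λ x y → ⟦ pm x ∧ pm y ⟧ * f x y)
                ≡ ∑₂ (λ x y → ⟦ same x y ⟧ * f x y) + ∑₂ (λ x y → ⟦ diff x y ⟧ * f x y)
      by-colour f = trans (∑₂-cong λ x y → trans (cong (_* f x y) (⟦⟧-split (pm x ∧ pm y) (κ x =ᴷ κ y))) (*-distribʳ-+ (f x y) ⟦ same x y ⟧ _))
        (∑₂-+ _ _)

      -- Exchanging the last two variables carries the count from a pair inside a part to the mixed
      -- pairs formed with the vertex of Q.
      move : ∑₂ (λ x y → ⟦ same x y ⟧ * dω g x y) ≡ ∑₂ (λ x y → ⟦ pm x ∧ ωm y ⟧ * dsame g x y)
      move = begin
        ∑₂ (λ x y → ⟦ same x y ⟧ * dω g x y)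
          ≡⟨ ∑₂-cong (λ x y → sym (∑-*ˡ ⟦ same x y ⟧ _)) ⟩
        ∑₃ (λ x y z → ⟦ same x y ⟧ * ⟦ ωm z ∧ g x y z ⟧)
          ≡⟨ ∑₃-swap₂₃ (λ x y z → ⟦ same x y ⟧ * ⟦ ωm z ∧ g x y z ⟧) ⟨
        ∑₃ (λ x y z → ⟦ same x z ⟧ * ⟦ ωm y ∧ g x z y ⟧)
          ≡⟨ ∑₃-cong (λ x y z → trans (cong (λ e → ⟦ same x z ⟧ * ⟦ ωm y ∧ e ⟧) (swap₂₃ G x z y))
               (regroup (pm x) (pm z) (κ x =ᴷ κ z) (ωm y) (g x y z))) ⟩
        ∑₃ (λ x y z → ⟦ pm x ∧ ωm y ⟧ * ⟦ same x z ∧ g x y z ⟧)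
          ≡⟨ ∑₂-cong (λ x y → ∑-*ˡ ⟦ pm x ∧ ωm y ⟧ _) ⟩
        ∑₂ (λ x y → ⟦ pm x ∧ ωm y ⟧ * dsame g x y) ∎
        where
        open ≡-Reasoning
        regroup : ∀ a b c d e → ⟦ (a ∧ b) ∧ c ⟧ * ⟦ d ∧ e ⟧ ≡ ⟦ a ∧ d ⟧ * ⟦ ((a ∧ b) ∧ c) ∧ e ⟧
        regroup false b     c     d     e = refl
        regroup true  false c     false e = refl
        regroup true  false c     true  e = refl
        regroup true  true  false false e = refl
        regroup true  true  false true  e = refl
        regroup true  true  true  false e = refl
        regroup true  true  true  true  e = refl

    decompose : nonbad g ≡ 𝔼 g + 𝕊 g + 3 * 𝔽 g + Ω g
    decompose = begin
      nonbad g
        ≡⟨ by-masks ⟩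
      W pm pm pm g + 3 * W pm pm ωm g + 3 * W pm ωm ωm g + Ω g
        ≡⟨ cong (_+ Ω g) (cong₂ _+_ (cong₂ (λ a b → a + 3 * b)
             (trans (rows pm pm pm) (by-colour (dp g))) (trans (rows pm pm ωm) (trans (by-colour (dω g)) (cong (_+ eω) move))))
             (cong (3 *_) (rows pm ωm ωm))) ⟩
      𝕊 g + ep + 3 * (f₁ + eω) + 3 * f₂ + Ω g
        ≡⟨ ring (𝕊 g) ep eω f₁ f₂ (Ω g) ⟩
      ep + 3 * eω + 𝕊 g + 3 * (f₁ + f₂) + Ω g
        ≡⟨ cong₂ (λ a b → a + 𝕊 g + 3 * b + Ω g) (sym 𝔼-split) (sym 𝔽-split) ⟩
      𝔼 g + 𝕊 g + 3 * 𝔽 g + Ω g ∎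
      where
      open ≡-Reasoning
      ep = ∑₂ λ x y → ⟦ diff x y ⟧ * dp g x y
      eω = ∑₂ λ x y → ⟦ diff x y ⟧ * dω g x y
      f₁ = ∑₂ λ x y → ⟦ pm x ∧ ωm y ⟧ * dsame g x y
      f₂ = ∑₂ λ x y → ⟦ pm x ∧ ωm y ⟧ * dω g x y
      ring : ∀ s p w a b o → s + p + 3 * (a + w) + 3 * b + o ≡ p + 3 * w + s + 3 * (a + b) + o
      ring = solve-∀
      𝔼-split : 𝔼 g ≡ ep + 3 * eω
      𝔼-split = trans (∑₂-cong λ x y → distrib ⟦ diff x y ⟧ (dp g x y) (dω g x y))
        (trans (∑₂-+ _ _) (cong (ep +_) (∑₂-*ˡ 3 _)))
        where
        distrib : ∀ a b c → a * (b + 3 * c) ≡ a * b + 3 * (a * c)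
        distrib = solve-∀
      𝔽-split : 𝔽 g ≡ f₁ + f₂
      𝔽-split = trans (∑₂-cong λ x y → *-distribˡ-+ ⟦ pm x ∧ ωm y ⟧ _ _) (∑₂-+ _ _)

    decompose-coarse : nonbad g ≡ 𝔼 g + 𝕊 g + 3 * ∑₂ (λ x y → ⟦ same x y ⟧ * dω g x y)
      + 3 * ∑₂ (λ x y → ⟦ pm x ∧ ωm y ⟧ * dω g x y) + Ω g
    decompose-coarse = trans decompose (trans (cong (λ f → 𝔼 g + 𝕊 g + 3 * f + Ω g) split)
        (ring (𝔼 g + 𝕊 g) (∑₂ λ x y → ⟦ same x y ⟧ * dω g x y) (∑₂ λ x y → ⟦ pm x ∧ ωm y ⟧ * dω g x y) (Ω g)))
      where
      ring : ∀ e a b o → e + 3 * (a + b) + o ≡ e + 3 * a + 3 * b + o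
      ring = solve-∀
      split : 𝔽 g ≡ ∑₂ (λ x y → ⟦ same x y ⟧ * dω g x y) + ∑₂ (λ x y → ⟦ pm x ∧ ωm y ⟧ * dω g x y)
      split = trans (∑₂-cong λ x y → *-distribˡ-+ ⟦ pm x ∧ ωm y ⟧ _ _) (trans (∑₂-+ _ _) (cong₂ _+_ (sym move) refl))

    size≤nonbad : size g ≤ nonbad g + 3 * ∑ (λ x → ⟦ B x ⟧ * degree g x)
    size≤nonbad = begin
      size g
        ≤⟨ ∑₃-mono (λ x y z → cover (B x) (B y) (B z) (g x y z)) ⟩
      ∑₃ (λ x y z → ⟦ nb x ∧ nb y ∧ nb z ∧ g x y z ⟧ + (⟦ B x ⟧ * ⟦ g x y z ⟧ + ⟦ B y ⟧ * ⟦ g x y z ⟧ + ⟦ B z ⟧ * ⟦ g x y z ⟧))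
        ≡⟨ trans (∑₃-+ _ _) (cong (nonbad g +_) (trans (∑₃-+ _ _) (cong₂ _+_ (trans (∑₃-+ _ _) (cong₂ _+_ in-x in-y)) in-z))) ⟩
      nonbad g + (D + D + D)
        ≡⟨ cong (nonbad g +_) (three D) ⟩
      nonbad g + 3 * D ∎
      where
      open ≤-Reasoning
      D = ∑ λ x → ⟦ B x ⟧ * degree g x
      three : ∀ a → a + a + a ≡ 3 * a
      three = solve-∀
      in-x : ∑₃ (λ x y z → ⟦ B x ⟧ * ⟦ g x y z ⟧) ≡ D
      in-x = ∑-cong λ x → ∑₂-*ˡ ⟦ B x ⟧ _
      in-y : ∑₃ (λ x y z → ⟦ B y ⟧ * ⟦ g x y z ⟧) ≡ D
      in-y = trans (∑₃-cong λ x y z → cong (λ e → ⟦ B y ⟧ * ⟦ e ⟧) (swap₁₂ G x y z))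
        (trans (∑₃-swap₁₂ (λ x y z → ⟦ B x ⟧ * ⟦ g x y z ⟧)) in-x)
      in-z : ∑₃ (λ x y z → ⟦ B z ⟧ * ⟦ g x y z ⟧) ≡ D
      in-z = trans (∑₃-cong λ x y z → cong (λ e → ⟦ B z ⟧ * ⟦ e ⟧) (swap₂₃ G x y z))
        (trans (∑₃-swap₂₃ (λ x y z → ⟦ B y ⟧ * ⟦ g x y z ⟧)) in-y)
      cover : ∀ a b c e → ⟦ e ⟧ ≤ ⟦ not a ∧ not b ∧ not c ∧ e ⟧ + (⟦ a ⟧ * ⟦ e ⟧ + ⟦ b ⟧ * ⟦ e ⟧ + ⟦ c ⟧ * ⟦ e ⟧)
      cover a     b     c     false = z≤n
      cover true  b     c     true  = s≤s z≤n
      cover false true  c     true  = s≤s z≤n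
      cover false false true  true  = s≤s z≤n
      cover false false false true  = s≤s z≤n

    -- Requiring the other two vertices not to be bad makes the three positions of the bad vertex
    -- disjoint cases, so nothing is counted twice.
    nonbad≤size : nonbad g + 3 * ∑ (λ x → ⟦ B x ⟧ * #₂ (λ y z → nb y ∧ nb z ∧ g x y z)) ≤ size g
    nonbad≤size = begin
      nonbad g + 3 * D
        ≡⟨ cong (nonbad g +_) (sym (three D)) ⟩
      nonbad g + (D + D + D)
        ≡⟨ trans (∑₃-+ _ _) (cong (nonbad g +_) (trans (∑₃-+ _ _) (cong₂ _+_ (trans (∑₃-+ _ _) (cong₂ _+_ in-x in-y)) in-z))) ⟨
      ∑₃ (λ x y z → ⟦ nb x ∧ nb y ∧ nb z ∧ g x y z ⟧ + (⟦ B x ⟧ * ⟦ nb y ∧ nb z ∧ g x y z ⟧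
          + ⟦ B y ⟧ * ⟦ nb x ∧ nb z ∧ g x y z ⟧ + ⟦ B z ⟧ * ⟦ nb x ∧ nb y ∧ g x y z ⟧))
        ≤⟨ ∑₃-mono (λ x y z → disjoint (B x) (B y) (B z) (g x y z)) ⟩
      size g ∎
      where
      open ≤-Reasoning
      D = ∑ λ x → ⟦ B x ⟧ * #₂ (λ y z → nb y ∧ nb z ∧ g x y z)
      three : ∀ a → a + a + a ≡ 3 * a
      three = solve-∀
      in-x : ∑₃ (λ x y z → ⟦ B x ⟧ * ⟦ nb y ∧ nb z ∧ g x y z ⟧) ≡ D
      in-x = ∑-cong λ x → ∑₂-*ˡ ⟦ B x ⟧ _
      in-y : ∑₃ (λ x y z → ⟦ B y ⟧ * ⟦ nb x ∧ nb z ∧ g x y z ⟧) ≡ D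
      in-y = trans (∑₃-cong λ x y z → cong (λ e → ⟦ B y ⟧ * ⟦ nb x ∧ nb z ∧ e ⟧) (swap₁₂ G x y z))
        (trans (∑₃-swap₁₂ (λ x y z → ⟦ B x ⟧ * ⟦ nb y ∧ nb z ∧ g x y z ⟧)) in-x)
      in-z : ∑₃ (λ x y z → ⟦ B z ⟧ * ⟦ nb x ∧ nb y ∧ g x y z ⟧) ≡ D
      in-z = trans (∑₃-cong λ x y z → cong (λ e → ⟦ B z ⟧ * ⟦ nb x ∧ nb y ∧ e ⟧) (swap₂₃ G x y z))
        (trans (∑₃-swap₂₃ (λ x y z → ⟦ B y ⟧ * ⟦ nb x ∧ nb z ∧ g x y z ⟧)) in-y)
      disjoint : ∀ a b c e → ⟦ not a ∧ not b ∧ not c ∧ e ⟧ + (⟦ a ⟧ * ⟦ not b ∧ not c ∧ e ⟧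
        + ⟦ b ⟧ * ⟦ not a ∧ not c ∧ e ⟧ + ⟦ c ⟧ * ⟦ not a ∧ not b ∧ e ⟧) ≤ ⟦ e ⟧
      disjoint true  true  true  e = z≤n
      disjoint true  true  false e = z≤n
      disjoint true  false true  e = z≤n
      disjoint true  false false true  = ≤-refl
      disjoint true  false false false = z≤n
      disjoint false true  true  e = z≤n
      disjoint false true  false true  = ≤-refl
      disjoint false true  false false = z≤n
      disjoint false false true  true  = ≤-refl
      disjoint false false true  false = z≤n
      disjoint false false false true  = ≤-refl
      disjoint false false false false = z≤n

rainbow⇒klein : (κ : Fin n → K) {x y z : Fin n} → κ x ≢ 𝟘 → κ y ≢ 𝟘 → κ x ≢ κ y → κ z ≡ κ x ⊕ κ y →
                klein κ x y z ≡ true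
rainbow⇒klein κ {x} {y} {z} x≢𝟘 y≢𝟘 x≢y e = ∧-true
  (∧-true (≢⇒≠ {x = x} {y} λ { refl → x≢y refl })
    (∧-true (≢⇒≠ {x = y} {z} λ { refl → ⊕-≢ˡ (κ y) (κ x) x≢𝟘 (trans (⊕-comm (κ y) (κ x)) (sym e)) })
            (≢⇒≠ {x = x} {z} λ { refl → ⊕-≢ˡ (κ x) (κ y) y≢𝟘 (sym e) })))
  (trans (cong (_=ᴷ κ x ⊕ κ y) e) (=ᴷ-refl (κ x ⊕ κ y)))

edge⇒klein : {h : Graph3 n} → Is3Graph h → (κ : Fin n → K) {x y z : Fin n} → h x y z ≡ true →
             κ z ≡ κ x ⊕ κ y → klein κ x y z ≡ true
edge⇒klein H κ {x} {y} {z} e s = ∧-true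
  (∧-true (≢⇒≠ (edge⇒≢₁₂ H e)) (∧-true (≢⇒≠ (edge⇒≢₂₃ H e)) (≢⇒≠ (edge⇒≢₁₃ H e))))
  (trans (cong (_=ᴷ κ x ⊕ κ y) s) (=ᴷ-refl (κ x ⊕ κ y)))

∑₂-tight : {f g : Fin n → Fin n → ℕ} → (∀ x y → f x y ≤ g x y) → ∑₂ g ≤ ∑₂ f → ∀ x y → f x y ≡ g x y
∑₂-tight f≤g ge x = ∑-tight (f≤g x) (≤-reflexive (sym (∑-tight (λ x → ∑-mono (f≤g x)) ge x)))

∑₃-tight : {f g : Fin n → Fin n → Fin n → ℕ} → (∀ x y z → f x y z ≤ g x y z) → ∑₃ g ≤ ∑₃ f →
           ∀ x y z → f x y z ≡ g x y z
∑₃-tight f≤g ge x = ∑₂-tight (f≤g x) (≤-reflexive (sym (∑-tight (λ x → ∑₂-mono (f≤g x)) ge x)))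

#-tight : {p q : Fin n → Bool} → (∀ i → p i ≡ true → q i ≡ true) → # q ≤ # p → ∀ i → q i ≡ true → p i ≡ true
#-tight f ge i e = ⟦⟧-pos (≤-trans (≤-reflexive (cong ⟦_⟧ (sym e)))
  (≤-reflexive (sym (∑-tight (λ i → ⟦⟧-mono (f i)) ge i))))

module Compare {t : ℕ} {h : Graph3 n} (H : Is3Graph h) (κ : Fin n → K) (B : Fin n → Bool)
  (bad⇒nz : ∀ v → B v ≡ true → nz (κ v) ≡ true) where
  open Decompose κ B bad⇒nz

  -- In `3 * t + 2` the term 3 t is what `crowd` allows to a pair with a neighbour in Q. One unit
  -- pays for x itself in `dsame-k`; one makes the comparison strict, so that in the case of
  -- equality no such pair exists.
  record Structured : Set where
    field
      parts : ∀ {x y z} → pm x ≡ true → pm y ≡ true → pm z ≡ true → h x y z ≡ true → κ x ≢ κ y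
      lightLink : ∀ {x p q} → κ x ≡ 𝟘 → h x p q ≡ true → codeg h p q ≤ t
      big   : ∀ {i} → i ≢ 𝟘 → 3 * t + 2 ≤ # (λ z → pm z ∧ (κ z =ᴷ i))

  module _ (S : Structured) where
    open Structured S

    k : Graph3 n
    k = klein κ

    private
      k-is3 : Is3Graph k
      k-is3 = klein-3graph κ

      pm⇒≢𝟘 : ∀ {x} → pm x ≡ true → κ x ≢ 𝟘
      pm⇒≢𝟘 e = nz⇒≢𝟘 (∧-trueˡ e)

      ωm⇒≡𝟘 : ∀ {x} → ωm x ≡ true → κ x ≡ 𝟘
      ωm⇒≡𝟘 {x} = =ᴷ⇒≡ (κ x) 𝟘

      diff⇒ : ∀ x y → diff x y ≡ true → pm x ≡ true × pm y ≡ true × κ x ≢ κ y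
      diff⇒ x y e = ∧-trueˡ (∧-trueˡ e) , ∧-trueʳ {pm x} (∧-trueˡ e)
        , λ eq → true≢false (trans (cong (κ x =ᴷ_) (sym eq)) (=ᴷ-refl (κ x))) (not-true (∧-trueʳ {pm x ∧ pm y} e))

      same⇒ : ∀ x y → same x y ≡ true → pm x ≡ true × pm y ≡ true × κ x ≡ κ y
      same⇒ x y e = ∧-trueˡ (∧-trueˡ e) , ∧-trueʳ {pm x} (∧-trueˡ e) , =ᴷ⇒≡ (κ x) (κ y) (∧-trueʳ {pm x ∧ pm y} e)

      light-pair : ∀ x y → 0 < dω h x y → codeg h x y ≤ t
      light-pair x y pos =
        let z , e = #-witness (λ z → ωm z ∧ h x y z) pos
        in  lightLink (ωm⇒≡𝟘 (∧-trueˡ e)) (trans (rotate H z x y) (∧-trueʳ {ωm z} e))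

      -- A neighbour of colour 𝟘 bounds the whole codegree of xy by t.
      crowd : ∀ x y (p : Fin n → Bool) → (∀ z → p z ≡ true → pm z ≡ true) → 0 < dω h x y →
              # (λ z → p z ∧ h x y z) + 3 * dω h x y ≤ 3 * t
      crowd x y p p⊆pm pos = begin
        a + 3 * w                ≤⟨ m≤m+n _ (2 * a) ⟩
        a + 3 * w + 2 * a        ≡⟨ ring a w ⟩
        3 * (a + w)              ≤⟨ *-monoʳ-≤ 3 (≤-trans (≤-trans (≤-reflexive (sym (∑-+ _ _)))
                                      (∑-mono λ z → disjoint (p z) (ωm z) (h x y z) (excl z))) (light-pair x y pos)) ⟩
        3 * t                    ∎
        where
        open ≤-Reasoning
        a = # (λ z → p z ∧ h x y z)
        w = dω h x y
        ring : ∀ a w → a + 3 * w + 2 * a ≡ 3 * (a + w)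
        ring = solve-∀
        excl : ∀ z → p z ≡ true → ωm z ≡ false
        excl z e = trans (cong (_∧ ωm z) (sym (p⊆pm z e))) (proj₂ (mask-split z))
        disjoint : ∀ a b c → (a ≡ true → b ≡ false) → ⟦ a ∧ c ⟧ + ⟦ b ∧ c ⟧ ≤ ⟦ c ⟧
        disjoint false true  c f = ≤-refl
        disjoint false false c f = z≤n
        disjoint true  b     c f rewrite f refl = ≤-reflexive (+-identityʳ ⟦ c ⟧)

      dp-k : ∀ x y → diff x y ≡ true → 3 * t + 2 ≤ dp k x y
      dp-k x y e = ≤-trans (big (⊕-≢𝟘 (κ x) (κ y) ne)) (#-mono λ z f → ∧-true {pm z} (∧-trueˡ f)
        (rainbow⇒klein κ (pm⇒≢𝟘 ex) (pm⇒≢𝟘 ey) ne (=ᴷ⇒≡ (κ z) _ (∧-trueʳ {pm z} f))))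
        where
        ex = proj₁ (diff⇒ x y e)
        ey = proj₁ (proj₂ (diff⇒ x y e))
        ne = proj₂ (proj₂ (diff⇒ x y e))

      dp-⊆ : ∀ x y → diff x y ≡ true → ∀ z → pm z ∧ h x y z ≡ true → pm z ∧ k x y z ≡ true
      dp-⊆ x y e z f = ∧-true pz (edge⇒klein H κ f′ (third-colour (κ x) (κ y) (κ z) (pm⇒≢𝟘 px) (pm⇒≢𝟘 py) (pm⇒≢𝟘 pz) ne
          (parts py pz px (trans (sym (rotate H x y z)) f′)) (parts px pz py (trans (sym (swap₂₃ H x y z)) f′))))
        where
        px = proj₁ (diff⇒ x y e)
        py = proj₁ (proj₂ (diff⇒ x y e))
        ne = proj₂ (proj₂ (diff⇒ x y e))
        pz : pm z ≡ true
        pz = ∧-trueˡ f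
        f′ = ∧-trueʳ {pm z} f

      zero⇒ : ∀ {a} → ¬ 0 < a → a ≡ 0
      zero⇒ ¬pos = n≤0⇒n≡0 (≮⇒≥ ¬pos)

      -- With a neighbour in Q the pair has codegree at most t, and even the triple weight stays
      -- below the size of the third part. Without one, all counted neighbours lie in the third
      -- part.
      𝔼-bound : ∀ x y → diff x y ≡ true → dp h x y + 3 * dω h x y ≤ dp k x y
      𝔼-bound x y e = step (0 <? dω h x y)
        where
        step : Dec (0 < dω h x y) → _
        step (yes pos) = ≤-trans (crowd x y pm (λ _ → id) pos) (≤-trans (m≤m+n (3 * t) 2) (dp-k x y e))
        step (no ¬pos) = ≤-trans (≤-reflexive (trans (cong (λ w → dp h x y + 3 * w) (zero⇒ ¬pos)) (+-identityʳ _)))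
          (#-mono (dp-⊆ x y e))

      𝔼-tight : ∀ x y → diff x y ≡ true → dp k x y ≤ dp h x y + 3 * dω h x y →
                ∀ z → pm z ≡ true → k x y z ≡ true → h x y z ≡ true
      𝔼-tight x y e ge z pz kz = step (0 <? dω h x y)
        where
        step : Dec (0 < dω h x y) → _
        step (yes pos) = contradiction (≤-trans (m<m+n (3 * t) (s≤s z≤n)) (≤-trans (dp-k x y e) (≤-trans ge (crowd x y pm (λ _ → id) pos))))
          (<-irrefl refl)
        step (no ¬pos) = ∧-trueʳ {pm z} (#-tight (dp-⊆ x y e)
          (≤-trans ge (≤-reflexive (trans (cong (λ w → dp h x y + 3 * w) (zero⇒ ¬pos)) (+-identityʳ _)))) z (∧-true pz kz))

      sum-𝟘 : ∀ {i y} → ωm y ≡ true → i ⊕ κ y ≡ i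
      sum-𝟘 {i} ey = trans (cong (i ⊕_) (ωm⇒≡𝟘 ey)) (⊕-identityʳ i)

      dsame-k : ∀ x y → pm x ≡ true → ωm y ≡ true → 3 * t < dsame k x y
      dsame-k x y px ey = ≤-pred (≤-trans (≤-reflexive (+-comm 2 (3 * t))) (≤-trans (big (pm⇒≢𝟘 px))
        (≤-trans (#-remove (λ z → pm z ∧ (κ z =ᴷ κ x)) x) (s≤s (#-mono incl)))))
        where
        incl : ∀ z → (pm z ∧ (κ z =ᴷ κ x)) ∧ (z ≠ x) ≡ true → same x z ∧ k x y z ≡ true
        incl z f = ∧-true (∧-true (∧-true px pz) (trans (cong (κ x =ᴷ_) eq) (=ᴷ-refl (κ x))))
          (∧-true (∧-true (≢⇒≠ {x = x} {y} λ { refl → pm⇒≢𝟘 px (ωm⇒≡𝟘 ey) })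
            (∧-true (≢⇒≠ {x = y} {z} λ { refl → pm⇒≢𝟘 pz (ωm⇒≡𝟘 ey) }) (≢⇒≠ {x = x} {z} λ x≡z → ≠⇒≢ {x = z} {x} (∧-trueʳ {pm z ∧ (κ z =ᴷ κ x)} f) (sym x≡z))))
            (trans (cong₂ _=ᴷ_ eq (sum-𝟘 {κ x} {y} ey)) (=ᴷ-refl (κ x))))
          where
          pz : pm z ≡ true
          pz = ∧-trueˡ {pm z} (∧-trueˡ f)
          eq = =ᴷ⇒≡ (κ z) (κ x) (∧-trueʳ {pm z} (∧-trueˡ f))

      dsame-⊆ : ∀ x y → ωm y ≡ true → ∀ z → same x z ∧ h x y z ≡ true → same x z ∧ k x y z ≡ true
      dsame-⊆ x y ey z f = ∧-true sz (edge⇒klein H κ (∧-trueʳ {same x z} f)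
        (trans (sym (proj₂ (proj₂ (same⇒ x z sz)))) (sym (sum-𝟘 {κ x} {y} ey))))
        where
        sz : same x z ≡ true
        sz = ∧-trueˡ f

      3t-bound : ∀ x y → pm x ≡ true → 0 < dω h x y → dsame h x y + dω h x y ≤ 3 * t
      3t-bound x y px pos = ≤-trans (+-monoʳ-≤ (dsame h x y) (m≤m+n (dω h x y) _))
        (crowd x y (same x) (λ z f → proj₁ (proj₂ (same⇒ x z f))) pos)

      𝔽-bound : ∀ x y → pm x ≡ true → ωm y ≡ true → dsame h x y + dω h x y ≤ dsame k x y
      𝔽-bound x y px ey = step (0 <? dω h x y)
        where
        step : Dec (0 < dω h x y) → _
        step (yes pos) = ≤-trans (3t-bound x y px pos) (<⇒≤ (dsame-k x y px ey))
        step (no ¬pos) = ≤-trans (≤-reflexive (trans (cong (dsame h x y +_) (zero⇒ ¬pos)) (+-identityʳ _)))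
          (#-mono (dsame-⊆ x y ey))

      𝔽-tight : ∀ x y → pm x ≡ true → ωm y ≡ true → dsame k x y ≤ dsame h x y + dω h x y →
                ∀ z → same x z ≡ true → k x y z ≡ true → h x y z ≡ true
      𝔽-tight x y px ey ge z sz kz = step (0 <? dω h x y)
        where
        step : Dec (0 < dω h x y) → _
        step (yes pos) = contradiction (≤-trans (dsame-k x y px ey) (≤-trans ge (3t-bound x y px pos))) (<-irrefl refl)
        step (no ¬pos) = ∧-trueʳ {same x z} (#-tight (dsame-⊆ x y ey)
          (≤-trans ge (≤-reflexive (trans (cong (dsame h x y +_) (zero⇒ ¬pos)) (+-identityʳ _)))) z (∧-true sz kz))

      masked : ∀ b {a c} → (b ≡ true → a ≤ c) → ⟦ b ⟧ * a ≤ ⟦ b ⟧ * c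
      masked false f = z≤n
      masked true  f = *-monoʳ-≤ 1 (f refl)

      unmask : ∀ b {a c} → b ≡ true → ⟦ b ⟧ * a ≡ ⟦ b ⟧ * c → a ≡ c
      unmask true {a} {c} refl e = trans (sym (*-identityˡ a)) (trans e (*-identityˡ c))

      Ω-⊆ : ∀ x y z → ωm x ∧ ωm y ∧ ωm z ∧ h x y z ≡ true → ωm x ∧ ωm y ∧ ωm z ∧ k x y z ≡ true
      Ω-⊆ x y z e = ∧-true ex (∧-true ey (∧-true ez (edge⇒klein H κ (∧-trueʳ {ωm z} (∧-trueʳ {ωm y} (∧-trueʳ {ωm x} e)))
        (trans (ωm⇒≡𝟘 ez) (sym (trans (sum-𝟘 {κ x} {y} ey) (ωm⇒≡𝟘 ex)))))))
        where
        ex : ωm x ≡ true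
        ex = ∧-trueˡ e
        ey : ωm y ≡ true
        ey = ∧-trueˡ (∧-trueʳ {ωm x} e)
        ez : ωm z ≡ true
        ez = ∧-trueˡ (∧-trueʳ {ωm y} (∧-trueʳ {ωm x} e))

      E-pt : ∀ x y → ⟦ diff x y ⟧ * (dp h x y + 3 * dω h x y) ≤ ⟦ diff x y ⟧ * (dp k x y + 3 * dω k x y)
      E-pt x y = masked (diff x y) λ e → ≤-trans (𝔼-bound x y e) (m≤m+n _ _)

      F-pt : ∀ x y → ⟦ pm x ∧ ωm y ⟧ * (dsame h x y + dω h x y) ≤ ⟦ pm x ∧ ωm y ⟧ * (dsame k x y + dω k x y)
      F-pt x y = masked (pm x ∧ ωm y) λ e → ≤-trans (𝔽-bound x y (∧-trueˡ e) (∧-trueʳ {pm x} e)) (m≤m+n _ _)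

      Ω-pt : ∀ x y z → ⟦ ωm x ∧ ωm y ∧ ωm z ∧ h x y z ⟧ ≤ ⟦ ωm x ∧ ωm y ∧ ωm z ∧ k x y z ⟧
      Ω-pt x y z = ⟦⟧-mono (Ω-⊆ x y z)

      𝕊-h : 𝕊 h ≡ 0
      𝕊-h = ∑-zero _ λ x → ∑-zero _ λ y → step x y (same x y) refl
        where
        step : ∀ x y b → same x y ≡ b → ⟦ b ⟧ * dp h x y ≡ 0
        step x y false e = refl
        step x y true  e = trans (*-identityˡ (dp h x y)) (∑-zero _ λ z → cong ⟦_⟧ (¬-not λ f →
          parts (proj₁ (same⇒ x y e)) (proj₁ (proj₂ (same⇒ x y e))) (∧-trueˡ f) (∧-trueʳ {pm z} f) (proj₂ (proj₂ (same⇒ x y e)))))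

    nonbad-≤ : nonbad h ≤ nonbad k
    nonbad-≤ = begin
      nonbad h                        ≡⟨ decompose H ⟩
      𝔼 h + 𝕊 h + 3 * 𝔽 h + Ω h       ≤⟨ +-mono-≤ (+-mono-≤ (+-mono-≤ (∑₂-mono E-pt) (≤-trans (≤-reflexive 𝕊-h) z≤n)) (*-monoʳ-≤ 3 (∑₂-mono F-pt))) (∑₃-mono Ω-pt) ⟩
      𝔼 k + 𝕊 k + 3 * 𝔽 k + Ω k       ≡⟨ decompose k-is3 ⟨
      nonbad k                        ∎
      where open ≤-Reasoning

    -- The triples of the construction that avoid Q; bad vertices are included, in the parts
    -- assigned to them. It replaces the full construction when Q may be too large.
    rainbowGraph : Graph3 n
    rainbowGraph x y z = (nz (κ x) ∧ nz (κ y) ∧ nz (κ z)) ∧ k x y z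

    rainbow-3graph : Is3Graph rainbowGraph
    rainbow-3graph .swap₁₂ x y z = cong₂ _∧_ (trans (sym (∧-assoc (nz (κ x)) _ _)) (trans (cong (_∧ nz (κ z)) (∧-comm (nz (κ x)) _)) (∧-assoc (nz (κ y)) _ _)))
      (swap₁₂ k-is3 x y z)
    rainbow-3graph .swap₂₃ x y z = cong₂ _∧_ (cong (nz (κ x) ∧_) (∧-comm (nz (κ y)) _)) (swap₂₃ k-is3 x y z)
    rainbow-3graph .loopless x z = trans (cong ((nz (κ x) ∧ nz (κ x) ∧ nz (κ z)) ∧_) (loopless k-is3 x z)) (∧-zeroʳ _)

    rainbow-size : size rainbowGraph ≤ 6 * (class κ 𝟙 * class κ 𝟚 * class κ 𝟛)
    rainbow-size = begin
      size rainbowGraph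
        ≤⟨ ∑₃-mono (λ x y z → pointwise (nz (κ x)) (nz (κ y)) (nz (κ z)) ((x ≠ y) ∧ (y ≠ z) ∧ (x ≠ z)) (κ z =ᴷ κ x ⊕ κ y)) ⟩
      ∑₃ (λ x y z → ⟦ nz (κ x) ⟧ * ⟦ cross κ (κ x) y z ⟧)
        ≡⟨ ∑-cong (λ x → ∑₂-*ˡ ⟦ nz (κ x) ⟧ _) ⟩
      ∑ (λ x → ⟦ nz (κ x) ⟧ * pairs κ (κ x))
        ≡⟨ ∑-cong (λ x → trans (cong (⟦ nz (κ x) ⟧ *_) (pairs-split κ k x)) (*-distribˡ-+ ⟦ nz (κ x) ⟧ _ _)) ⟩
      ∑ (λ x → ⟦ nz (κ x) ⟧ * degIn κ k (κ x) x + ⟦ nz (κ x) ⟧ * missing κ k x)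
        ≡⟨ trans (∑-+ _ _) (rainbow+missing κ k) ⟩
      6 * (class κ 𝟙 * class κ 𝟚 * class κ 𝟛) ∎
      where
      open ≤-Reasoning
      pointwise : ∀ a b c d e → ⟦ (a ∧ b ∧ c) ∧ d ∧ e ⟧ ≤ ⟦ a ⟧ * ⟦ (b ∧ c) ∧ e ⟧
      pointwise false b     c     d     e = z≤n
      pointwise true  false c     d     e = z≤n
      pointwise true  true  false d     e = z≤n
      pointwise true  true  true  false e = z≤n
      pointwise true  true  true  true  e = ≤-reflexive (sym (+-identityʳ _))

    innerPairs : ℕ
    innerPairs = ∑₂ λ x y → ⟦ same x y ∧ (x ≠ y) ⟧

    innerPairs-bound : innerPairs + total (class κ) ≤ square-sum (class κ)
    innerPairs-bound = begin
      innerPairs + total (class κ)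
        ≡⟨ cong (innerPairs +_) (sym diagonal) ⟩
      innerPairs + ∑₂ (λ x y → ⟦ y == x ⟧ * ⟦ nz (κ x) ⟧)
        ≡⟨ ∑₂-+ _ _ ⟨
      ∑₂ (λ x y → ⟦ same x y ∧ (x ≠ y) ⟧ + ⟦ y == x ⟧ * ⟦ nz (κ x) ⟧)
        ≤⟨ ∑₂-mono pointwise ⟩
      ∑₂ (λ x y → ⟦ nz (κ x) ⟧ * ⟦ κ y =ᴷ κ x ⟧)
        ≡⟨ ∑-cong (λ x → ∑-*ˡ ⟦ nz (κ x) ⟧ _) ⟩
      ∑ (λ x → ⟦ nz (κ x) ⟧ * class κ (κ x))
        ≡⟨ sum-class κ (λ i → ⟦ nz i ⟧ * class κ i) ⟩
      class κ 𝟘 * 0 + (class κ 𝟙 * (1 * class κ 𝟙) + (class κ 𝟚 * (1 * class κ 𝟚) + class κ 𝟛 * (1 * class κ 𝟛)))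
        ≡⟨ ring (class κ 𝟘) (class κ 𝟙) (class κ 𝟚) (class κ 𝟛) ⟩
      square-sum (class κ) ∎
      where
      open ≤-Reasoning
      ring : ∀ w a b c → w * 0 + (a * (1 * a) + (b * (1 * b) + c * (1 * c))) ≡ a * a + b * b + c * c
      ring = solve-∀
      ring′ : ∀ w a b c → w * 0 + (a * 1 + (b * 1 + c * 1)) ≡ a + b + c
      ring′ = solve-∀
      diagonal : ∑₂ (λ x y → ⟦ y == x ⟧ * ⟦ nz (κ x) ⟧) ≡ total (class κ)
      diagonal = trans (∑-cong λ x → trans (∑-*ʳ ⟦ nz (κ x) ⟧ _) (trans (cong (_* ⟦ nz (κ x) ⟧) (#-== x)) (*-identityˡ _)))
        (trans (sum-class κ (λ i → ⟦ nz i ⟧)) (ring′ (class κ 𝟘) (class κ 𝟙) (class κ 𝟚) (class κ 𝟛)))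
      pointwise : ∀ x y → ⟦ same x y ∧ (x ≠ y) ⟧ + ⟦ y == x ⟧ * ⟦ nz (κ x) ⟧ ≤ ⟦ nz (κ x) ⟧ * ⟦ κ y =ᴷ κ x ⟧
      pointwise x y = step (x Fin.≟ y)
        where
        step : Dec (x ≡ y) → ⟦ same x y ∧ (x ≠ y) ⟧ + ⟦ y == x ⟧ * ⟦ nz (κ x) ⟧ ≤ ⟦ nz (κ x) ⟧ * ⟦ κ y =ᴷ κ x ⟧
        step (yes refl) rewrite ==-refl x | ∧-zeroʳ (same x x) | =ᴷ-refl (κ x) = ≤-reflexive (*-comm 1 ⟦ nz (κ x) ⟧)
        step (no ne) rewrite not-true (≢⇒≠ {x = y} {x} (λ e → ne (sym e))) = ≤-trans (≤-reflexive (+-identityʳ _))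
          (≤-trans (⟦⟧-mono {same x y ∧ (x ≠ y)} {nz (κ x) ∧ (κ y =ᴷ κ x)} λ e → ∧-true (∧-trueˡ (proj₁ (same⇒ x y (∧-trueˡ e))))
            (trans (cong (_=ᴷ κ x) (sym (proj₂ (proj₂ (same⇒ x y (∧-trueˡ e)))))) (=ᴷ-refl (κ x))))
            (≤-reflexive (⟦⟧-∧ (nz (κ x)) (κ y =ᴷ κ x))))

    -- Light links give every pair inside a part at most t neighbours in Q, however large Q is.
    -- Edges with two or three vertices in Q are bounded crudely by 3 n w² and n w², whence the 4.
    nonbad-coarse : nonbad h ≤ nonbad rainbowGraph + 3 * (t * innerPairs) + 4 * (n * (class κ 𝟘 * class κ 𝟘))
    nonbad-coarse = begin
      nonbad h
        ≡⟨ decompose-coarse H ⟩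
      𝔼 h + 𝕊 h + 3 * ∑₂ (λ x y → ⟦ same x y ⟧ * dω h x y) + 3 * ∑₂ (λ x y → ⟦ pm x ∧ ωm y ⟧ * dω h x y) + Ω h
        ≤⟨ +-mono-≤ (+-mono-≤ (+-mono-≤ (+-mono-≤ crossing (≤-reflexive 𝕊-h)) (*-monoʳ-≤ 3 inner)) (*-monoʳ-≤ 3 two)) three ⟩
      nonbad rainbowGraph + 0 + 3 * (t * innerPairs) + 3 * (n * (w * w)) + n * (w * w)
        ≡⟨ ring (nonbad rainbowGraph) (t * innerPairs) (n * (w * w)) ⟩
      nonbad rainbowGraph + 3 * (t * innerPairs) + 4 * (n * (w * w)) ∎
      where
      open ≤-Reasoning
      w = class κ 𝟘
      ring : ∀ a b c → a + 0 + 3 * b + 3 * c + c ≡ a + 3 * b + 4 * c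
      ring = solve-∀
      rainbow-edge : ∀ x y z → ⟦ diff x y ⟧ * ⟦ pm z ∧ k x y z ⟧ ≤ ⟦ nb x ∧ nb y ∧ nb z ∧ rainbowGraph x y z ⟧
      rainbow-edge x y z = pointwise (nz (κ x)) (nz (κ y)) (nz (κ z)) (nb x) (nb y) (nb z) (not (κ x =ᴷ κ y)) (k x y z)
        where
        pointwise : ∀ a b c p q r d e → ⟦ ((a ∧ p) ∧ (b ∧ q)) ∧ d ⟧ * ⟦ (c ∧ r) ∧ e ⟧ ≤ ⟦ p ∧ q ∧ r ∧ (a ∧ b ∧ c) ∧ e ⟧
        pointwise false b     c     p     q     r     d     e = z≤n
        pointwise true  b     c     false q     r     d     e = z≤n
        pointwise true  false c     true  q     r     d     e = z≤n
        pointwise true  true  c     true  false r     d     e = z≤n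
        pointwise true  true  c     true  true  r     false e = z≤n
        pointwise true  true  false true  true  r     true  e = z≤n
        pointwise true  true  true  true  true  false true  e = z≤n
        pointwise true  true  true  true  true  true  true  e = ≤-reflexive (+-identityʳ _)
      crossing : 𝔼 h ≤ nonbad rainbowGraph
      crossing = ∑₂-mono λ x y → ≤-trans (masked (diff x y) (𝔼-bound x y))
        (≤-trans (≤-reflexive (sym (∑-*ˡ ⟦ diff x y ⟧ _))) (∑-mono (rainbow-edge x y)))
      inner : ∑₂ (λ x y → ⟦ same x y ⟧ * dω h x y) ≤ t * innerPairs
      inner = ≤-trans (∑₂-mono λ x y → step x y (0 <? dω h x y)) (≤-reflexive (∑₂-*ˡ t _))
        where
        step : ∀ x y → Dec (0 < dω h x y) → ⟦ same x y ⟧ * dω h x y ≤ t * ⟦ same x y ∧ (x ≠ y) ⟧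
        step x y (no ¬pos) = ≤-trans (≤-reflexive (trans (cong (⟦ same x y ⟧ *_) (zero⇒ ¬pos)) (*-zeroʳ ⟦ same x y ⟧))) z≤n
        step x y (yes pos) = ≤-trans (*-monoʳ-≤ ⟦ same x y ⟧ (≤-trans (#-mono λ z f → ∧-trueʳ {ωm z} f) (light-pair x y pos)))
          (≤-reflexive (trans (*-comm ⟦ same x y ⟧ t) (cong (λ b → t * ⟦ b ⟧) (trans (sym (∧-identityʳ _)) (cong (same x y ∧_) (sym x≠y))))))
          where
          x≠y : (x ≠ y) ≡ true
          x≠y = ≢⇒≠ (edge⇒≢₁₂ H (∧-trueʳ {ωm (proj₁ (#-witness _ pos))} (proj₂ (#-witness _ pos))))
      pairs-of-W : ∑₃ (λ (x y z : Fin n) → ⟦ ωm y ⟧ * ⟦ ωm z ⟧) ≡ n * (w * w)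
      pairs-of-W = trans (∑-const n _) (cong (n *_) (∑∑-product (λ y → ⟦ ωm y ⟧) (λ z → ⟦ ωm z ⟧)))
      two : ∑₂ (λ x y → ⟦ pm x ∧ ωm y ⟧ * dω h x y) ≤ n * (w * w)
      two = ≤-trans (∑₂-mono λ x y → ≤-trans (≤-reflexive (sym (∑-*ˡ ⟦ pm x ∧ ωm y ⟧ _)))
          (∑-mono λ z → *-mono-≤ (⟦⟧-mono (∧-trueʳ {pm x})) (⟦⟧-mono {ωm z ∧ h x y z} ∧-trueˡ)))
        (≤-reflexive pairs-of-W)
      three : Ω h ≤ n * (w * w)
      three = ≤-trans (∑₃-mono λ x y z → pointwise (ωm x) (ωm y) (ωm z) (h x y z)) (≤-reflexive pairs-of-W)
        where
        pointwise : ∀ a b c e → ⟦ a ∧ b ∧ c ∧ e ⟧ ≤ ⟦ b ⟧ * ⟦ c ⟧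
        pointwise false b     c     e = z≤n
        pointwise true  false c     e = z≤n
        pointwise true  true  false e = z≤n
        pointwise true  true  true  e = ⟦⟧-≤1 e

    -- Each of the four terms of the decomposition is bounded by its counterpart, pair by pair, so
    -- equal totals force equality at every pair. There the strict margin excludes neighbours in Q
    -- that the construction does not have, and all edges of the construction must be present.
    module Tight (ge : nonbad k ≤ nonbad h) (no-bad : ∀ v → B v ≡ false) where
      private
        sums : 𝔼 k + 𝕊 k + 3 * 𝔽 k + Ω k ≤ 𝔼 h + 𝕊 h + 3 * 𝔽 h + Ω h
        sums = ≤-trans (≤-reflexive (sym (decompose k-is3))) (≤-trans ge (≤-reflexive (decompose H)))

        squeeze : ∀ {e s f o e′ s′ f′ o′} → e ≤ e′ → s ≤ s′ → f ≤ f′ → o ≤ o′ → e′ + s′ + 3 * f′ + o′ ≤ e + s + 3 * f + o →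
                  e′ ≤ e × f′ ≤ f × o′ ≤ o
        squeeze {e} {s} {f} {o} {e′} {s′} {f′} {o′} a b c d g =
            lin 0 (+-mono-≤ (+-mono-≤ (+-mono-≤ g b) (*-monoʳ-≤ 3 c)) d) (r₁ e s f o e′ s′ f′ o′)
          , *-cancelˡ-≤ 3 (lin 0 (+-mono-≤ (+-mono-≤ (+-mono-≤ g a) b) d) (r₂ e s f o e′ s′ f′ o′))
          , lin 0 (+-mono-≤ (+-mono-≤ (+-mono-≤ g a) b) (*-monoʳ-≤ 3 c)) (r₃ e s f o e′ s′ f′ o′)
          where
          r₁ : ∀ e s f o e′ s′ f′ o′ → e′ + (e + s + 3 * f + o + s′ + 3 * f′ + o′) + 0 ≡ e + (e′ + s′ + 3 * f′ + o′ + s + 3 * f + o)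
          r₁ = solve-∀
          r₂ : ∀ e s f o e′ s′ f′ o′ → 3 * f′ + (e + s + 3 * f + o + e′ + s′ + o′) + 0 ≡ 3 * f + (e′ + s′ + 3 * f′ + o′ + e + s + o)
          r₂ = solve-∀
          r₃ : ∀ e s f o e′ s′ f′ o′ → o′ + (e + s + 3 * f + o + e′ + s′ + 3 * f′) + 0 ≡ o + (e′ + s′ + 3 * f′ + o′ + e + s + 3 * f)
          r₃ = solve-∀

        tight = squeeze (∑₂-mono E-pt) (≤-trans (≤-reflexive 𝕊-h) z≤n) (∑₂-mono F-pt) (∑₃-mono Ω-pt) sums

        E-eq = ∑₂-tight E-pt (proj₁ tight)
        F-eq = ∑₂-tight F-pt (proj₁ (proj₂ tight))
        Ω-eq = ∑₃-tight Ω-pt (proj₂ (proj₂ tight))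

        pm-of : ∀ {v} → κ v ≢ 𝟘 → pm v ≡ true
        pm-of {v} ne = ∧-true (≢𝟘⇒nz ne) (cong not (no-bad v))

        ωm-of : ∀ {v} → κ v ≡ 𝟘 → ωm v ≡ true
        ωm-of e = cong (_=ᴷ 𝟘) e

        two-parts : ∀ {x y z} → κ x ≢ 𝟘 → κ y ≡ 𝟘 → κ z ≡ κ x → k x y z ≡ true → h x y z ≡ true
        two-parts {x} {y} {z} x≢𝟘 y≡𝟘 eq kz = 𝔽-tight x y px ey
          (≤-trans (m≤m+n _ (dω k x y)) (≤-reflexive (sym (unmask (pm x ∧ ωm y) (∧-true px ey) (F-eq x y))))) z
          (∧-true (∧-true px (pm-of (subst (_≢ 𝟘) (sym eq) x≢𝟘))) (trans (cong (κ x =ᴷ_) eq) (=ᴷ-refl (κ x)))) kz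
          where
          px = pm-of x≢𝟘
          ey = ωm-of y≡𝟘

      klein⊆ : ∀ x y z → k x y z ≡ true → h x y z ≡ true
      klein⊆ x y z kz = step (κ x ≟ᴷ 𝟘) (κ y ≟ᴷ 𝟘) (κ x ≟ᴷ κ y)
        where
        s : κ z ≡ κ x ⊕ κ y
        s = klein-colour κ x y z kz
        step : Dec (κ x ≡ 𝟘) → Dec (κ y ≡ 𝟘) → Dec (κ x ≡ κ y) → h x y z ≡ true
        step (yes x≡𝟘) (yes y≡𝟘) _ = ∧-trueʳ {ωm z} (∧-trueʳ {ωm y} (∧-trueʳ {ωm x} (⟦⟧-pos (≤-trans
          (≤-reflexive (cong ⟦_⟧ (sym (∧-true (ωm-of x≡𝟘) (∧-true (ωm-of y≡𝟘) (∧-true (ωm-of (trans s (cong₂ _⊕_ x≡𝟘 y≡𝟘))) kz))))))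
          (≤-reflexive (sym (Ω-eq x y z)))))))
        step (yes x≡𝟘) (no y≢𝟘) _ = trans (swap₁₂ H x y z) (two-parts y≢𝟘 x≡𝟘 (trans s (cong (_⊕ κ y) x≡𝟘)) (trans (swap₁₂ k-is3 y x z) kz))
        step (no x≢𝟘) (yes y≡𝟘) _ = two-parts x≢𝟘 y≡𝟘 (trans s (trans (cong (κ x ⊕_) y≡𝟘) (⊕-identityʳ (κ x)))) kz
        step (no x≢𝟘) (no y≢𝟘) (yes eq) = trans (swap₂₃ H x y z)
          (two-parts x≢𝟘 (trans s (trans (cong (κ x ⊕_) (sym eq)) (⊕-self (κ x)))) (sym eq) (trans (swap₂₃ k-is3 x z y) kz))
        step (no x≢𝟘) (no y≢𝟘) (no ne) = 𝔼-tight x y dxy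
          (≤-trans (m≤m+n _ (3 * dω k x y)) (≤-reflexive (sym (unmask (diff x y) dxy (E-eq x y))))) z
          (pm-of (subst (_≢ 𝟘) (sym s) (⊕-≢𝟘 (κ x) (κ y) ne))) kz
          where
          dxy : diff x y ≡ true
          dxy = ∧-true (∧-true (pm-of x≢𝟘) (pm-of y≢𝟘)) (≢⇒not-=ᴷ ne)

module Typed {t : ℕ} {h : Graph3 n} (H : Is3Graph h) (free : Free t h) (u : ℕ)
  (t≤u : 2 * t + 10 ≤ u) (u≤n : 9000 * u ≤ n) (the-core : Core u h) where

  private
    module Kern = Core the-core
    open Classify H free u t≤u u≤n the-core using (classify; no-good-pair)

  colour : Fin n → K
  colour v = Classified.colour (classify v)

  badly : Fin n → Bool
  badly v = Classified.isBad (classify v)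

  private
    verdict : ∀ v → Verdict t u h Kern.κ v (colour v) (badly v)
    verdict v = Classified.verdict (classify v)

    extends : ∀ v → Kern.κ v ≢ 𝟘 → colour v ≡ Kern.κ v × badly v ≡ false
    extends v = Classified.extends (classify v)

    GoodAt : Fin n → K → Set
    GoodAt v i = Supported t h v × pairs Kern.κ i ≤ degIn Kern.κ h i v + 8 * u * n

    verdict-bad : ∀ {v i b} → Verdict t u h Kern.κ v i b → b ≡ true →
                  i ≢ 𝟘 × degree h v + 6 * u * n ≤ pairs Kern.κ i
    verdict-bad (bad ne d) _ = ne , d

    verdict-good : ∀ {v i b} → Verdict t u h Kern.κ v i b → i ≢ 𝟘 → b ≡ false → GoodAt v i
    verdict-good (good _ s g) _  _ = s , g
    verdict-good (light _ _)  ne _ = contradiction refl ne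

    verdict-light : ∀ {v i b} → Verdict t u h Kern.κ v i b → i ≡ 𝟘 →
                    (∀ p q → h v p q ≡ true → codeg h p q ≤ t) × Kern.κ v ≡ 𝟘
    verdict-light (good ne _ _) e = contradiction e ne
    verdict-light (bad ne _)    e = contradiction e ne
    verdict-light (light l z)   _ = l , z

  bad⇒nz : ∀ v → badly v ≡ true → nz (colour v) ≡ true
  bad⇒nz v e = ≢𝟘⇒nz (proj₁ (verdict-bad (verdict v) e))

  open Decompose colour badly bad⇒nz
  open Compare {t = t} H colour badly bad⇒nz

  private
    pm-good : ∀ v → pm v ≡ true → GoodAt v (colour v)
    pm-good v e = verdict-good (verdict v) (nz⇒≢𝟘 (∧-trueˡ e)) (not-true (∧-trueʳ {nz (colour v)} e))

    kern-pm : ∀ v → Kern.κ v ≢ 𝟘 → pm v ≡ true × colour v ≡ Kern.κ v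
    kern-pm v ne = ∧-true (≢𝟘⇒nz (subst (_≢ 𝟘) (sym (proj₁ (extends v ne))) ne)) (cong not (proj₂ (extends v ne)))
                 , proj₁ (extends v ne)

    large-class : ∀ {i} → i ≢ 𝟘 → class Kern.κ i ≤ # (λ z → pm z ∧ (colour z =ᴷ i))
    large-class {i} ne = #-mono λ v e →
      let κ≡ = =ᴷ⇒≡ (Kern.κ v) i e
          p , c = kern-pm v (subst (_≢ 𝟘) (sym κ≡) ne)
      in  ∧-true {pm v} p (trans (cong (_=ᴷ i) (trans c κ≡)) (=ᴷ-refl i))

    room : ∀ a → n ≤ 8 * a → 3 * t + 2 ≤ a
    room a le = *-cancelˡ-≤ 8 (lin (8988 * u + 104) (+-mono-≤ (+-mono-≤ (*-monoʳ-≤ 12 t≤u) u≤n) le) (ring t u n a))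
      where
      ring : ∀ t u n a → 8 * (3 * t + 2) + (12 * u + n + 8 * a) + (8988 * u + 104) ≡ 8 * a + (12 * (2 * t + 10) + 9000 * u + n)
      ring = solve-∀

  class-large : ∀ {i} → i ≢ 𝟘 → n ≤ 8 * class colour i
  class-large ne = ≤-trans (Kern.large ne) (*-monoʳ-≤ 8 (≤-trans (large-class ne) (#-mono λ v e → ∧-trueʳ {pm v} e)))

  class-few : class colour 𝟘 ≤ u
  class-few = ≤-trans (#-mono λ v e →
    trans (cong (_=ᴷ 𝟘) (proj₂ (verdict-light (verdict v) (=ᴷ⇒≡ (colour v) 𝟘 e)))) refl) Kern.few

  structured : Structured
  structured = record
    { parts = λ {x} {y} {z} px py pz e eq → no-good-pair (nz⇒≢𝟘 (∧-trueˡ px)) (proj₁ (pm-good z pz))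
        (proj₂ (pm-good x px)) (subst (λ i → pairs Kern.κ i ≤ degIn Kern.κ h i y + 8 * u * n) (sym eq) (proj₂ (pm-good y py))) e
    ; lightLink = λ {x} {p} {q} e → proj₁ (verdict-light (verdict x) e) p q
    ; big = λ ne → ≤-trans (room _ (Kern.large ne)) (large-class ne) }

  private
    ideal = klein colour
    rg = rainbowGraph structured

    -- Core vertices keep their colour and are never bad, so every core pair across the two parts
    -- other than that of `x` forms a rainbow triple with `x`.
    bad-degree : ∀ x → badly x ≡ true → degree h x + 6 * u * n ≤ #₂ (λ y z → nb y ∧ nb z ∧ rg x y z)
    bad-degree x e = ≤-trans (proj₂ (verdict-bad (verdict x) e)) (∑₂-mono λ y z → ⟦⟧-mono (incl y z))
      where
      x≢𝟘 = proj₁ (verdict-bad (verdict x) e)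
      incl : ∀ y z → cross Kern.κ (colour x) y z ≡ true → nb y ∧ nb z ∧ rg x y z ≡ true
      incl y z f =
        let y≢𝟘 , z≢𝟘 , s = cross-colours Kern.κ (colour x) y z f
            py , cy = kern-pm y y≢𝟘
            pz , cz = kern-pm z z≢𝟘
            y≢ = subst (_≢ 𝟘) (sym cy) y≢𝟘
            s′ = trans cz (trans s (cong (colour x ⊕_) (sym cy)))
            x≢y = λ eq → z≢𝟘 (trans s (trans (cong (_⊕ Kern.κ y) (trans eq cy)) (⊕-self (Kern.κ y))))
        in  ∧-true {nb y} (∧-trueʳ {nz (colour y)} py) (∧-true {nb z} (∧-trueʳ {nz (colour z)} pz)
              (∧-true (∧-true (≢𝟘⇒nz x≢𝟘) (∧-true (≢𝟘⇒nz y≢) (∧-trueˡ pz))) (rainbow⇒klein colour x≢𝟘 y≢ x≢y s′)))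

    D Dʳ : ℕ
    D  = ∑ λ x → ⟦ badly x ⟧ * degree h x
    Dʳ = ∑ λ x → ⟦ badly x ⟧ * #₂ (λ y z → nb y ∧ nb z ∧ rg x y z)

    bad-total : D + 6 * u * n * # badly ≤ Dʳ
    bad-total = ≤-trans (≤-reflexive (sym (trans (∑-+ _ _) (cong (D +_) (∑-*ˡ (6 * u * n) _))))) (∑-mono λ x → row x (badly x) refl)
      where
      row : ∀ x b → badly x ≡ b → ⟦ b ⟧ * degree h x + 6 * u * n * ⟦ b ⟧ ≤ ⟦ b ⟧ * #₂ (λ y z → nb y ∧ nb z ∧ rg x y z)
      row x false e = ≤-reflexive (*-zeroʳ (6 * u * n))
      row x true  e = ≤-trans (≤-reflexive (cong₂ _+_ (*-identityˡ (degree h x)) (*-identityʳ (6 * u * n))))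
        (≤-trans (bad-degree x e) (≤-reflexive (sym (*-identityˡ _))))

  -- Edges at bad vertices are overcounted for `h` and undercounted for the construction, yet each
  -- bad vertex still loses 6 u n, in each of three positions.
  size-fine : size h + 18 * u * n * # badly ≤ size ideal
  size-fine = lin 0 (+-mono-≤ (+-mono-≤ (+-mono-≤ (+-mono-≤ (size≤nonbad H) (nonbad-≤ structured)) (*-monoʳ-≤ 3 bad-total)) (*-monoʳ-≤ 3 Dʳ≤))
      (nonbad≤size (klein-3graph colour))) (ring (size h) (size ideal) (nonbad h) (nonbad ideal) D Dʳ Dᵏ u n (# badly))
    where
    Dᵏ = ∑ λ x → ⟦ badly x ⟧ * #₂ (λ y z → nb y ∧ nb z ∧ ideal x y z)
    Dʳ≤ : Dʳ ≤ Dᵏ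
    Dʳ≤ = ∑-mono λ x → *-monoʳ-≤ ⟦ badly x ⟧ (∑₂-mono λ y z → ⟦⟧-mono λ e →
      ∧-true {nb y} (∧-trueˡ e) (∧-true {nb z} (∧-trueˡ (∧-trueʳ {nb y} e))
        (∧-trueʳ {nz (colour x) ∧ nz (colour y) ∧ nz (colour z)} (∧-trueʳ {nb z} (∧-trueʳ {nb y} e)))))
    ring : ∀ sh sk nh nk d dr dk u n b → sh + 18 * u * n * b + (nh + 3 * d + nk + 3 * dr + 3 * dk + sk) + 0
         ≡ sk + (sh + nh + 3 * (d + 6 * u * n * b) + 3 * dr + (nk + 3 * dk))
    ring = solve-∀

  -- The main terms carry the factor t although Q has w vertices, so an excess of Q enters only
  -- through the error 4 n w².
  size-coarse : size h + 3 * (t * total (class colour)) ≤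
    6 * (class colour 𝟙 * class colour 𝟚 * class colour 𝟛) + 3 * (t * square-sum (class colour))
      + 4 * (n * (class colour 𝟘 * class colour 𝟘))
  size-coarse = lin 0 (+-mono-≤ (+-mono-≤ (+-mono-≤ (+-mono-≤ (+-mono-≤ (size≤nonbad H) (nonbad-coarse structured))
      (*-monoʳ-≤ 3 (≤-trans (m≤m+n D _) bad-total))) (nonbad≤size (rainbow-3graph structured))) (rainbow-size structured))
      (*-monoʳ-≤ (3 * t) (innerPairs-bound structured)))
    (ring (size h) (nonbad h) (nonbad rg) (size rg) D Dʳ t (innerPairs structured) (total (class colour)) (square-sum (class colour))
      (n * (class colour 𝟘 * class colour 𝟘)) (6 * (class colour 𝟙 * class colour 𝟚 * class colour 𝟛)))
    where
    ring : ∀ sh nh nr sr d dr t i tot sq w m → sh + 3 * (t * tot) + (nh + 3 * d + (nr + 3 * (t * i) + 4 * w) + 3 * dr + sr + m + 3 * t * sq) + 0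
         ≡ m + 3 * (t * sq) + 4 * w + (sh + nh + 3 * d + (nr + 3 * dr) + sr + 3 * t * (i + tot))
    ring = solve-∀

  -- By `size-fine` there is no room for a bad vertex. Then the construction is contained in `h`,
  -- and having at least as many edges it equals `h`.
  extremal⇒klein : 1 ≤ u → 1 ≤ n → size ideal ≤ size h → ∀ x y z → h x y z ≡ ideal x y z
  extremal⇒klein 1≤u 1≤n ge = λ x y z → sym (bool (∑₃-tight (λ x y z → ⟦⟧-mono (klein⊆ x y z)) (≤-trans (m≤m+n (size h) _) size-fine) x y z))
    where
    none : # badly ≡ 0
    none = n≤0⇒n≡0 (≮⇒≥ λ pos → <-irrefl refl (≤-trans (m<m+n (size h) (*-mono-≤ {1} {18 * u * n} (*-mono-≤ {1} {18 * u} (*-mono-≤ {1} {18} (s≤s z≤n) 1≤u) 1≤n) pos))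
      (≤-trans size-fine ge)))
    no-bad : ∀ v → badly v ≡ false
    no-bad v = ¬-not λ e → <-irrefl (sym none) (≤-trans (≤-reflexive (cong ⟦_⟧ (sym e))) (≤∑ (λ v → ⟦ badly v ⟧) v))
    D≡0 : D ≡ 0
    D≡0 = ∑-zero _ λ v → cong (λ b → ⟦ b ⟧ * degree h v) (no-bad v)
    nonbad-ge : nonbad ideal ≤ nonbad h
    nonbad-ge = ≤-trans (m≤m+n (nonbad ideal) _) (≤-trans (nonbad≤size (klein-3graph colour)) (≤-trans ge
      (≤-trans (size≤nonbad H) (≤-reflexive (trans (cong (λ d → nonbad h + 3 * d) D≡0) (+-identityʳ _))))))
    open Tight structured nonbad-ge no-bad
    bool : ∀ {a b} → ⟦ a ⟧ ≡ ⟦ b ⟧ → a ≡ b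
    bool {true}  {true}  _ = refl
    bool {false} {false} _ = refl

-- The size of Q

C3-mono : ∀ {m n} → m ≤ n → m C 3 ≤ n C 3
C3-mono {m} m≤n with m≤n⇒∃[o]m+o≡n m≤n
... | o , refl = go o
  where
  go : ∀ o → m C 3 ≤ (m + o) C 3
  go zero    = ≤-reflexive (cong (_C 3) (sym (+-identityʳ m)))
  go (suc o) = ≤-trans (go o) (≤-trans (m≤n+m _ ((m + o) C 2))
    (≤-reflexive (trans (nCk+nC[k+1]≡[n+1]C[k+1] (m + o) 2) (cong (_C 3) (sym (+-suc m o))))))

-- Moving s vertices from a part to Q, when Q has s vertices too few.
refill-Q : ∀ w s a b c → 1 ≤ s → 3 * (w + s) + 10 ≤ a → a + b + c ≤ 9 * a →
           objective w (a + s) b c < objective (w + s) a b c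
refill-Q w s a b c 1≤s a-large n≤9a = *-cancelˡ-< 2 _ _ (+-cancelʳ-< (w * (a + s + b + c) + (w + s) * (a + b + c)) _ _
  (subst₂ _<_ (assemble (objective-Φ w (a + s) b c) (swap (2 * objective w (a + s) b c) (w * (a + s + b + c)) ((w + s) * (a + b + c))))
    (assemble (objective-Φ (w + s) a b c) (swap′ (2 * objective (w + s) a b c) ((w + s) * (a + b + c)) (w * (a + s + b + c)))) gain))
  where
  assemble : ∀ {x y p q} → x ≡ y → x + p ≡ q → y + p ≡ q
  assemble refl e = e
  swap : ∀ o p q → o + p + q ≡ o + (p + q)
  swap = +-assoc
  swap′ : ∀ o p q → o + p + q ≡ o + (q + p)
  swap′ o p q = trans (+-assoc o p q) (cong (o +_) (+-comm p q))
  ws≤ : w * s ≤ a * (w + s)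
  ws≤ = *-mono-≤ (≤-trans (m≤m+n w s) (≤-trans (m≤m+n (w + s) _) (≤-trans (m≤m+n _ 10) a-large))) (m≤n+m s w)
  -- The larger Q gains s (a² + b² + c²). The lost transversal triples cost 2 s b c, which b² + c²
  -- covers, and s a² pays for the rest.
  gain : Φ w (a + s) b c + (w + s) * (a + b + c) < Φ (w + s) a b c + w * (a + s + b + c)
  gain = lin (a * s * s + a * s * s + w * s)
    (+-mono-≤ (+-mono-≤ (+-mono-≤ (+-mono-≤ (*-monoʳ-≤ s (2ab≤a²+b² b c)) (*-monoʳ-≤ (s * a) a-large)) (*-monoʳ-≤ s n≤9a)) (*-monoʳ-≤ s ws≤))
      (*-mono-≤ 1≤s (≤-trans (s≤s z≤n) (≤-trans (m≤n+m 10 (3 * (w + s))) a-large))))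
    (ring w s a b c)
    where
    ring : ∀ w s a b c →
      suc (2 * ((a + s) * b * c) + w * ((a + s) * (a + s) + b * b + c * c) + (w + s) * (a + b + c))
        + (s * (b * b + c * c) + s * a * a + s * (9 * a) + s * (a * (w + s)) + s * a) + (a * s * s + a * s * s + w * s)
      ≡ 2 * (a * b * c) + (w + s) * (a * a + b * b + c * c) + w * (a + s + b + c)
        + (s * (2 * (b * c)) + s * a * (3 * (w + s) + 10) + s * (a + b + c) + s * (w * s) + 1 * 1)
    ring = solve-∀

-- Moving s vertices from Q to a part, when Q has s vertices too many.
empty-Q : ∀ t s a b c n u T → 1 ≤ s → 1 ≤ u → 9000 * (t + 1) * u ≤ n → t + s ≤ u → n ≤ 8 * b → n ≤ 8 * c →
  T + 3 * (t * (a + b + c)) ≤ 6 * (a * b * c) + 3 * (t * (a * a + b * b + c * c)) + 4 * (n * ((t + s) * (t + s))) →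
  ¬ 6 * objective t (a + s) b c ≤ T
empty-Q t s a b c n u T 1≤s 1≤u n≥ w≤u b≥ c≥ upper lower = <-irrefl refl (begin-strict
  448 * X                 <⟨ *-monoˡ-< X {{>-nonZero X>0}} (s≤s (m≤m+n 448 53551)) ⟩
  54000 * X               ≡⟨ ring₁ 9000 s n (t + 1) u ⟩
  6 * (s * n) * (9000 * (t + 1) * u) ≤⟨ *-monoʳ-≤ (6 * (s * n)) n≥ ⟩
  6 * (s * n) * n         ≡⟨ ring₂ s n ⟩
  6 * s * (n * n)         ≤⟨ *-monoʳ-≤ (6 * s) (*-mono-≤ b≥ c≥) ⟩
  6 * s * (8 * b * (8 * c)) ≡⟨ ring₃ s b c ⟩
  64 * (6 * (s * (b * c))) ≤⟨ *-monoʳ-≤ 64 loss ⟩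
  64 * (4 * (n * ((t + s) * (t + s))) + 3 * (t * s)) ≤⟨ *-monoʳ-≤ 64 (+-mono-≤ (*-monoʳ-≤ 4 (*-monoʳ-≤ n (*-mono-≤ w≤u w≤))) (*-monoʳ-≤ 3 ts≤)) ⟩
  64 * (4 * (n * (u * ((t + 1) * s))) + 3 * X) ≡⟨ ring₄ s n t u ⟩
  448 * X                 ∎)
  where
  open ≤-Reasoning
  X = s * (n * ((t + 1) * u))
  1≤t+1 : 1 ≤ t + 1
  1≤t+1 = m≤n+m 1 t
  1≤n : 1 ≤ n
  1≤n = ≤-trans (*-mono-≤ {1} {9000 * (t + 1)} (*-mono-≤ {1} {9000} (s≤s z≤n) 1≤t+1) 1≤u) n≥
  X>0 : 0 < X
  X>0 = *-mono-≤ {1} {s} 1≤s (*-mono-≤ {1} {n} 1≤n (*-mono-≤ {1} {t + 1} 1≤t+1 1≤u))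
  w≤ : t + s ≤ (t + 1) * s
  w≤ = ≤-trans (+-monoˡ-≤ s (≤-trans (≤-reflexive (sym (*-identityʳ t))) (*-monoʳ-≤ t 1≤s))) (≤-reflexive (e t s))
    where
    e : ∀ t s → t * s + s ≡ (t + 1) * s
    e = solve-∀
  ts≤ : t * s ≤ X
  ts≤ = ≤-trans (*-monoˡ-≤ s (≤-trans (m≤m+n t 1) (≤-trans (≤-reflexive (sym (trans (*-identityˡ _) (*-identityʳ (t + 1))))) (*-mono-≤ {1} {n} 1≤n (*-monoʳ-≤ (t + 1) 1≤u)))))
    (≤-reflexive (*-comm (n * ((t + 1) * u)) s))
  ring₁ : ∀ p s n t u → 6 * p * (s * (n * (t * u))) ≡ 6 * (s * n) * (p * t * u)
  ring₁ = solve-∀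
  ring₂ : ∀ s n → 6 * (s * n) * n ≡ 6 * s * (n * n)
  ring₂ = solve-∀
  ring₃ : ∀ s b c → 6 * s * (8 * b * (8 * c)) ≡ 64 * (6 * (s * (b * c)))
  ring₃ = solve-∀
  ring₄ : ∀ s n t u → 64 * (4 * (n * (u * ((t + 1) * s))) + 3 * (s * (n * ((t + 1) * u)))) ≡ 448 * (s * (n * ((t + 1) * u)))
  ring₄ = solve-∀
  -- Putting the s surplus vertices into a part would create s b c transversal triples, a quadratic
  -- number in n. If the graph is at least that large, these must be paid from error terms that are
  -- only linear in n times u.
  loss : 6 * (s * (b * c)) ≤ 4 * (n * ((t + s) * (t + s))) + 3 * (t * s)
  loss = lin (3 * t * (2 * a * s + s * s)) (+-mono-≤ (+-mono-≤ upper lower) (≤-reflexive (cong (3 *_) (sym (objective-Φ t (a + s) b c)))))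
    (ring t s a b c (n * ((t + s) * (t + s))) T (objective t (a + s) b c))
    where
    ring : ∀ t s a b c w T o →
      6 * (s * (b * c)) + (6 * (a * b * c) + 3 * (t * (a * a + b * b + c * c)) + 4 * w + T + 3 * (2 * o + t * (a + s + b + c))) + 3 * t * (2 * a * s + s * s)
      ≡ 4 * w + 3 * (t * s) + (T + 3 * (t * (a + b + c)) + 6 * o + 3 * (2 * ((a + s) * b * c) + t * ((a + s) * (a + s) + b * b + c * c)))
    ring = solve-∀

-- Constants and the scale u

ratio : ℕ → ℕ
ratio t = 9000 * (t + 1)

-- The first term is the deficit of the construction from `dense`, the second the cost of cleaning.
coefficient : ℕ → ℕ
coefficient t = 6 * (t + 2) + 54 * (t + 6)

errorBound : ℕ → ℕ
errorBound t = 9 * (2 * ratio t * (2 * ratio t) * (2 * ratio t) * coefficient t)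

unitBound : ℕ → ℕ
unitBound t = errorBound t + (2 * t + 10)

threshold : ℕ → ℕ
threshold t = unitBound t * ratio t

-- The factor 9000 serves the classification of vertices, and the factor t + 1 in `ratio` the
-- exclusion of a surplus in Q by `empty-Q`. With `u` the quotient of n by `ratio t`, n is at most
-- twice their product, so M = 2 `ratio t` in the construction of the core.
record Scale (t n : ℕ) : Set where
  field
    u    : ℕ
    t≤u  : 2 * t + 10 ≤ u
    big  : errorBound t ≤ u
    u≤n  : ratio t * u ≤ n
    n≤u  : n ≤ 2 * ratio t * u

  1≤u : 1 ≤ u
  1≤u = ≤-trans (s≤s z≤n) (≤-trans (m≤n+m 10 (2 * t)) t≤u)

  9000u≤n : 9000 * u ≤ n
  9000u≤n = ≤-trans (*-monoˡ-≤ u (≤-trans (≤-reflexive (sym (*-identityʳ 9000))) (*-monoʳ-≤ 9000 (m≤n+m 1 t)))) u≤n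

  9000t≤n : 9000 * (t + 1) ≤ n
  9000t≤n = ≤-trans (≤-reflexive (sym (*-identityʳ (ratio t)))) (≤-trans (*-monoʳ-≤ (ratio t) 1≤u) u≤n)

  1≤n : 1 ≤ n
  1≤n = ≤-trans 1≤u (≤-trans (m≤m+n u _) 9000u≤n)

  t≤n : t ≤ n
  t≤n = ≤-trans (≤-trans (m≤m+n t 1) (m≤m+n (t + 1) _)) 9000t≤n

scale : ∀ t n → threshold t ≤ n → Scale t n
scale t n N≤n = record
  { u = n / c
  ; t≤u = ≤-trans (m≤n+m (2 * t + 10) (errorBound t)) U≤u
  ; big = ≤-trans (m≤m+n (errorBound t) (2 * t + 10)) U≤u
  ; u≤n = ≤-trans (≤-reflexive (*-comm c (n / c))) (m/n*n≤m n c)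
  ; n≤u = begin
      n                        ≡⟨ m≡m%n+[m/n]*n n c ⟩
      n % c + (n / c) * c      ≤⟨ +-monoˡ-≤ ((n / c) * c) (≤-trans (<⇒≤ (m%n<n n c)) (≤-trans (≤-reflexive (sym (*-identityˡ c))) (*-monoˡ-≤ c 1≤u))) ⟩
      (n / c) * c + (n / c) * c ≡⟨ ring (n / c) c ⟩
      2 * c * (n / c)          ∎ }
  where
  open ≤-Reasoning
  c = ratio t
  instance
    c≢0 : NonZero c
    c≢0 = >-nonZero (*-mono-≤ {1} {9000} (s≤s z≤n) (m≤n+m 1 t))
  U≤u : unitBound t ≤ n / c
  U≤u = ≤-trans (≤-reflexive (sym (m*n/n≡m (unitBound t) c))) (/-monoˡ-≤ c N≤n)
  1≤u : 1 ≤ n / c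
  1≤u = ≤-trans (≤-trans (s≤s z≤n) (≤-trans (m≤n+m 10 (2 * t)) (m≤n+m (2 * t + 10) (errorBound t)))) U≤u
  ring : ∀ u c → u * c + u * c ≡ 2 * c * u
  ring = solve-∀

largeThird : ∀ {t n} → 1 ≤ t → Scale t n → LargeThird t (n ∸ t)
largeThird {t} {n} 1≤t sc = record
  { k = (n ∸ t) / 3 ; s = (n ∸ t) % 3 ; 1≤t = 1≤t
  ; large = ≤-trans (≤-reflexive (sym (m*n/n≡m (12 * t) 3))) (/-monoˡ-≤ 3 (+-cancelʳ-≤ t _ _ (≤-trans 37t≤n (≤-reflexive (sym (m∸n+n≡m (Scale.t≤n sc)))))))
  ; s≤2 = ≤-pred (m%n<n (n ∸ t) 3)
  ; split = trans (+-comm _ ((n ∸ t) % 3)) (trans (cong ((n ∸ t) % 3 +_) (*-comm 3 ((n ∸ t) / 3))) (sym (m≡m%n+[m/n]*n (n ∸ t) 3))) }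
  where
  37t≤n : 12 * t * 3 + t ≤ n
  37t≤n = ≤-trans (m≤m+n _ (8963 * t + 9000)) (≤-trans (≤-reflexive (ring t)) (Scale.9000t≤n sc))
    where
    ring : ∀ t → 12 * t * 3 + t + (8963 * t + 9000) ≡ 9000 * (t + 1)
    ring = solve-∀

-- The triple `middle` already yields 6 k³ ordered edges, and n = 3 k + e with e ≤ t + 2. Expanding,
-- 2 n³ is at most 54 k³ + 6 e n².
dense : ∀ {t n T} → (L : LargeThird t (n ∸ t)) → t ≤ n → 6 * exValue n t ≤ T →
        2 * (n * n * n) ≤ 9 * T + 6 * (t + 2) * (n * n)
dense {t} {n} {T} L t≤n lower = subst (λ n → 2 * (n * n * n) ≤ 9 * T + 6 * (t + 2) * (n * n)) n≡ (begin
  2 * (m * m * m)                                   ≤⟨ m≤m+n _ (18 * (k * (e * e)) + 4 * (e * e * e)) ⟩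
  2 * (m * m * m) + (18 * (k * (e * e)) + 4 * (e * e * e)) ≡⟨ ring k e ⟩
  9 * (6 * (k * k * k)) + 6 * e * (m * m)           ≤⟨ +-mono-≤ (*-monoʳ-≤ 9 k³≤) (*-monoˡ-≤ (m * m) (*-monoʳ-≤ 6 (+-monoʳ-≤ t s≤2))) ⟩
  9 * T + 6 * (t + 2) * (m * m)                     ∎)
  where
  open ≤-Reasoning
  open LargeThird L
  e = t + s
  m = 3 * k + e
  n≡ : m ≡ n
  n≡ = trans (shuffle (3 * k) t s) (trans (cong (_+ t) split) (m∸n+n≡m t≤n))
    where
    shuffle : ∀ a t s → a + (t + s) ≡ a + s + t
    shuffle = solve-∀
  ring : ∀ k e → 2 * ((3 * k + e) * (3 * k + e) * (3 * k + e)) + (18 * (k * (e * e)) + 4 * (e * e * e))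
       ≡ 9 * (6 * (k * k * k)) + 6 * e * ((3 * k + e) * (3 * k + e))
  ring = solve-∀
  k³≤ : 6 * (k * k * k) ≤ T
  k³≤ = ≤-trans (*-monoʳ-≤ 6 (≤-trans (*-monoʳ-≤ (k * k) (m≤m+n k s)) (≤-trans (m≤m+n _ _)
    (≤-trans (objective≤max (n ∸ t) t middle) (m≤m+n _ (t C 3)))))) lower

-- Extremal graphs and the theorem

record Extremal (t : ℕ) (h : Graph3 n) : Set where
  field
    κ        : Fin n → K
    class-𝟘  : class κ 𝟘 ≡ t
    balanced : BalancedK (class κ)
    klein≡   : ∀ x y z → h x y z ≡ klein κ x y z

module _ {t : ℕ} {h : Graph3 n} (1≤t : 1 ≤ t) (sc : Scale t n) (H : Is3Graph h) (free : Free t h)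
  (lower : 6 * exValue n t ≤ size h) where
  open Scale sc

  private
    L : LargeThird t (n ∸ t)
    L = largeThird 1≤t sc

    core : Core u h
    core = core-exists H free (6 * (t + 2)) (2 * ratio t) u n≤u
      (≤-trans (*-monoˡ-≤ u (m≤m+n 216 8784)) 9000u≤n)
      (*-monoʳ-≤ 2 (≤-trans (*-mono-≤ {1} {9000} (s≤s z≤n) (m≤n+m 1 t)) ≤-refl)) 1≤u big (dense L t≤n lower)

    open Typed H free u t≤u 9000u≤n core

    w a b c : ℕ
    w = class colour 𝟘
    a = class colour 𝟙
    b = class colour 𝟚
    c = class colour 𝟛

    a≥ : n ≤ 8 * a
    a≥ = class-large {𝟙} λ ()
    b≥ : n ≤ 8 * b
    b≥ = class-large {𝟚} λ ()
    c≥ : n ≤ 8 * c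
    c≥ = class-large {𝟛} λ ()

    positive : ∀ {x} → n ≤ 8 * x → 1 ≤ x
    positive le = n≢0⇒n>0 λ { refl → contradiction (≤-trans 1≤n le) λ () }

    count : w + (a + b + c) ≡ n
    count = class-total colour

    below : (τ : Triple (n ∸ t)) → 6 * (Triple.value τ t + t C 3) ≤ size h
    below τ = ≤-trans (*-monoʳ-≤ 6 (+-monoˡ-≤ (t C 3) (objective≤max (n ∸ t) t τ))) lower

    size-h≤ : size h ≤ 6 * (objective w a b c + w C 3)
    size-h≤ = ≤-trans (≤-trans (m≤m+n (size h) _) size-fine) (≤-reflexive (klein-size-objective colour))

    -- The construction with w vertices in Q bounds `h` from above, but moving t - w vertices of a
    -- part into Q improves it strictly, to a value not above the assumed size of `h`.
    not-less : ¬ w < t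
    not-less w<t = contra (m≤n⇒∃[o]m+o≡n (<⇒≤ w<t)) (m≤n⇒∃[o]m+o≡n s≤a)
      where
      t≤a : t + t + t + 10 + t ≤ a
      t≤a = *-cancelˡ-≤ 8 (≤-trans (≤-trans (m≤m+n _ (8968 * t + 8920)) (≤-trans (≤-reflexive (ring t)) 9000t≤n)) a≥)
        where
        ring : ∀ t → 8 * (t + t + t + 10 + t) + (8968 * t + 8920) ≡ 9000 * (t + 1)
        ring = solve-∀
      s≤a : t ≤ a
      s≤a = ≤-trans (m≤n+m t (t + t + t + 10)) t≤a
      contra : (∃ λ s → w + s ≡ t) → (∃ λ o → t + o ≡ a) → ⊥
      contra (s , ws) (o , ta) = <-irrefl refl (begin-strict
        6 * (objective w a b c + w C 3)             ≡⟨ cong (λ x → 6 * (objective w x b c + w C 3)) (sym a≡) ⟩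
        6 * (objective w (a′ + s) b c + w C 3)      <⟨ *-monoʳ-< 6 (+-mono-<-≤ better (C3-mono (<⇒≤ w<t))) ⟩
        6 * (objective (w + s) a′ b c + t C 3)      ≡⟨ cong (λ x → 6 * (objective x a′ b c + t C 3)) ws ⟩
        6 * (objective t a′ b c + t C 3)            ≤⟨ below τ ⟩
        size h                                      ≤⟨ size-h≤ ⟩
        6 * (objective w a b c + w C 3)             ∎)
        where
        open ≤-Reasoning
        -- This is a - s without subtraction, as t + o is a and w + s is t.
        a′ = w + o
        a≡ : a′ + s ≡ a
        a≡ = trans (shuffle w o s) (trans (cong (_+ o) ws) ta)
          where
          shuffle : ∀ w o s → w + o + s ≡ w + s + o
          shuffle = solve-∀
        s≥1 : 1 ≤ s
        s≥1 = +-cancelˡ-≤ w _ _ (≤-trans (≤-reflexive (+-comm w 1)) (≤-trans w<t (≤-reflexive (sym ws))))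
        s≤t : s ≤ t
        s≤t = ≤-trans (m≤n+m s w) (≤-reflexive ws)
        a′-large : 3 * t + 10 ≤ a′
        a′-large = +-cancelʳ-≤ s _ _ (≤-trans (+-monoʳ-≤ (3 * t + 10) s≤t)
          (≤-trans (≤-trans (≤-reflexive (ring t)) t≤a) (≤-reflexive (sym a≡))))
          where
          ring : ∀ t → 3 * t + 10 + t ≡ t + t + t + 10 + t
          ring = solve-∀
        n≤9a′ : n ≤ 9 * a′
        n≤9a′ = *-cancelˡ-≤ 8 (lin (8928 * t + 9000) (+-mono-≤ (+-mono-≤ (+-mono-≤ (*-monoʳ-≤ 9 a≥) (*-monoʳ-≤ 72 (≤-reflexive (sym a≡)))) (*-monoʳ-≤ 72 s≤t)) 9000t≤n)
          (ring n a a′ s t))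
          where
          ring : ∀ n a a′ s t → 8 * n + (9 * (8 * a) + 72 * (a′ + s) + 72 * t + n) + (8928 * t + 9000)
               ≡ 8 * (9 * a′) + (9 * n + 72 * a + 72 * s + 9000 * (t + 1))
          ring = solve-∀
        a′bc≤ : a′ + b + c + t ≡ n
        a′bc≤ = trans (cong (a′ + b + c +_) (sym ws)) (trans (shuffle a′ b c w s) (trans (cong (λ x → w + (x + b + c)) a≡) count))
          where
          shuffle : ∀ a b c w s → a + b + c + (w + s) ≡ w + (a + s + b + c)
          shuffle = solve-∀
        τ : Triple (n ∸ t)
        τ = triple a′ b c (≤-trans (≤-trans (s≤s z≤n) (m≤n+m 10 (3 * t))) a′-large) (positive b≥) (positive c≥)
          (sym (trans (cong (_∸ t) (sym a′bc≤)) (m+n∸n≡m (a′ + b + c) t)))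
        better : objective w (a′ + s) b c < objective (w + s) a′ b c
        better = refill-Q w s a′ b c s≥1 (≤-trans (≤-reflexive (cong (λ x → 3 * x + 10) ws)) a′-large)
          (≤-trans (≤-trans (m≤m+n _ t) (≤-reflexive a′bc≤)) n≤9a′)

    -- The fine bound would compare `h` with too large a construction, so the coarse one is set
    -- against the triple in which the w - t surplus vertices join the first part.
    not-more : ¬ t < w
    not-more t<w = contra (m≤n⇒∃[o]m+o≡n (<⇒≤ t<w))
      where
      contra : (∃ λ s → t + s ≡ w) → ⊥
      contra (s , ts) = empty-Q t s a b c n u (size h) s≥1 1≤u u≤n (≤-trans (≤-reflexive ts) class-few) b≥ c≥
        (subst (λ w → size h + 3 * (t * (a + b + c)) ≤ 6 * (a * b * c) + 3 * (t * (a * a + b * b + c * c)) + 4 * (n * (w * w))) (sym ts) size-coarse)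
        (≤-trans (*-monoʳ-≤ 6 (m≤m+n (objective t (a + s) b c) (t C 3))) (below τ))
        where
        s≥1 : 1 ≤ s
        s≥1 = +-cancelˡ-≤ t _ _ (≤-trans (≤-reflexive (+-comm t 1)) (≤-trans t<w (≤-reflexive (sym ts))))
        τ : Triple (n ∸ t)
        τ = triple (a + s) b c (≤-trans (positive a≥) (m≤m+n a s)) (positive b≥) (positive c≥)
          (sym (trans (cong (_∸ t) (sym (trans (shuffle a b c t s) (trans (cong (_+ (a + b + c)) ts) count)))) (m+n∸n≡m (a + s + b + c) t)))
          where
          shuffle : ∀ a b c t s → a + s + b + c + t ≡ t + s + (a + b + c)
          shuffle = solve-∀

    w≡t : w ≡ t
    w≡t = ≤-antisym (≮⇒≥ not-more) (≮⇒≥ not-less)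

    sum≡ : a + b + c ≡ n ∸ t
    sum≡ = sym (trans (cong₂ _∸_ (sym count) (sym w≡t)) (m+n∸m≡n w (a + b + c)))

    size-klein : size (klein colour) ≡ 6 * (objective t a b c + t C 3)
    size-klein = trans (klein-size-objective colour) (cong (λ w → 6 * (objective w a b c + w C 3)) w≡t)

  extremal : Extremal t h
  extremal = record
    { κ = colour ; class-𝟘 = w≡t
    ; balanced = Balanced⇒K (class colour) (max⇒balanced L a b c (positive a≥) (positive b≥) (positive c≥) sum≡
        (+-cancelʳ-≤ (t C 3) _ _ (*-cancelˡ-≤ 6 (≤-trans lower (≤-trans (≤-trans (m≤m+n (size h) _) size-fine) (≤-reflexive size-klein))))))
    ; klein≡ = extremal⇒klein 1≤u 1≤n (≤-trans (≤-reflexive size-klein)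
        (below (triple a b c (positive a≥) (positive b≥) (positive c≥) sum≡))) }

cons-classes : ∀ {t} → t ≤ n → class (consColour {n} t) 𝟘 ≡ t × BalancedK (class (consColour {n} t)) ×
               total (class (consColour {n} t)) ≡ n ∸ t
cons-classes {t = t} t≤n with m≤n⇒∃[o]m+o≡n t≤n
... | m , refl = cons-class-𝟘 t m , cons-balanced t m , trans (cons-total t m) (sym (m+n∸m≡n t m))

module _ {t : ℕ} (1≤t : 1 ≤ t) (sc : Scale t n) where
  private
    L : LargeThird t (n ∸ t)
    L = largeThird 1≤t sc

    total-colours : (κ : Fin n → K) → class κ 𝟘 ≡ t → total (class κ) ≡ n ∸ t
    total-colours κ e = sym (trans (cong₂ _∸_ (sym (class-total κ)) (sym e)) (m+n∸m≡n (class κ 𝟘) _))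

    balance : (N : K → ℕ) → BalancedK N → Balanced (N 𝟙) (N 𝟚) (N 𝟛)
    balance N b = (b {𝟙} {𝟚} (λ ()) (λ ()) , b {𝟚} {𝟙} (λ ()) (λ ()))
                , (b {𝟚} {𝟛} (λ ()) (λ ()) , b {𝟛} {𝟚} (λ ()) (λ ()))
                , (b {𝟙} {𝟛} (λ ()) (λ ()) , b {𝟛} {𝟙} (λ ()) (λ ()))

  klein-numEdges : (E : Graph3 n) (κ : Fin n → K) → class κ 𝟘 ≡ t → BalancedK (class κ) →
                   (∀ x y z → hyper E x y z ≡ klein κ x y z) → numEdges E ≡ exValue n t
  klein-numEdges E κ e b same = *-cancelˡ-≡ _ _ 6 (trans (sym (size-hyper E)) (trans (∑₃-cong λ x y z → cong ⟦_⟧ (same x y z))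
    (trans (klein-size-objective κ) (cong (6 *_) (trans (cong (λ w → objective w (class κ 𝟙) (class κ 𝟚) (class κ 𝟛) + w C 3) e)
      (cong (_+ t C 3) (balanced⇒max L (class κ 𝟙) (class κ 𝟚) (class κ 𝟛) (total-colours κ e) (balance (class κ) b))))))))

  extremal-hyper : (E : Graph3 n) → FsimFree t E → exValue n t ≤ numEdges E → Extremal t (hyper E)
  extremal-hyper E free le = extremal 1≤t sc (hyper-3graph E) (FsimFree⇒Free E free)
    (≤-trans (*-monoʳ-≤ 6 le) (≤-reflexive (sym (size-hyper E))))

  extremal-numEdges : (E : Graph3 n) → Extremal t (hyper E) → numEdges E ≡ exValue n t
  extremal-numEdges E ex = klein-numEdges E κ class-𝟘 balanced klein≡
    where open Extremal ex

  -- A graph with at least the claimed number of edges is extremal, hence has exactly that number.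
  upper-bound : (E : Graph3 n) → FsimFree t E → numEdges E ≤ exValue n t
  upper-bound E free with ≤-total (numEdges E) (exValue n t)
  ... | inj₁ le = le
  ... | inj₂ ge = ≤-reflexive (extremal-numEdges E (extremal-hyper E free ge))

  construction : Graph3 n
  construction = consEdge n t

  private
    κᶜ : Fin n → K
    κᶜ = consColour t

    classes = cons-classes {n = n} {t} (Scale.t≤n sc)

    hyper-construction : ∀ x y z → hyper construction x y z ≡ klein κᶜ x y z
    hyper-construction = 3graph-ext (hyper-3graph construction) (klein-3graph κᶜ)
      λ x y z p q → trans (hyper-inc construction p q) (consEdge-klein t x y z)

  construction-free : FsimFree t construction
  construction-free = Free⇒FsimFree construction
    (Free-cong (λ x y z → sym (hyper-construction x y z)) (klein-free κᶜ (≤-reflexive (proj₁ classes))))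

  construction-size : numEdges construction ≡ exValue n t
  construction-size = klein-numEdges construction κᶜ (proj₁ classes) (proj₁ (proj₂ classes)) hyper-construction

  extremal⇒iso : (E : Graph3 n) → Extremal t (hyper E) → IsoToConstruction n t E
  extremal⇒iso E ex = proj₁ recoloured , iso
    where
    open Extremal ex
    -- The part sizes agree with those of the construction only up to order. An automorphism of the
    -- colours matches the parts first; after that the class sizes coincide and `recolour` supplies
    -- the bijection.
    matched : ∃ λ (ρ : Aut) → ∀ x → x ≢ 𝟘 → class κᶜ x ≡ class κ (Aut.to ρ x)
    matched = balanced-match (class κᶜ) (class κ) (proj₁ (proj₂ classes)) balanced
      (trans (proj₂ (proj₂ classes)) (sym (total-colours κ class-𝟘)))
    ρ = proj₁ matched
    κ′ : Fin n → K
    κ′ v = Aut.from ρ (κ v)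
    class-κ′ : ∀ x → class κ′ x ≡ class κ (Aut.to ρ x)
    class-κ′ x = ∑-cong λ v → cong ⟦_⟧ (iff⇒≡ (both (κ v)))
      where
      both : ∀ c → ((Aut.from ρ c =ᴷ x) iff (c =ᴷ Aut.to ρ x)) ≡ true
      both c with Aut.from ρ c =ᴷ x in e
      ... | true  = trans (cong (_=ᴷ Aut.to ρ x) (trans (sym (Aut.to-from ρ c)) (cong (Aut.to ρ) (=ᴷ⇒≡ _ x e)))) (=ᴷ-refl _)
      ... | false = cong not (¬-not λ f → true≢false
                      (trans (cong (_=ᴷ x) (trans (cong (Aut.from ρ) (=ᴷ⇒≡ c _ f)) (Aut.from-to ρ x))) (=ᴷ-refl x)) e)
    same-classes : ∀ x → class κ′ x ≡ class κᶜ x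
    same-classes x with x ≟ᴷ 𝟘
    ... | yes refl = trans (class-κ′ 𝟘) (trans (cong (class κ) (Aut.fixes ρ)) (trans class-𝟘 (sym (proj₁ classes))))
    ... | no ne    = trans (class-κ′ x) (sym (proj₂ matched x ne))
    recoloured : ∃ λ (π : Permutation n n) → ∀ v → κᶜ (π ⟨$⟩ʳ v) ≡ κ′ v
    recoloured = recolour κ′ κᶜ same-classes
    iso : ∀ x y z → toℕ x < toℕ y → toℕ y < toℕ z →
          E x y z ≡ consEdge n t (proj₁ recoloured ⟨$⟩ʳ x) (proj₁ recoloured ⟨$⟩ʳ y) (proj₁ recoloured ⟨$⟩ʳ z)
    iso x y z p q = begin
      E x y z                    ≡⟨ hyper-inc E p q ⟨
      hyper E x y z              ≡⟨ klein≡ x y z ⟩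
      klein κ x y z              ≡⟨ klein-aut (ρ ⁻ᴬ) κ x y z ⟨
      klein κ′ x y z             ≡⟨ klein-permute κ′ κᶜ (proj₁ recoloured) (proj₂ recoloured) x y z ⟩
      klein κᶜ _ _ _             ≡⟨ consEdge-klein t _ _ _ ⟨
      consEdge n t _ _ _         ∎
      where open ≡-Reasoning

  iso⇒numEdges : (E : Graph3 n) → IsoToConstruction n t E → numEdges E ≡ exValue n t
  iso⇒numEdges E (σ , iso) = trans (*-cancelˡ-≡ _ _ 6 (begin
    6 * numEdges E             ≡⟨ size-hyper E ⟨
    size (hyper E)             ≡⟨ ∑₃-cong (λ x y z → cong ⟦_⟧ (hyper≡ x y z)) ⟩
    size (klein κ′)            ≡⟨ size-permute (klein κ′) (klein κᶜ) σ (klein-permute κ′ κᶜ σ (λ _ → refl)) ⟩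
    size (klein κᶜ)            ≡⟨ ∑₃-cong (λ x y z → cong ⟦_⟧ (sym (hyper-construction x y z))) ⟩
    size (hyper construction)  ≡⟨ size-hyper construction ⟩
    6 * numEdges construction  ∎)) construction-size
    where
    open ≡-Reasoning
    κ′ : Fin n → K
    κ′ v = κᶜ (σ ⟨$⟩ʳ v)
    hyper≡ : ∀ x y z → hyper E x y z ≡ klein κ′ x y z
    hyper≡ = 3graph-ext (hyper-3graph E) (klein-3graph κ′) λ x y z p q →
      trans (hyper-inc E p q) (trans (iso x y z p q) (trans (consEdge-klein t _ _ _)
        (sym (klein-permute κ′ κᶜ σ (λ _ → refl) x y z))))

theorem1p3 : (t : ℕ) → 1 ≤ t →
    Σ ℕ λ N → (n : ℕ) → N ≤ n →
    ExEquals n t (exValue n t) ×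
    (∀ a b c → 1 ≤ a → 1 ≤ b → 1 ≤ c → a + b + c ≡ n ∸ t →
    a ≤ suc b → b ≤ suc a → b ≤ suc c → c ≤ suc b → a ≤ suc c → c ≤ suc a →
    objective t a b c ≡ maxObjective (n ∸ t) t) ×
    (∀ (E : Graph3 n) → FsimFree t E →
    (numEdges E ≡ exValue n t) ⇔ IsoToConstruction n t E)
theorem1p3 t 1≤t = threshold t , λ n N≤n →
  let sc = scale t n N≤n in
    ((construction 1≤t sc , construction-free 1≤t sc , construction-size 1≤t sc) , upper-bound 1≤t sc)
  , (λ a b c _ _ _ e ab ba bc cb ac ca → balanced⇒max (largeThird 1≤t sc) a b c e ((ab , ba) , (bc , cb) , (ac , ca)))
  , λ E free → mk⇔
      (λ e → extremal⇒iso 1≤t sc E (extremal-hyper 1≤t sc E free (≤-reflexive (sym e))))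
      (iso⇒numEdges 1≤t sc E)
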